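{- Over any field $\mathbb{F}$, $\mathbf{VP}_2^{\mathrm{weak}}\subsetneq\mathbf{VP}_2^{\mathrm{gen}}$.
   Context: An algebraic branching program (ABP) over $\mathbb{F}$ is a DAG with source $s$ and sink $t$, vertices assigned to layers, edges going from layer $i$ to layer $i+1$ and labelled by affine linear forms; width = max layer size, size = number of vertices, value = sum over $s$-$t$ paths of the products of edge labels. A weak ABP has edge labels of the form $\alpha x_i+\beta$ with $\alpha,\beta\in\mathbb{F}$; a general ABP allows arbitrary affine linear forms $\sum_i\alpha_ix_i+\beta$. $\mathbf{VP}_2^{\mathrm{weak}}$ (resp. $\mathbf{VP}_2^{\mathrm{gen}}$) is the class of families of polynomials (in polynomially many variables) computable by polynomial-size width-2 weak (resp. general) ABPs. -}

module Defs where

open import Level using (Level; _⊔_) renaming (suc to lsuc)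
open import Algebra.Bundles using (CommutativeRing)
open import Data.Nat using (ℕ; zero; suc; _≤_; s≤s; z≤n)
import Data.Nat as N
import Data.Fin as Fin
open import Data.Fin using (Fin)
open import Data.Product using (Σ; ∃; _×_; _,_)
open import Relation.Nullary using (¬_)

record Field (c ℓ : Level) : Set (lsuc (c ⊔ ℓ)) where
  field
    commutativeRing : CommutativeRing c ℓ
  open CommutativeRing commutativeRing public
  field
    0≉1     : ¬ (0# ≈ 1#)
    inverse : ∀ x → ¬ (x ≈ 0#) → ∃ λ y → (x * y) ≈ 1#

module _ {c ℓ : Level} (F : Field c ℓ) where
  private module F = Field F
  K = F.Carrier

  -- The polynomial ring F[x_0, …, x_{m-1}]: expressions modulo the
  -- congruence generated by the commutative-semiring axioms and the
  -- requirement that constants form a ring homomorphism F → F[x]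
  -- (this is the free commutative F-algebra on m generators).

  data Poly (m : ℕ) : Set c where
    var  : Fin m → Poly m
    con  : K → Poly m
    _⊕_  : Poly m → Poly m → Poly m
    _⊛_  : Poly m → Poly m → Poly m

  infixl 6 _⊕_
  infixl 7 _⊛_
  infix 4 _≋_

  0p 1p : ∀ {m} → Poly m
  0p = con F.0#
  1p = con F.1#

  data _≋_ {m : ℕ} : Poly m → Poly m → Set (c ⊔ ℓ) where
    ≋-refl  : ∀ {p} → p ≋ p
    ≋-sym   : ∀ {p q} → p ≋ q → q ≋ p
    ≋-trans : ∀ {p q r} → p ≋ q → q ≋ r → p ≋ r
    ⊕-cong  : ∀ {p p′ q q′} → p ≋ p′ → q ≋ q′ → p ⊕ q ≋ p′ ⊕ q′
    ⊛-cong  : ∀ {p p′ q q′} → p ≋ p′ → q ≋ q′ → p ⊛ q ≋ p′ ⊛ q′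
    ⊕-assoc : ∀ p q r → (p ⊕ q) ⊕ r ≋ p ⊕ (q ⊕ r)
    ⊕-comm  : ∀ p q → p ⊕ q ≋ q ⊕ p
    ⊕-idˡ   : ∀ p → 0p ⊕ p ≋ p
    ⊛-assoc : ∀ p q r → (p ⊛ q) ⊛ r ≋ p ⊛ (q ⊛ r)
    ⊛-comm  : ∀ p q → p ⊛ q ≋ q ⊛ p
    ⊛-idˡ   : ∀ p → 1p ⊛ p ≋ p
    distribˡ : ∀ p q r → p ⊛ (q ⊕ r) ≋ (p ⊛ q) ⊕ (p ⊛ r)
    zeroˡ   : ∀ p → 0p ⊛ p ≋ 0p
    con-cong : ∀ {a b} → a F.≈ b → con a ≋ con b
    con-+   : ∀ a b → con (a F.+ b) ≋ con a ⊕ con b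
    con-*   : ∀ a b → con (a F.* b) ≋ con a ⊛ con b

  sumP : ∀ {m} k → (Fin k → Poly m) → Poly m
  sumP zero    f = 0p
  sumP (suc k) f = f Fin.zero ⊕ sumP k (λ i → f (Fin.suc i))

  -- weak label: α x_i + β, or a constant β (relevant when there is no
  -- variable; otherwise it is the case α = 0)
  data WeakLabel (m : ℕ) : Set c where
    wconst : K → WeakLabel m
    wlin   : Fin m → K → K → WeakLabel m

  ⟦_⟧w : ∀ {m} → WeakLabel m → Poly m
  ⟦ wconst β ⟧w     = con β
  ⟦ wlin i α β ⟧w   = con α ⊛ var i ⊕ con β

  GenLabel : ℕ → Set c
  GenLabel m = (Fin m → K) × K

  ⟦_⟧g : ∀ {m} → GenLabel m → Poly m
  ⟦ (α , β) ⟧g = sumP _ (λ i → con (α i) ⊛ var i) ⊕ con β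

  -- Width-2 layered ABPs.  A `Prog Lab k` describes the layers from the
  -- source layer {s} (size 1) up to a current last layer of size k;
  -- each new layer has size 1 or 2 and comes with a label for every
  -- pair (u in previous layer, v in new layer) (a missing edge is the
  -- same as an edge labelled 0, which is a legal label of either kind).

  data Prog (Lab : Set c) : ℕ → Set c where
    start : Prog Lab 1
    step  : ∀ {j} (k : ℕ) → 1 ≤ k → k ≤ 2 →
            Prog Lab j → (Fin j → Fin k → Lab) → Prog Lab k

  size : ∀ {Lab k} → Prog Lab k → ℕ
  size start            = 1
  size (step k _ _ P _) = size P N.+ k

  -- value at each vertex of the last layer: sum over all paths from s
  -- to that vertex of the product of the labels
  valueAt : ∀ {m Lab k} → (Lab → Poly m) → Prog Lab k → Fin k → Poly m
  valueAt ⟦_⟧ start            v = 1p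
  valueAt ⟦_⟧ (step {j} k _ _ P lab) v =
    sumP j (λ u → valueAt ⟦_⟧ P u ⊛ ⟦ lab u v ⟧)

  -- A width-2 ABP: at least one step (s ≠ t) and last layer = {t}.
  record ABP (Lab : Set c) : Set c where
    constructor abp
    field
      {j}   : ℕ
      body  : Prog Lab j
      lastLab : Fin j → Fin 1 → Lab

  prog : ∀ {Lab} → ABP Lab → Prog Lab 1
  prog (abp body lastLab) = step 1 (s≤s z≤n)
                              (s≤s z≤n) body lastLab

  abpSize : ∀ {Lab} → ABP Lab → ℕ
  abpSize A = size (prog A)

  abpValue : ∀ {m Lab} → (Lab → Poly m) → ABP Lab → Poly m
  abpValue ⟦_⟧ A = valueAt ⟦_⟧ (prog A) Fin.zero

  PolyBounded : (ℕ → ℕ) → Set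
  PolyBounded f = ∃ λ c′ → ∀ n → f n ≤ c′ N.* n N.^ c′ N.+ c′

  record Family : Set c where
    field
      nvars : ℕ → ℕ
      poly  : (n : ℕ) → Poly (nvars n)
  open Family public

  InVP₂ : (Lab : ℕ → Set c) → (∀ {m} → Lab m → Poly m) → Family → Set (c ⊔ ℓ)
  InVP₂ Lab ⟦_⟧ f =
    PolyBounded (nvars f) ×
    ∃ λ s → PolyBounded s ×
      (∀ n → ∃ λ (A : ABP (Lab (nvars f n))) →
         abpSize A ≤ s n × abpValue ⟦_⟧ A ≋ poly f n)

  VP₂weak : Family → Set (c ⊔ ℓ)
  VP₂weak = InVP₂ WeakLabel ⟦_⟧w

  VP₂gen : Family → Set (c ⊔ ℓ)
  VP₂gen = InVP₂ GenLabel ⟦_⟧g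

{-# OPTIONS --safe #-}
module Submission where

-- The separating family is constant, equal to f = L₁² + L₂ with L₁ and L₂ sums of
-- disjoint sets of nine variables.  A weak program of width two is a product of 2 × 2
-- matrices in which every entry involves one variable.  Call such a matrix singular
-- when, some variables being fixed already, the remaining ones can be given values
-- (possibly in a quadratic extension of the field) that make its determinant vanish.
-- If it is not singular, it has the form A + B x for a single variable x and its
-- determinant is a nonzero constant.
--
-- Fixing the variables of a singular matrix makes it an outer product, so that the
-- restriction of f factors as (part before) · (part after).  Restrictions of f that
-- fix at most eight variables are irreducible, because they are linear with
-- coefficient 1 in some variable of L₂.  Moreover a product of nonsingular matrices
-- between constant vectors is never a unit times such a restriction: it is a
-- combination of continuants of affine forms, and along a curve contained in the zero
-- set of the restriction on which nonconstant affine forms have positive degree, these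
-- have strictly increasing degrees.  Going through the singular matrices from left to
-- right, it follows that the part before each of them is a unit; but then the
-- nonsingular matrices after the last one compute a restriction of f.
--
-- Equality in the field is not decidable, but every case distinction is made on the
-- way to a contradiction, hence under a double negation.

open import Defs
open import Level using (Level; _⊔_) renaming (suc to lsuc)
open import Algebra.Bundles using (CommutativeRing; RawRing)
open import Algebra.Solver.Ring.AlmostCommutativeRing using (fromCommutativeRing; _-Raw-AlmostCommutative⟶_)
import Algebra.Properties.Ring
import Algebra.Properties.Semiring.Mult.TCOptimised
import Algebra.Solver.Ring
open import Data.Bool using (Bool; true; false; not; _∨_; if_then_else_)
open import Data.Empty using (⊥; ⊥-elim)
open import Data.Fin as Fin using (Fin; _↑ˡ_; _↑ʳ_; splitAt)
import Data.Fin.Properties as FinP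
open import Data.List using (List; []; _∷_; _++_; length; lookup)
import Data.List.Membership.DecPropositional as DecMembership
open import Data.List.Membership.Propositional using (_∈_; _∉_)
open import Data.List.Membership.Propositional.Properties using (∈-++⁺ˡ; ∈-++⁺ʳ)
open import Data.List.Properties using (length-++)
open import Data.List.Relation.Unary.All using (All; []; _∷_)
open import Data.List.Relation.Unary.Any using (index; here)
import Data.List.Relation.Unary.Any.Properties as AnyP
open import Data.Maybe using (Maybe; just; nothing)
open import Data.Nat using (ℕ; zero; suc)
import Data.Nat as N
import Data.Nat.Properties as NP
open import Data.Product using (∃; _×_; _,_; proj₁; proj₂)
open import Data.Sum using (_⊎_; inj₁; inj₂; [_,_])
open import Relation.Binary.PropositionalEquality as ≡ using (_≡_)
import Relation.Binary.Reasoning.Setoid as SetoidReasoning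
open import Relation.Nullary using (¬_; yes; no)
open import Relation.Nullary.Decidable using (⌊_⌋; ¬¬-excluded-middle)
open import Relation.Nullary.Negation using (contradiction)

-- The square is what makes f hard: an affine polynomial such as x + z is a product of two shears
-- with one variable each, all nonsingular. Once L₁ enters quadratically, the zero set of a
-- restriction to one variable x of L₁ and one variable z of L₂ is a parabola, along which x has
-- degree 1 and z degree 2, so that no nonconstant affine form in them becomes constant. The linear
-- L₂ allows z to be solved for without division. A quadratic extension is needed because the
-- determinant of a matrix in a single variable can be a quadratic without a root. Each singular
-- matrix may enlarge the field again, so restrictions are treated over an arbitrary field with a
-- homomorphism from F. The number of fixed variables must not grow likewise: the earlier assignment
-- is forgotten at each singular matrix, which is possible because the unrestricted product so far
-- is kept; only the transition fixes the variables of two matrices at once. Polynomials are given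
-- up to a generated congruence, so that nonzero ones are recognised through homomorphisms, mostly
-- into power series.

-- Ring normalisation in an abstract ring: a coefficient is a formal difference
-- m − n of naturals, so that equality of coefficients is decidable.
module Solver {c ℓ} (R : CommutativeRing c ℓ) where
  open CommutativeRing R renaming (distribˡ to *-distribˡ)
  open Algebra.Properties.Ring ring
  open Algebra.Properties.Semiring.Mult.TCOptimised semiring using (×-homo-+; ×1-homo-*) renaming (_×_ to _·_)
  open SetoidReasoning setoid

  private
    Diff : RawRing _ _
    Diff = record
      { Carrier = ℕ × ℕ
      ; _≈_     = _≡_
      ; _+_     = λ (a , b) (c , d) → a N.+ c , b N.+ d
      ; _*_     = λ (a , b) (c , d) → a N.* c N.+ b N.* d , a N.* d N.+ b N.* c
      ; -_      = λ (a , b) → b , a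
      ; 0#      = 0 , 0
      ; 1#      = 1 , 0
      }

    -- The separate clause for `zero` makes the coefficients 0 and 1 denote `0#` and `1#`
    -- themselves, so that `:0` and `:1` match the terms in goals and the unit laws of `morphism`
    -- are `refl`.
    ⟦_⟧d : ℕ × ℕ → Carrier
    ⟦ a , zero ⟧d  = a · 1#
    ⟦ a , suc b ⟧d = a · 1# - suc b · 1#

    ⟦⟧d-difference : ∀ a b → ⟦ a , b ⟧d ≈ a · 1# - b · 1#
    ⟦⟧d-difference a zero    = sym (trans (+-congˡ -0#≈0#) (+-identityʳ (a · 1#)))
    ⟦⟧d-difference a (suc b) = refl

    interchange : ∀ a b c d → (a + b) + (c + d) ≈ (a + c) + (b + d)
    interchange a b c d = begin
      (a + b) + (c + d) ≈⟨ +-assoc a b (c + d) ⟩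
      a + (b + (c + d)) ≈⟨ +-congˡ (sym (+-assoc b c d)) ⟩
      a + ((b + c) + d) ≈⟨ +-congˡ (+-congʳ (+-comm b c)) ⟩
      a + ((c + b) + d) ≈⟨ +-congˡ (+-assoc c b d) ⟩
      a + (c + (b + d)) ≈⟨ sym (+-assoc a c (b + d)) ⟩
      (a + c) + (b + d) ∎

    difference-+ : ∀ a b c d → (a + c) - (b + d) ≈ (a - b) + (c - d)
    difference-+ a b c d = begin
      (a + c) - (b + d)     ≈⟨ +-congˡ (sym (-‿+-comm b d)) ⟩
      (a + c) + (- b - d)   ≈⟨ interchange a c (- b) (- d) ⟩
      (a - b) + (c - d)     ∎

    difference-* : ∀ a b c d → (a * c + b * d) - (a * d + b * c) ≈ (a - b) * (c - d)
    difference-* a b c d = sym (begin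
      (a - b) * (c - d)                             ≈⟨ distribʳ (c - d) a (- b) ⟩
      a * (c - d) + - b * (c - d)                   ≈⟨ +-cong (*-distribˡ a c (- d)) (*-distribˡ (- b) c (- d)) ⟩
      (a * c + a * - d) + (- b * c + - b * - d)     ≈⟨ +-congˡ (+-comm (- b * c) (- b * - d)) ⟩
      (a * c + a * - d) + (- b * - d + - b * c)     ≈⟨ interchange (a * c) (a * - d) (- b * - d) (- b * c) ⟩
      (a * c + - b * - d) + (a * - d + - b * c)     ≈⟨ +-cong (+-congˡ neg-neg) (+-cong (sym (-‿distribʳ-* a d)) (sym (-‿distribˡ-* b c))) ⟩
      (a * c + b * d) + (- (a * d) + - (b * c))     ≈⟨ +-congˡ (-‿+-comm (a * d) (b * c)) ⟩
      (a * c + b * d) - (a * d + b * c)             ∎)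
      where
      neg-neg : - b * - d ≈ b * d
      neg-neg = trans (sym (-‿distribˡ-* b (- d))) (trans (-‿cong (sym (-‿distribʳ-* b d))) (-‿involutive (b * d)))

    ·-products : ∀ a c b d → (a N.* c N.+ b N.* d) · 1# ≈ a · 1# * (c · 1#) + b · 1# * (d · 1#)
    ·-products a c b d = trans (×-homo-+ 1# (a N.* c) (b N.* d)) (+-cong (×1-homo-* a c) (×1-homo-* b d))

    abstract
      +-homo-d : ∀ x y → ⟦ RawRing._+_ Diff x y ⟧d ≈ ⟦ x ⟧d + ⟦ y ⟧d
      +-homo-d (a , b) (c , d) = begin
          ⟦ a N.+ c , b N.+ d ⟧d                        ≈⟨ ⟦⟧d-difference (a N.+ c) (b N.+ d) ⟩
          (a N.+ c) · 1# - (b N.+ d) · 1#               ≈⟨ +-cong (×-homo-+ 1# a c) (-‿cong (×-homo-+ 1# b d)) ⟩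
          (a · 1# + c · 1#) - (b · 1# + d · 1#)         ≈⟨ difference-+ (a · 1#) (b · 1#) (c · 1#) (d · 1#) ⟩
          (a · 1# - b · 1#) + (c · 1# - d · 1#)         ≈⟨ +-cong (⟦⟧d-difference a b) (⟦⟧d-difference c d) ⟨
          ⟦ a , b ⟧d + ⟦ c , d ⟧d                       ∎

      *-homo-d : ∀ x y → ⟦ RawRing._*_ Diff x y ⟧d ≈ ⟦ x ⟧d * ⟦ y ⟧d
      *-homo-d (a , b) (c , d) = begin
          ⟦ a N.* c N.+ b N.* d , a N.* d N.+ b N.* c ⟧d
            ≈⟨ ⟦⟧d-difference (a N.* c N.+ b N.* d) (a N.* d N.+ b N.* c) ⟩
          (a N.* c N.+ b N.* d) · 1# - (a N.* d N.+ b N.* c) · 1#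
            ≈⟨ +-cong (·-products a c b d) (-‿cong (·-products a d b c)) ⟩
          _ ≈⟨ difference-* (a · 1#) (b · 1#) (c · 1#) (d · 1#) ⟩
          (a · 1# - b · 1#) * (c · 1# - d · 1#)         ≈⟨ *-cong (⟦⟧d-difference a b) (⟦⟧d-difference c d) ⟨
          ⟦ a , b ⟧d * ⟦ c , d ⟧d                       ∎

      -‿homo-d : ∀ x → ⟦ RawRing.-_ Diff x ⟧d ≈ - ⟦ x ⟧d
      -‿homo-d (a , b) = begin
          ⟦ b , a ⟧d                                    ≈⟨ ⟦⟧d-difference b a ⟩
          b · 1# - a · 1#                               ≈⟨ +-comm (b · 1#) (- (a · 1#)) ⟩
          - (a · 1#) + b · 1#                           ≈⟨ +-congˡ (-‿involutive (b · 1#)) ⟨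
          - (a · 1#) - - (b · 1#)                       ≈⟨ -‿+-comm (a · 1#) (- (b · 1#)) ⟩
          - (a · 1# - b · 1#)                           ≈⟨ -‿cong (⟦⟧d-difference a b) ⟨
          - ⟦ a , b ⟧d                                  ∎

    morphism : Diff -Raw-AlmostCommutative⟶ fromCommutativeRing R
    morphism = record
      { ⟦_⟧ = ⟦_⟧d ; +-homo = +-homo-d ; *-homo = *-homo-d ; -‿homo = -‿homo-d ; 0-homo = refl ; 1-homo = refl }

    abstract
      ⟦⟧d-cross : ∀ a b c d → a N.+ d ≡ c N.+ b → ⟦ a , b ⟧d ≈ ⟦ c , d ⟧d
      ⟦⟧d-cross a b c d eq = begin
        ⟦ a , b ⟧d                                        ≈⟨ ⟦⟧d-difference a b ⟩
        a · 1# - b · 1#                                   ≈⟨ +-identityʳ _ ⟨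
        (a · 1# - b · 1#) + 0#                            ≈⟨ +-congˡ (-‿inverseʳ (d · 1#)) ⟨
        (a · 1# - b · 1#) + (d · 1# - d · 1#)             ≈⟨ difference-+ _ _ _ _ ⟨
        (a · 1# + d · 1#) - (b · 1# + d · 1#)             ≈⟨ +-cong sum-eq (-‿cong (+-comm _ _)) ⟩
        (c · 1# + b · 1#) - (d · 1# + b · 1#)             ≈⟨ difference-+ _ _ _ _ ⟩
        (c · 1# - d · 1#) + (b · 1# - b · 1#)             ≈⟨ +-congˡ (-‿inverseʳ (b · 1#)) ⟩
        (c · 1# - d · 1#) + 0#                            ≈⟨ +-identityʳ _ ⟩
        c · 1# - d · 1#                                   ≈⟨ ⟦⟧d-difference c d ⟨
        ⟦ c , d ⟧d                                        ∎
        where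
        sum-eq : a · 1# + d · 1# ≈ c · 1# + b · 1#
        sum-eq = trans (sym (×-homo-+ 1# a d)) (trans (reflexive (≡.cong (_· 1#) eq)) (×-homo-+ 1# c b))

    _≟d_ : ∀ x y → Maybe (⟦ x ⟧d ≈ ⟦ y ⟧d)
    (a , b) ≟d (c , d) with a N.+ d N.≟ c N.+ b
    ... | no _ = nothing
    ... | yes eq = just (⟦⟧d-cross a b c d eq)

  open Algebra.Solver.Ring Diff (fromCommutativeRing R) morphism _≟d_ public
    using (solve; _:+_; _:*_; _:-_; :-_; _:=_; con)

  pattern :0 = con (0 , 0)
  pattern :1 = con (1 , 0)

-- Ring homomorphisms, units and domains

private variable
  a b c d e ℓ : Level

record RingHom (R : CommutativeRing a b) (S : CommutativeRing c d) : Set (a ⊔ b ⊔ c ⊔ d) where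
  private
    module R = CommutativeRing R
    module S = CommutativeRing S
  field
    ⟦_⟧    : R.Carrier → S.Carrier
    ⟦⟧-cong : ∀ {x y} → x R.≈ y → ⟦ x ⟧ S.≈ ⟦ y ⟧
    +-homo : ∀ x y → ⟦ x R.+ y ⟧ S.≈ ⟦ x ⟧ S.+ ⟦ y ⟧
    *-homo : ∀ x y → ⟦ x R.* y ⟧ S.≈ ⟦ x ⟧ S.* ⟦ y ⟧
    1-homo : ⟦ R.1# ⟧ S.≈ S.1#

  open Algebra.Properties.Ring S.ring using (+-cancelˡ)

  0-homo : ⟦ R.0# ⟧ S.≈ S.0#
  0-homo = +-cancelˡ _ _ _ (S.trans (S.sym (+-homo R.0# R.0#))
    (S.trans (⟦⟧-cong (R.+-identityˡ R.0#)) (S.sym (S.+-identityʳ _))))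

  -‿homo : ∀ x → ⟦ R.- x ⟧ S.≈ S.- ⟦ x ⟧
  -‿homo x = +-cancelˡ ⟦ x ⟧ _ _ (S.trans (S.sym (+-homo x (R.- x)))
    (S.trans (⟦⟧-cong (R.-‿inverseʳ x)) (S.trans 0-homo (S.sym (S.-‿inverseʳ _)))))

open RingHom using (⟦_⟧)

id-hom : (R : CommutativeRing a b) → RingHom R R
id-hom R = record
  { ⟦_⟧ = λ x → x ; ⟦⟧-cong = λ x≈y → x≈y
  ; +-homo = λ _ _ → refl ; *-homo = λ _ _ → refl ; 1-homo = refl }
  where open CommutativeRing R

infixr 9 _∘h_
_∘h_ : {R : CommutativeRing a b} {S : CommutativeRing c d} {T : CommutativeRing e ℓ} →
       RingHom S T → RingHom R S → RingHom R T
_∘h_ {T = T} g f = record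
  { ⟦_⟧ = λ x → ⟦ g ⟧ (⟦ f ⟧ x)
  ; ⟦⟧-cong = λ x≈y → g.⟦⟧-cong (f.⟦⟧-cong x≈y)
  ; +-homo = λ x y → trans (g.⟦⟧-cong (f.+-homo x y)) (g.+-homo _ _)
  ; *-homo = λ x y → trans (g.⟦⟧-cong (f.*-homo x y)) (g.*-homo _ _)
  ; 1-homo = trans (g.⟦⟧-cong f.1-homo) g.1-homo
  }
  where
  module g = RingHom g
  module f = RingHom f
  open CommutativeRing T

Unit : (R : CommutativeRing a b) → CommutativeRing.Carrier R → Set (a ⊔ b)
Unit R x = ∃ λ y → x * y ≈ 1#
  where open CommutativeRing R

unit-hom : {R : CommutativeRing a b} {S : CommutativeRing c d} (f : RingHom R S) →
           ∀ {x} → Unit R x → Unit S (⟦ f ⟧ x)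
unit-hom {S = S} f (y , xy≈1) = ⟦ f ⟧ y , trans (sym (*-homo _ y)) (trans (⟦⟧-cong xy≈1) 1-homo)
  where
  open RingHom f hiding (⟦_⟧)
  open CommutativeRing S

-- Negative form: a disjunction of the two equations could not be proved without deciding equality.
IsDomain : (R : CommutativeRing a b) → Set (a ⊔ b)
IsDomain R = ∀ {x y} → x * y ≈ 0# → ¬ x ≈ 0# → ¬ y ≈ 0# → ⊥
  where open CommutativeRing R

FieldHom : Field a b → Field c d → Set (a ⊔ b ⊔ c ⊔ d)
FieldHom K L = RingHom (Field.commutativeRing K) (Field.commutativeRing L)

module FieldProperties (K : Field c ℓ) where
  open Field K
  open SetoidReasoning setoid
  open Solver commutativeRing

  unit⇒≉0 : ∀ {x} → Unit commutativeRing x → ¬ x ≈ 0#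
  unit⇒≉0 (y , xy≈1) x≈0 = 0≉1 (trans (sym (trans (*-comm 0# y) (zeroʳ y))) (trans (*-congʳ (sym x≈0)) xy≈1))

  *-cancel-0 : ∀ {x y} → ¬ x ≈ 0# → x * y ≈ 0# → y ≈ 0#
  *-cancel-0 {x} {y} x≉0 xy≈0 with inverse x x≉0
  ... | z , xz≈1 = begin
    y           ≈⟨ *-identityˡ y ⟨
    1# * y      ≈⟨ *-congʳ xz≈1 ⟨
    x * z * y   ≈⟨ solve 3 (λ x y z → x :* z :* y := z :* (x :* y)) refl x y z ⟩
    z * (x * y) ≈⟨ *-congˡ xy≈0 ⟩
    z * 0#      ≈⟨ zeroʳ z ⟩
    0#          ∎

  field-isDomain : IsDomain commutativeRing
  field-isDomain xy≈0 x≉0 y≉0 = y≉0 (*-cancel-0 x≉0 xy≈0)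

-- The polynomial ring and its universal property

module PolyRing (K : Field c ℓ) (m : ℕ) where
  private
    module K = Field K
    P = Poly K m
    infix 4 _≈_
    _≈_ : P → P → Set _
    _≈_ = _≋_ K

  private
    neg : P → P
    neg p = con (K.- K.1#) ⊛ p

    ⊕-idʳ : ∀ p → (p ⊕ 0p K) ≈ p
    ⊕-idʳ p = ≋-trans (⊕-comm p _) (⊕-idˡ p)

    ⊛-idʳ : ∀ p → (p ⊛ 1p K) ≈ p
    ⊛-idʳ p = ≋-trans (⊛-comm p _) (⊛-idˡ p)

    distribʳ : ∀ r p q → ((p ⊕ q) ⊛ r) ≈ ((p ⊛ r) ⊕ (q ⊛ r))
    distribʳ r p q = ≋-trans (⊛-comm _ r) (≋-trans (distribˡ r p q) (⊕-cong (⊛-comm r p) (⊛-comm r q)))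

    neg-inverseˡ : ∀ p → (neg p ⊕ p) ≈ 0p K
    neg-inverseˡ p = ≋-trans (⊕-cong ≋-refl (≋-sym (⊛-idˡ p)))
      (≋-trans (≋-sym (distribʳ p _ _))
      (≋-trans (⊛-cong (≋-trans (≋-sym (con-+ _ _)) (con-cong (K.-‿inverseˡ K.1#))) ≋-refl)
      (zeroˡ p)))

  polyRing : CommutativeRing c (c ⊔ ℓ)
  polyRing = record
    { Carrier = P ; _≈_ = _≈_ ; _+_ = _⊕_ ; _*_ = _⊛_ ; -_ = neg ; 0# = 0p K ; 1# = 1p K
    ; isCommutativeRing = record
      { isRing = record
        { +-isAbelianGroup = record
          { isGroup = record
            { isMonoid = record
              { isSemigroup = record
                { isMagma = record
                  { isEquivalence = record { refl = ≋-refl ; sym = ≋-sym ; trans = ≋-trans }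
                  ; ∙-cong = ⊕-cong }
                ; assoc = ⊕-assoc }
              ; identity = ⊕-idˡ , ⊕-idʳ }
            ; inverse = neg-inverseˡ , λ p → ≋-trans (⊕-comm p (neg p)) (neg-inverseˡ p)
            ; ⁻¹-cong = ⊛-cong ≋-refl }
          ; comm = ⊕-comm }
        ; *-cong = ⊛-cong
        ; *-assoc = ⊛-assoc
        ; *-identity = ⊛-idˡ , ⊛-idʳ
        ; distrib = distribˡ , distribʳ
        }
      ; *-comm = ⊛-comm
      }
    }

  con-hom : RingHom K.commutativeRing polyRing
  con-hom = record
    { ⟦_⟧ = con ; ⟦⟧-cong = con-cong ; +-homo = con-+ ; *-homo = con-* ; 1-homo = ≋-refl }

open PolyRing public using (polyRing; con-hom)

module _ (K : Field c ℓ) {m : ℕ} {R : CommutativeRing d e}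
         (ι : RingHom (Field.commutativeRing K) R) (ρ : Fin m → CommutativeRing.Carrier R) where
  private
    module ι = RingHom ι
    open CommutativeRing R

    eval : Poly K m → Carrier
    eval (var i) = ρ i
    eval (con x) = ι.⟦ x ⟧
    eval (p ⊕ q) = eval p + eval q
    eval (p ⊛ q) = eval p * eval q

    eval-cong : ∀ {p q} → _≋_ K p q → eval p ≈ eval q
    eval-cong ≋-refl = refl
    eval-cong (≋-sym eq) = sym (eval-cong eq)
    eval-cong (≋-trans eq eq′) = trans (eval-cong eq) (eval-cong eq′)
    eval-cong (⊕-cong eq eq′) = +-cong (eval-cong eq) (eval-cong eq′)
    eval-cong (⊛-cong eq eq′) = *-cong (eval-cong eq) (eval-cong eq′)
    eval-cong (⊕-assoc p q r) = +-assoc _ _ _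
    eval-cong (⊕-comm p q) = +-comm _ _
    eval-cong (⊕-idˡ p) = trans (+-congʳ ι.0-homo) (+-identityˡ _)
    eval-cong (⊛-assoc p q r) = *-assoc _ _ _
    eval-cong (⊛-comm p q) = *-comm _ _
    eval-cong (⊛-idˡ p) = trans (*-congʳ ι.1-homo) (*-identityˡ _)
    eval-cong (distribˡ p q r) = CommutativeRing.distribˡ R _ _ _
    eval-cong (zeroˡ p) = trans (*-congʳ ι.0-homo) (trans (CommutativeRing.zeroˡ R _) (sym ι.0-homo))
    eval-cong (con-cong eq) = ι.⟦⟧-cong eq
    eval-cong (con-+ x y) = ι.+-homo x y
    eval-cong (con-* x y) = ι.*-homo x y

  eval-hom : RingHom (polyRing K m) R
  eval-hom = record
    { ⟦_⟧ = eval ; ⟦⟧-cong = eval-cong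
    ; +-homo = λ _ _ → refl ; *-homo = λ _ _ → refl ; 1-homo = ι.1-homo }

-- Half of the universal property: two ways of substituting are compared on variables and constants
-- alone, without any normal form.
poly-hom-unique : (K : Field c ℓ) {m : ℕ} {R : CommutativeRing d e} (f g : RingHom (polyRing K m) R) →
  (∀ i → CommutativeRing._≈_ R (⟦ f ⟧ (var i)) (⟦ g ⟧ (var i))) →
  (∀ x → CommutativeRing._≈_ R (⟦ f ⟧ (con x)) (⟦ g ⟧ (con x))) →
  ∀ p → CommutativeRing._≈_ R (⟦ f ⟧ p) (⟦ g ⟧ p)
poly-hom-unique K {R = R} f g on-var on-con = go
  where
  open CommutativeRing R
  module f = RingHom f
  module g = RingHom g
  go : ∀ p → ⟦ f ⟧ p ≈ ⟦ g ⟧ p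
  go (var i) = on-var i
  go (con x) = on-con x
  go (p ⊕ q) = trans (f.+-homo p q) (trans (+-cong (go p) (go q)) (sym (g.+-homo p q)))
  go (p ⊛ q) = trans (f.*-homo p q) (trans (*-cong (go p) (go q)) (sym (g.*-homo p q)))

-- Power series and degrees

module PowerSeries (R : CommutativeRing a b) where
  open CommutativeRing R renaming (zeroˡ to *-zeroˡ)
  open SetoidReasoning setoid
  open Solver R

  -- Finite support is not recorded; `HasDegree` supplies it where it matters. The same ring serves
  -- to read off coefficients and to receive curves.
  Series : Set a
  Series = ℕ → Carrier

  infix 4 _≈ˢ_
  _≈ˢ_ : Series → Series → Set b
  f ≈ˢ g = ∀ n → f n ≈ g n

  tail : Series → Series
  tail f n = f (suc n)

  infixl 6 _+ˢ_
  _+ˢ_ : Series → Series → Series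
  (f +ˢ g) n = f n + g n

  infixl 7 _*ˢ_
  _*ˢ_ : Series → Series → Series
  (f *ˢ g) zero    = f 0 * g 0
  (f *ˢ g) (suc n) = f 0 * g (suc n) + (tail f *ˢ g) n

  constant : Carrier → Series
  constant x zero    = x
  constant x (suc n) = 0#

  t : Series
  t 1 = 1#
  t _ = 0#

  *ˢ-cong : ∀ {f f′ g g′} → f ≈ˢ f′ → g ≈ˢ g′ → f *ˢ g ≈ˢ f′ *ˢ g′
  *ˢ-cong f≈ g≈ zero    = *-cong (f≈ 0) (g≈ 0)
  *ˢ-cong f≈ g≈ (suc n) = +-cong (*-cong (f≈ 0) (g≈ (suc n))) (*ˢ-cong (λ k → f≈ (suc k)) g≈ n)

  -- The product recurses on its left factor; this mirror image is what closes the induction for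
  -- commutativity.
  *ˢ-sucʳ : ∀ f g n → (f *ˢ g) (suc n) ≈ f (suc n) * g 0 + (f *ˢ tail g) n
  *ˢ-sucʳ f g zero    = +-comm _ _
  *ˢ-sucʳ f g (suc n) = begin
    f 0 * g (suc (suc n)) + (tail f *ˢ g) (suc n)
      ≈⟨ +-congˡ (*ˢ-sucʳ (tail f) g n) ⟩
    f 0 * g (suc (suc n)) + (f (suc (suc n)) * g 0 + (tail f *ˢ tail g) n)
      ≈⟨ solve 3 (λ x y z → x :+ (y :+ z) := y :+ (x :+ z)) refl _ _ _ ⟩
    f (suc (suc n)) * g 0 + (f 0 * g (suc (suc n)) + (tail f *ˢ tail g) n) ∎

  *ˢ-comm : ∀ f g → f *ˢ g ≈ˢ g *ˢ f
  *ˢ-comm f g zero    = *-comm _ _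
  *ˢ-comm f g (suc n) = begin
    f 0 * g (suc n) + (tail f *ˢ g) n ≈⟨ +-cong (*-comm _ _) (*ˢ-comm (tail f) g n) ⟩
    g (suc n) * f 0 + (g *ˢ tail f) n ≈⟨ *ˢ-sucʳ g f n ⟨
    (g *ˢ f) (suc n)                  ∎

  *ˢ-scale : ∀ x g h → (λ n → x * g n) *ˢ h ≈ˢ (λ n → x * (g *ˢ h) n)
  *ˢ-scale x g h zero    = *-assoc _ _ _
  *ˢ-scale x g h (suc n) = begin
    x * g 0 * h (suc n) + ((λ n → x * g (suc n)) *ˢ h) n ≈⟨ +-congˡ (*ˢ-scale x (tail g) h n) ⟩
    x * g 0 * h (suc n) + x * (tail g *ˢ h) n
      ≈⟨ solve 4 (λ x y z w → x :* y :* z :+ x :* w := x :* (y :* z :+ w)) refl _ _ _ _ ⟩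
    x * (g 0 * h (suc n) + (tail g *ˢ h) n) ∎

  *ˢ-distribʳ : ∀ h f g → (f +ˢ g) *ˢ h ≈ˢ f *ˢ h +ˢ g *ˢ h
  *ˢ-distribʳ h f g zero    = distribʳ _ _ _
  *ˢ-distribʳ h f g (suc n) = begin
    (f 0 + g 0) * h (suc n) + ((tail f +ˢ tail g) *ˢ h) n
      ≈⟨ +-congˡ (*ˢ-distribʳ h (tail f) (tail g) n) ⟩
    (f 0 + g 0) * h (suc n) + ((tail f *ˢ h) n + (tail g *ˢ h) n)
      ≈⟨ solve 5 (λ x y z u v → (x :+ y) :* z :+ (u :+ v) := (x :* z :+ u) :+ (y :* z :+ v)) refl _ _ _ _ _ ⟩
    (f *ˢ h) (suc n) + (g *ˢ h) (suc n) ∎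

  *ˢ-assoc : ∀ f g h → (f *ˢ g) *ˢ h ≈ˢ f *ˢ (g *ˢ h)
  *ˢ-assoc f g h zero    = *-assoc _ _ _
  *ˢ-assoc f g h (suc n) = begin
    f 0 * g 0 * h (suc n) + (tail (f *ˢ g) *ˢ h) n
      ≈⟨ +-congˡ (*ˢ-distribʳ h (λ k → f 0 * g (suc k)) (tail f *ˢ g) n) ⟩
    f 0 * g 0 * h (suc n) + (((λ k → f 0 * g (suc k)) *ˢ h) n + ((tail f *ˢ g) *ˢ h) n)
      ≈⟨ +-congˡ (+-cong (*ˢ-scale (f 0) (tail g) h n) (*ˢ-assoc (tail f) g h n)) ⟩
    f 0 * g 0 * h (suc n) + (f 0 * (tail g *ˢ h) n + (tail f *ˢ (g *ˢ h)) n)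
      ≈⟨ solve 5 (λ x y z u v → x :* y :* z :+ (x :* u :+ v) := x :* (y :* z :+ u) :+ v) refl _ _ _ _ _ ⟩
    f 0 * (g 0 * h (suc n) + (tail g *ˢ h) n) + (tail f *ˢ (g *ˢ h)) n ∎

  *ˢ-zeroˡ : ∀ g n → ((λ _ → 0#) *ˢ g) n ≈ 0#
  *ˢ-zeroˡ g zero    = *-zeroˡ _
  *ˢ-zeroˡ g (suc n) = trans (+-cong (*-zeroˡ _) (*ˢ-zeroˡ g n)) (+-identityʳ 0#)

  constant-*ˢ : ∀ x g → constant x *ˢ g ≈ˢ (λ n → x * g n)
  constant-*ˢ x g zero    = refl
  constant-*ˢ x g (suc n) = trans (+-congˡ (*ˢ-zeroˡ g n)) (+-identityʳ _)

  *ˢ-identityˡ : ∀ g → constant 1# *ˢ g ≈ˢ g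
  *ˢ-identityˡ g n = trans (constant-*ˢ 1# g n) (*-identityˡ _)

  t-*ˢ : ∀ g n → (t *ˢ g) (suc n) ≈ g n
  t-*ˢ g n = begin
    0# * g (suc n) + (tail t *ˢ g) n ≈⟨ +-cong (*-zeroˡ _) (*ˢ-cong tail-t (λ _ → refl) n) ⟩
    0# + (constant 1# *ˢ g) n        ≈⟨ +-identityˡ _ ⟩
    (constant 1# *ˢ g) n             ≈⟨ *ˢ-identityˡ g n ⟩
    g n                              ∎
    where
    tail-t : tail t ≈ˢ constant 1#
    tail-t zero    = refl
    tail-t (suc n) = refl

  seriesRing : CommutativeRing a b
  seriesRing = record
    { Carrier = Series ; _≈_ = _≈ˢ_ ; _+_ = _+ˢ_ ; _*_ = _*ˢ_ ; -_ = λ f n → - f n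
    ; 0# = λ _ → 0# ; 1# = constant 1#
    ; isCommutativeRing = record
      { isRing = record
        { +-isAbelianGroup = record
          { isGroup = record
            { isMonoid = record
              { isSemigroup = record
                { isMagma = record
                  { isEquivalence = record
                    { refl = λ _ → refl ; sym = λ eq n → sym (eq n) ; trans = λ eq eq′ n → trans (eq n) (eq′ n) }
                  ; ∙-cong = λ eq eq′ n → +-cong (eq n) (eq′ n) }
                ; assoc = λ f g h n → +-assoc _ _ _ }
              ; identity = (λ f n → +-identityˡ _) , λ f n → +-identityʳ _ }
            ; inverse = (λ f n → -‿inverseˡ _) , λ f n → -‿inverseʳ _
            ; ⁻¹-cong = λ eq n → -‿cong (eq n) }
          ; comm = λ f g n → +-comm _ _ }
        ; *-cong = *ˢ-cong
        ; *-assoc = *ˢ-assoc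
        ; *-identity = *ˢ-identityˡ , λ g n → trans (*ˢ-comm g (constant 1#) n) (*ˢ-identityˡ g n)
        ; distrib = (λ h f g n → trans (*ˢ-comm h (f +ˢ g) n) (trans (*ˢ-distribʳ h f g n) (+-cong (*ˢ-comm f h n) (*ˢ-comm g h n))))
                  , *ˢ-distribʳ
        }
      ; *-comm = *ˢ-comm
      }
    }

  constant-hom : RingHom R seriesRing
  constant-hom = record
    { ⟦_⟧ = constant
    ; ⟦⟧-cong = λ { x≈y zero → x≈y ; x≈y (suc n) → refl }
    ; +-homo = λ { x y zero → refl ; x y (suc n) → sym (+-identityʳ 0#) }
    ; *-homo = λ { x y zero → refl ; x y (suc n) → sym (trans (constant-*ˢ x (constant y) (suc n)) (zeroʳ x)) }
    ; 1-homo = λ _ → refl }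

  VanishesFrom : Series → ℕ → Set b
  VanishesFrom f d = ∀ {n} → d N.≤ n → f n ≈ 0#

  record HasDegree (f : Series) (d : ℕ) : Set b where
    field
      leading≉0 : ¬ f d ≈ 0#
      vanishes  : VanishesFrom f (suc d)
  open HasDegree public

  hasDegree-≉0 : ∀ {f d} → HasDegree f d → ¬ f ≈ˢ (λ _ → 0#)
  hasDegree-≉0 deg f≈0 = leading≉0 deg (f≈0 _)

  hasDegree-cong : ∀ {f g d} → f ≈ˢ g → HasDegree f d → HasDegree g d
  hasDegree-cong f≈g deg = record
    { leading≉0 = λ g≈0 → leading≉0 deg (trans (f≈g _) g≈0)
    ; vanishes  = λ d<n → trans (sym (f≈g _)) (vanishes deg d<n) }

  hasDegree-+ : ∀ {f g d} → HasDegree f d → VanishesFrom g d → HasDegree (f +ˢ g) d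
  hasDegree-+ deg g≈0 = record
    { leading≉0 = λ eq → leading≉0 deg (trans (sym (trans (+-congˡ (g≈0 NP.≤-refl)) (+-identityʳ _))) eq)
    ; vanishes  = λ d<n → trans (+-cong (vanishes deg d<n) (g≈0 (NP.<⇒≤ d<n))) (+-identityʳ 0#) }

  *ˢ-vanishes : ∀ {f g} d e → VanishesFrom f (suc d) → VanishesFrom g (suc e) → VanishesFrom (f *ˢ g) (suc (d N.+ e))
  *ˢ-vanishes zero e f≈0 g≈0 {suc n} e<n = trans
    (+-cong (trans (*-congˡ (g≈0 e<n)) (zeroʳ _)) (trans (*ˢ-cong (λ k → f≈0 (N.s≤s N.z≤n)) (λ _ → refl) n) (*ˢ-zeroˡ _ n)))
    (+-identityʳ 0#)
  *ˢ-vanishes (suc d) e f≈0 g≈0 {suc n} (N.s≤s d+e<n) = trans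
    (+-cong (trans (*-congˡ (g≈0 (NP.≤-trans (N.s≤s (NP.m≤n+m e (suc d))) (N.s≤s d+e<n)))) (zeroʳ _))
            (*ˢ-vanishes d e (λ d<k → f≈0 (N.s≤s d<k)) g≈0 d+e<n))
    (+-identityʳ 0#)

  *ˢ-leading : ∀ {f g} d e → VanishesFrom f (suc d) → VanishesFrom g (suc e) → (f *ˢ g) (d N.+ e) ≈ f d * g e
  *ˢ-leading zero zero f≈0 g≈0 = refl
  *ˢ-leading zero (suc e) f≈0 g≈0 = trans
    (+-congˡ (trans (*ˢ-cong (λ k → f≈0 (N.s≤s N.z≤n)) (λ _ → refl) e) (*ˢ-zeroˡ _ e))) (+-identityʳ _)
  *ˢ-leading (suc d) e f≈0 g≈0 = trans
    (+-cong (trans (*-congˡ (g≈0 (N.s≤s (NP.m≤n+m e d)))) (zeroʳ _))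
            (*ˢ-leading d e (λ d<k → f≈0 (N.s≤s d<k)) g≈0))
    (+-identityˡ _)

  hasDegree-* : IsDomain R → ∀ {f g d e} → HasDegree f d → HasDegree g e → HasDegree (f *ˢ g) (d N.+ e)
  hasDegree-* dom {d = d} {e} degf degg = record
    { leading≉0 = λ eq → dom (trans (sym (*ˢ-leading d e (vanishes degf) (vanishes degg))) eq) (leading≉0 degf) (leading≉0 degg)
    ; vanishes  = *ˢ-vanishes d e (vanishes degf) (vanishes degg) }

open PowerSeries using (seriesRing; constant-hom; HasDegree; VanishesFrom)

-- Polynomial rings over a field are domains

-- Peeling off the variable 0: every polynomial in suc m variables is a
-- polynomial in that variable with coefficients in m variables, and its
-- coefficients can be read off in the power series ring.
module _ (K : Field c ℓ) (m : ℕ) where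
  private
    module K = Field K
    module P = CommutativeRing (polyRing K m)
    module Q = CommutativeRing (polyRing K (suc m))
    module S = PowerSeries (polyRing K m)
    open Solver (polyRing K (suc m))
    open SetoidReasoning Q.setoid

    weaken : RingHom (polyRing K m) (polyRing K (suc m))
    weaken = eval-hom K (con-hom K (suc m)) (λ i → var (Fin.suc i))

    split-var : Fin (suc m) → ℕ → Poly K m
    split-var Fin.zero    = S.t
    split-var (Fin.suc i) = S.constant (var i)

    split : RingHom (polyRing K (suc m)) S.seriesRing
    split = eval-hom K (S.constant-hom ∘h con-hom K m) split-var

    horner : List (Poly K m) → Poly K (suc m)
    horner []       = Q.0#
    horner (x ∷ xs) = ⟦ weaken ⟧ x Q.+ var Fin.zero Q.* horner xs

    nth : List (Poly K m) → ℕ → Poly K m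
    nth []       n       = P.0#
    nth (x ∷ xs) zero    = x
    nth (x ∷ xs) (suc n) = nth xs n

    split-weaken : ∀ p → ⟦ split ⟧ (⟦ weaken ⟧ p) S.≈ˢ S.constant p
    split-weaken = poly-hom-unique K (split ∘h weaken) S.constant-hom (λ i n → P.refl) (λ x n → P.refl)

    split-horner : ∀ xs → ⟦ split ⟧ (horner xs) S.≈ˢ nth xs
    split-horner [] n = RingHom.0-homo S.constant-hom n
    split-horner (x ∷ xs) zero = P.trans (P.+-cong (split-weaken x 0) (P.trans (P.*-comm _ _) (P.zeroʳ _))) (P.+-identityʳ x)
    split-horner (x ∷ xs) (suc n) = P.trans
      (P.+-cong (split-weaken x (suc n)) (P.trans (S.t-*ˢ _ n) (split-horner xs n))) (P.+-identityˡ _)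

    HornerForm : Poly K (suc m) → Set _
    HornerForm p = ∃ λ xs → p Q.≈ horner xs

    hornerForm-cong : ∀ {p q} → p Q.≈ q → HornerForm q → HornerForm p
    hornerForm-cong p≈q (xs , eq) = xs , Q.trans p≈q eq

    horner-+ : ∀ xs ys → HornerForm (horner xs Q.+ horner ys)
    horner-+ [] ys = ys , Q.+-identityˡ _
    horner-+ xs@(_ ∷ _) [] = xs , Q.+-identityʳ _
    horner-+ (x ∷ xs) (y ∷ ys) with horner-+ xs ys
    ... | zs , eq = x P.+ y ∷ zs , (begin
      (⟦ weaken ⟧ x Q.+ T Q.* horner xs) Q.+ (⟦ weaken ⟧ y Q.+ T Q.* horner ys)
        ≈⟨ solve 5 (λ t x y u v → (x :+ t :* u) :+ (y :+ t :* v) := (x :+ y) :+ t :* (u :+ v)) Q.refl T _ _ _ _ ⟩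
      (⟦ weaken ⟧ x Q.+ ⟦ weaken ⟧ y) Q.+ T Q.* (horner xs Q.+ horner ys)
        ≈⟨ Q.+-congˡ (Q.*-congˡ eq) ⟩
      ⟦ weaken ⟧ (x P.+ y) Q.+ T Q.* horner zs ∎)
      where T = var Fin.zero

    hornerForm-+ : ∀ {p q} → HornerForm p → HornerForm q → HornerForm (p Q.+ q)
    hornerForm-+ (xs , p≈) (ys , q≈) = hornerForm-cong (Q.+-cong p≈ q≈) (horner-+ xs ys)

    horner-scale : ∀ x ys → HornerForm (⟦ weaken ⟧ x Q.* horner ys)
    horner-scale x [] = [] , Q.zeroʳ _
    horner-scale x (y ∷ ys) with horner-scale x ys
    ... | zs , eq = x P.* y ∷ zs , (begin
      ⟦ weaken ⟧ x Q.* (⟦ weaken ⟧ y Q.+ T Q.* horner ys)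
        ≈⟨ solve 4 (λ t x y u → x :* (y :+ t :* u) := x :* y :+ t :* (x :* u)) Q.refl T _ _ _ ⟩
      ⟦ weaken ⟧ x Q.* ⟦ weaken ⟧ y Q.+ T Q.* (⟦ weaken ⟧ x Q.* horner ys)
        ≈⟨ Q.+-congˡ (Q.*-congˡ eq) ⟩
      ⟦ weaken ⟧ (x P.* y) Q.+ T Q.* horner zs ∎)
      where T = var Fin.zero

    horner-0∷ : ∀ xs → var Fin.zero Q.* horner xs Q.≈ horner (P.0# ∷ xs)
    horner-0∷ xs = Q.sym (Q.+-identityˡ _)

    horner-* : ∀ xs ys → HornerForm (horner xs Q.* horner ys)
    horner-* [] ys = [] , Q.trans (Q.*-comm _ _) (Q.zeroʳ _)
    horner-* (x ∷ xs) ys with horner-* xs ys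
    ... | zs , eq = hornerForm-cong
      (Q.trans (Q.distribʳ _ _ _) (Q.+-congˡ (Q.trans (Q.*-assoc _ _ _) (Q.*-congˡ eq))))
      (hornerForm-+ (horner-scale x ys) (P.0# ∷ zs , horner-0∷ zs))

    horner-constant : ∀ x → ⟦ weaken ⟧ x Q.≈ horner (x ∷ [])
    horner-constant x = Q.sym (Q.trans (Q.+-congˡ (Q.zeroʳ _)) (Q.+-identityʳ _))

    hornerForm : ∀ p → HornerForm p
    hornerForm (var Fin.zero) = P.0# ∷ P.1# ∷ [] ,
      Q.trans (Q.sym (Q.*-identityʳ _)) (Q.trans (Q.*-congˡ (horner-constant P.1#)) (Q.sym (Q.+-identityˡ _)))
    hornerForm (var (Fin.suc i)) = var i ∷ [] , horner-constant (var i)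
    hornerForm (con x) = con x ∷ [] , horner-constant (con x)
    hornerForm (p ⊕ q) = hornerForm-+ (hornerForm p) (hornerForm q)
    hornerForm (p ⊛ q) with hornerForm p | hornerForm q
    ... | xs , p≈ | ys , q≈ = hornerForm-cong (Q.*-cong p≈ q≈) (horner-* xs ys)

    -- The list may end in zero coefficients, so its length does not give the degree; the last
    -- nonzero coefficient is sought from the far end, each comparison with zero being made under
    -- the double negation.
    horner-0-or-degree : ∀ xs → ¬ ¬ (horner xs Q.≈ Q.0# ⊎ ∃ (HasDegree _ (nth xs)))
    horner-0-or-degree [] k = k (inj₁ Q.refl)
    horner-0-or-degree (x ∷ xs) k = horner-0-or-degree xs λ
      { (inj₂ (d , deg)) → k (inj₂ (suc d , record
          { leading≉0 = S.leading≉0 deg ; vanishes = λ { (N.s≤s d<n) → S.vanishes deg d<n } }))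
      ; (inj₁ xs≈0) → ¬¬-excluded-middle λ
        { (yes x≈0) → k (inj₁ (begin
            ⟦ weaken ⟧ x Q.+ T Q.* horner xs ≈⟨ Q.+-cong (RingHom.⟦⟧-cong weaken x≈0) (Q.*-congˡ xs≈0) ⟩
            Q.0# Q.+ T Q.* Q.0#              ≈⟨ Q.trans (Q.+-identityˡ _) (Q.zeroʳ T) ⟩
            Q.0#                             ∎))
        ; (no x≉0) → k (inj₂ (0 , record
            { leading≉0 = x≉0
            -- A list that denotes the zero polynomial has zero entries, since `split` recovers them
            -- from the polynomial.
            ; vanishes = λ { {suc n} _ → P.trans (P.sym (split-horner xs n)) (P.trans (RingHom.⟦⟧-cong split xs≈0 n) (RingHom.0-homo split n)) } })) } }
      where T = var Fin.zero

  split-degree : ∀ p → ¬ p Q.≈ Q.0# → ¬ ¬ ∃ (HasDegree _ (⟦ split ⟧ p))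
  split-degree p p≉0 k with hornerForm p
  ... | xs , p≈ = horner-0-or-degree xs λ
    { (inj₁ xs≈0) → p≉0 (Q.trans p≈ xs≈0)
    ; (inj₂ (d , deg)) → k (d , S.hasDegree-cong
        (λ n → P.sym (P.trans (RingHom.⟦⟧-cong split p≈ n) (split-horner xs n))) deg) }

  -- The leading coefficients lie in the smaller ring, where their product is nonzero; hence the
  -- image of p q under `split` has a degree and cannot be zero.
  poly-suc-isDomain : IsDomain (polyRing K m) → IsDomain (polyRing K (suc m))
  poly-suc-isDomain dom {p} {q} pq≈0 p≉0 q≉0 =
    split-degree p p≉0 λ (d , degp) → split-degree q q≉0 λ (e , degq) →
    S.hasDegree-≉0 (S.hasDegree-* dom degp degq)
      (λ n → P.trans (RingHom.⟦⟧-cong split pq≈0 n) (RingHom.0-homo split n))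

poly-isDomain : (K : Field c ℓ) (m : ℕ) → IsDomain (polyRing K m)
poly-isDomain K zero {p} {q} pq≈0 p≉0 q≉0 =
  field-isDomain (RingHom.⟦⟧-cong value pq≈0) (nonzero p p≉0) (nonzero q q≉0)
  where
  open FieldProperties K
  module P = CommutativeRing (polyRing K 0)
  value : RingHom (polyRing K 0) (Field.commutativeRing K)
  value = eval-hom K (id-hom _) (λ ())
  con-value : ∀ p → p P.≈ con (⟦ value ⟧ p)
  con-value = poly-hom-unique K (id-hom _) (con-hom K 0 ∘h value) (λ ()) (λ _ → P.refl)
  nonzero : ∀ p → ¬ p P.≈ P.0# → ¬ Field._≈_ K (⟦ value ⟧ p) (Field.0# K)
  nonzero p p≉0 v≈0 = p≉0 (P.trans (con-value p) (con-cong v≈0))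
poly-isDomain K (suc m) = poly-suc-isDomain K m (poly-isDomain K m)

-- Roots of quadratics in field extensions

quadratic : (K : Field c ℓ) (let open Field K) → Carrier → Carrier → Carrier → Carrier → Carrier
quadratic K d₀ d₁ d₂ x = d₀ + d₁ * x + d₂ * (x * x)
  where open Field K

Rootless : (K : Field c ℓ) (let open Field K) → Carrier → Carrier → Set (c ⊔ ℓ)
Rootless K u v = ∀ r → ¬ (r * r + u * r + v ≈ 0#)
  where open Field K

-- The field K[ω] with ω² + uω + v = 0, for a quadratic without roots in K;
-- the pair (x , y) stands for x + yω.
module QuadraticExtension (K : Field c ℓ) (u v : Field.Carrier K)
  (no-root : Rootless K u v) where
  open Field K
  open FieldProperties K
  open Solver commutativeRing
  open SetoidReasoning setoid

  private
    E = Carrier × Carrier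

    infix 4 _≈ᴱ_
    _≈ᴱ_ : E → E → Set ℓ
    (x , y) ≈ᴱ (x′ , y′) = x ≈ x′ × y ≈ y′

    _*ᴱ_ : E → E → E
    (x , y) *ᴱ (z , w) = x * z - v * (y * w) , x * w + y * z - u * (y * w)

  extensionRing : CommutativeRing c ℓ
  extensionRing = record
    { Carrier = E ; _≈_ = _≈ᴱ_
    ; _+_ = λ (x , y) (z , w) → x + z , y + w ; _*_ = _*ᴱ_ ; -_ = λ (x , y) → - x , - y
    ; 0# = 0# , 0# ; 1# = 1# , 0#
    ; isCommutativeRing = record
      { isRing = record
        { +-isAbelianGroup = record
          { isGroup = record
            { isMonoid = record
              { isSemigroup = record
                { isMagma = record
                  { isEquivalence = record
                    { refl = refl , refl ; sym = λ (p , q) → sym p , sym q ; trans = λ (p , q) (p′ , q′) → trans p p′ , trans q q′ }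
                  ; ∙-cong = λ (p , q) (p′ , q′) → +-cong p p′ , +-cong q q′ }
                ; assoc = λ _ _ _ → +-assoc _ _ _ , +-assoc _ _ _ }
              ; identity = (λ _ → +-identityˡ _ , +-identityˡ _) , λ _ → +-identityʳ _ , +-identityʳ _ }
            ; inverse = (λ _ → -‿inverseˡ _ , -‿inverseˡ _) , λ _ → -‿inverseʳ _ , -‿inverseʳ _
            ; ⁻¹-cong = λ (p , q) → -‿cong p , -‿cong q }
          ; comm = λ _ _ → +-comm _ _ , +-comm _ _ }
        ; *-cong = λ (p , q) (p′ , q′) →
            +-cong (*-cong p p′) (-‿cong (*-congˡ (*-cong q q′))) ,
            +-cong (+-cong (*-cong p q′) (*-cong q p′)) (-‿cong (*-congˡ (*-cong q q′)))
        ; *-assoc = λ (a , b) (a′ , b′) (a″ , b″) →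
            solve 8 (λ u v a b a′ b′ a″ b″ →
              (a :* a′ :- v :* (b :* b′)) :* a″ :- v :* ((a :* b′ :+ b :* a′ :- u :* (b :* b′)) :* b″) :=
              a :* (a′ :* a″ :- v :* (b′ :* b″)) :- v :* (b :* (a′ :* b″ :+ b′ :* a″ :- u :* (b′ :* b″))))
              refl u v a b a′ b′ a″ b″ ,
            solve 8 (λ u v a b a′ b′ a″ b″ →
              (a :* a′ :- v :* (b :* b′)) :* b″ :+ (a :* b′ :+ b :* a′ :- u :* (b :* b′)) :* a″
                :- u :* ((a :* b′ :+ b :* a′ :- u :* (b :* b′)) :* b″) :=
              a :* (a′ :* b″ :+ b′ :* a″ :- u :* (b′ :* b″)) :+ b :* (a′ :* a″ :- v :* (b′ :* b″))
                :- u :* (b :* (a′ :* b″ :+ b′ :* a″ :- u :* (b′ :* b″))))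
              refl u v a b a′ b′ a″ b″
        ; *-identity =
            (λ (a , b) →
              solve 3 (λ v a b → :1 :* a :- v :* (:0 :* b) := a) refl v a b ,
              solve 3 (λ u a b → :1 :* b :+ :0 :* a :- u :* (:0 :* b) := b) refl u a b) ,
            (λ (a , b) →
              solve 3 (λ v a b → a :* :1 :- v :* (b :* :0) := a) refl v a b ,
              solve 3 (λ u a b → a :* :0 :+ b :* :1 :- u :* (b :* :0) := b) refl u a b)
        ; distrib =
            (λ (a , b) (a′ , b′) (a″ , b″) →
              solve 7 (λ v a b a′ b′ a″ b″ →
                a :* (a′ :+ a″) :- v :* (b :* (b′ :+ b″)) :=
                (a :* a′ :- v :* (b :* b′)) :+ (a :* a″ :- v :* (b :* b″))) refl v a b a′ b′ a″ b″ ,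
              solve 7 (λ u a b a′ b′ a″ b″ →
                a :* (b′ :+ b″) :+ b :* (a′ :+ a″) :- u :* (b :* (b′ :+ b″)) :=
                (a :* b′ :+ b :* a′ :- u :* (b :* b′)) :+ (a :* b″ :+ b :* a″ :- u :* (b :* b″))) refl u a b a′ b′ a″ b″) ,
            (λ (a , b) (a′ , b′) (a″ , b″) →
              solve 7 (λ v a b a′ b′ a″ b″ →
                (a′ :+ a″) :* a :- v :* ((b′ :+ b″) :* b) :=
                (a′ :* a :- v :* (b′ :* b)) :+ (a″ :* a :- v :* (b″ :* b))) refl v a b a′ b′ a″ b″ ,
              solve 7 (λ u a b a′ b′ a″ b″ →
                (a′ :+ a″) :* b :+ (b′ :+ b″) :* a :- u :* ((b′ :+ b″) :* b) :=
                (a′ :* b :+ b′ :* a :- u :* (b′ :* b)) :+ (a″ :* b :+ b″ :* a :- u :* (b″ :* b))) refl u a b a′ b′ a″ b″)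
        }
      ; *-comm = λ (a , b) (a′ , b′) →
          solve 5 (λ v a b a′ b′ → a :* a′ :- v :* (b :* b′) := a′ :* a :- v :* (b′ :* b)) refl v a b a′ b′ ,
          solve 5 (λ u a b a′ b′ → a :* b′ :+ b :* a′ :- u :* (b :* b′) := a′ :* b :+ b′ :* a :- u :* (b′ :* b)) refl u a b a′ b′
      }
    }

  norm : E → Carrier
  norm (x , y) = x * x - u * (x * y) + v * (y * y)

  -- For y ≉ 0 a zero of the norm exhibits − x / y as a root.
  norm-≉0 : ∀ z → ¬ z ≈ᴱ (0# , 0#) → ¬ norm z ≈ 0#
  norm-≉0 (x , y) z≉0 N≈0 = ¬¬-excluded-middle λ
    { (yes y≈0) → ¬¬-excluded-middle λ
      { (yes x≈0) → z≉0 (x≈0 , y≈0)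
      ; (no x≉0) → x≉0 (*-cancel-0 x≉0 (begin
          x * x                                   ≈⟨ solve 3 (λ u v x → x :* x := x :* x :- u :* (x :* :0) :+ v :* (:0 :* :0)) refl u v x ⟩
          x * x - u * (x * 0#) + v * (0# * 0#)    ≈⟨ +-cong (+-congˡ (-‿cong (*-congˡ (*-congˡ y≈0)))) (*-congˡ (*-cong y≈0 y≈0)) ⟨
          norm (x , y)                            ≈⟨ N≈0 ⟩
          0#                                      ∎)) }
    ; (no y≉0) → let (w , yw≈1) = inverse y y≉0 in no-root (- (x * w)) (begin
        - (x * w) * - (x * w) + u * - (x * w) + v
          ≈⟨ solve 4 (λ u v x w → :- (x :* w) :* :- (x :* w) :+ u :* :- (x :* w) :+ v
               := w :* w :* (x :* x) :- u :* (x :* w) :* :1 :+ v :* (:1 :* :1)) refl u v x w ⟩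
        w * w * (x * x) - u * (x * w) * 1# + v * (1# * 1#)
          ≈⟨ +-cong (+-congˡ (-‿cong (*-congˡ yw≈1))) (*-congˡ (*-cong yw≈1 yw≈1)) ⟨
        w * w * (x * x) - u * (x * w) * (y * w) + v * ((y * w) * (y * w))
          ≈⟨ solve 5 (λ u v x y w → w :* w :* (x :* x) :- u :* (x :* w) :* (y :* w) :+ v :* ((y :* w) :* (y :* w))
               := w :* w :* (x :* x :- u :* (x :* y) :+ v :* (y :* y))) refl u v x y w ⟩
        w * w * norm (x , y) ≈⟨ *-congˡ N≈0 ⟩
        w * w * 0#           ≈⟨ zeroʳ _ ⟩
        0#                   ∎) }

  extensionField : Field c ℓ
  extensionField = record
    { commutativeRing = extensionRing
    ; 0≉1 = λ (0≈1 , _) → 0≉1 0≈1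
    ; inverse = λ { z@(x , y) z≉0 → let (n , Nn≈1) = inverse (norm z) (norm-≉0 z z≉0) in
        -- The conjugate of x + yω is (x - uy) - yω, because the two roots sum to -u; here it is
        -- divided by the norm.
        ((x - u * y) * n , - y * n) ,
        (trans (solve 5 (λ u v x y n → x :* ((x :- u :* y) :* n) :- v :* (y :* (:- y :* n))
                 := (x :* x :- u :* (x :* y) :+ v :* (y :* y)) :* n) refl u v x y n) Nn≈1 ,
         solve 4 (λ u x y n → x :* (:- y :* n) :+ y :* ((x :- u :* y) :* n) :- u :* (y :* (:- y :* n))
                 := :0) refl u x y n) }
    }

  embed : RingHom commutativeRing extensionRing
  embed = record
    { ⟦_⟧ = λ x → x , 0#
    ; ⟦⟧-cong = λ eq → eq , refl
    ; +-homo = λ x y → refl , sym (+-identityʳ 0#)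
    ; *-homo = λ x y →
        solve 3 (λ v x y → x :* y := x :* y :- v :* (:0 :* :0)) refl v x y ,
        solve 3 (λ u x y → :0 := x :* :0 :+ :0 :* y :- u :* (:0 :* :0)) refl u x y
    ; 1-homo = refl , refl }

  root : E
  root = 0# , 1#

  private module E = CommutativeRing extensionRing

  root-isRoot : root E.* root E.+ ⟦ embed ⟧ u E.* root E.+ ⟦ embed ⟧ v E.≈ E.0#
  root-isRoot =
    solve 2 (λ u v → :0 :* :0 :- v :* (:1 :* :1) :+ (u :* :0 :- v :* (:0 :* :1)) :+ v := :0) refl u v ,
    solve 1 (λ u → :0 :* :1 :+ :1 :* :0 :- u :* (:1 :* :1) :+ (u :* :1 :+ :0 :* :0 :- u :* (:0 :* :1)) :+ :0 := :0) refl u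

-- The extension has the levels of `K`, so that extensions can be iterated and quantified over
-- uniformly.
record FieldExtension (K : Field c ℓ) : Set (lsuc (c ⊔ ℓ)) where
  field
    field′    : Field c ℓ
    embedding : FieldHom K field′

trivialExtension : (K : Field c ℓ) → FieldExtension K
trivialExtension K = record { field′ = K ; embedding = id-hom _ }

module _ (K : Field c ℓ) where
  open Field K
  open FieldProperties K
  open Solver commutativeRing
  open SetoidReasoning setoid

  RootOf : (d₀ d₁ d₂ : Carrier) → Set _
  RootOf d₀ d₁ d₂ = ∃ λ (L : FieldExtension K) →
    let open FieldExtension L
        ι = ⟦ embedding ⟧
    in ∃ λ r → Field._≈_ field′ (quadratic field′ (ι d₀) (ι d₁) (ι d₂) r) (Field.0# field′)

  -- Degree one is solved directly. Otherwise division by `d₂` makes the quadratic monic, and if it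
  -- has no root in `K`, adjoining ω supplies one. Which case occurs cannot be decided, hence the
  -- double negation.
  root-exists : ∀ d₀ d₁ d₂ → ¬ (d₁ ≈ 0# × d₂ ≈ 0#) → ¬ ¬ RootOf d₀ d₁ d₂
  root-exists d₀ d₁ d₂ nonconstant k = ¬¬-excluded-middle λ
    { (yes d₂≈0) → let (w , d₁w≈1) = inverse d₁ (λ d₁≈0 → nonconstant (d₁≈0 , d₂≈0)) in
        k (trivialExtension K , - (d₀ * w) , (begin
          d₀ + d₁ * - (d₀ * w) + d₂ * (- (d₀ * w) * - (d₀ * w))
            ≈⟨ +-congˡ (trans (*-congʳ d₂≈0) (trans (*-comm _ _) (zeroʳ _))) ⟩
          d₀ + d₁ * - (d₀ * w) + 0#
            ≈⟨ solve 3 (λ d₀ d₁ w → d₀ :+ d₁ :* :- (d₀ :* w) :+ :0 := d₀ :- d₀ :* (d₁ :* w)) refl d₀ d₁ w ⟩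
          d₀ - d₀ * (d₁ * w)
            ≈⟨ +-congˡ (-‿cong (*-congˡ d₁w≈1)) ⟩
          d₀ - d₀ * 1#
            ≈⟨ solve 1 (λ d₀ → d₀ :- d₀ :* :1 := :0) refl d₀ ⟩
          0# ∎))
    ; (no d₂≉0) → let (w , d₂w≈1) = inverse d₂ d₂≉0
                      u = d₁ * w
                      v = d₀ * w
                  in ¬¬-excluded-middle {A = ∃ λ r → r * r + u * r + v ≈ 0#} λ
      { (yes (r , r-root)) → k (trivialExtension K , r , monic⇒root (trivialExtension K) w d₂w≈1 r r-root)
      ; (no no-root) → let open QuadraticExtension K u v (λ r r-root → no-root (r , r-root))
                           L = record { field′ = extensionField ; embedding = embed }
                       in k (L , root , monic⇒root L w d₂w≈1 root root-isRoot) } }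
    where
    monic⇒root : (L : FieldExtension K) →
      let open FieldExtension L
          ι = ⟦ embedding ⟧
          module L = Field field′
      in ∀ w → d₂ * w ≈ 1# → ∀ r → r L.* r L.+ ι (d₁ * w) L.* r L.+ ι (d₀ * w) L.≈ L.0# →
      quadratic field′ (ι d₀) (ι d₁) (ι d₂) r L.≈ L.0#
    monic⇒root L w d₂w≈1 r r-root = L.trans
      (L.+-cong (L.+-cong (lower d₀) (L.*-congʳ (lower d₁))) L.refl)
      (L.trans (S.solve 5 (λ a b u v r → a S.:* v S.:+ a S.:* u S.:* r S.:+ a S.:* (r S.:* r)
                  S.:= a S.:* (r S.:* r S.:+ u S.:* r S.:+ v)) L.refl (ι d₂) (ι d₂) (ι (d₁ * w)) (ι (d₀ * w)) r)
      (L.trans (L.*-congˡ r-root) (L.zeroʳ _)))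
      where
      open FieldExtension L
      module L = Field field′
      module S = Solver L.commutativeRing
      open RingHom embedding renaming (⟦_⟧ to ι)
      lower : ∀ d → ι d L.≈ ι d₂ L.* ι (d * w)
      lower d = L.trans (⟦⟧-cong (trans (sym (*-identityʳ d)) (trans (*-congˡ (sym d₂w≈1))
        (solve 3 (λ d d₂ w → d :* (d₂ :* w) := d₂ :* (d :* w)) refl d d₂ w)))) (*-homo d₂ (d * w))

-- Two by two matrices over a ring

record Matrix (A : Set a) : Set a where
  constructor matrix
  field m₁₁ m₁₂ m₂₁ m₂₂ : A

mapMatrix : {A : Set a} {B : Set b} → (A → B) → Matrix A → Matrix B
mapMatrix f (matrix p q r s) = matrix (f p) (f q) (f r) (f s)

module MatrixOps (R : CommutativeRing a b) where
  open CommutativeRing R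

  Vector : Set a
  Vector = Carrier × Carrier

  infixl 7 _·ᵣ_ _·ᵥ_
  _·ᵣ_ : Vector → Matrix Carrier → Vector
  (x , y) ·ᵣ matrix p q r s = x * p + y * r , x * q + y * s

  _·_ : Matrix Carrier → Vector → Vector
  matrix p q r s · (x , y) = p * x + q * y , r * x + s * y

  _·ᵥ_ : Vector → Vector → Carrier
  (x , y) ·ᵥ (z , w) = x * z + y * w

  infix 4 _≈ᵥ_
  _≈ᵥ_ : Vector → Vector → Set b
  (x , y) ≈ᵥ (z , w) = x ≈ z × y ≈ w

  e₁ : Vector
  e₁ = 1# , 0#

  ·ᵥ-cong : ∀ {u u′ v v′} → u ≈ᵥ u′ → v ≈ᵥ v′ → u ·ᵥ v ≈ u′ ·ᵥ v′
  ·ᵥ-cong (p , q) (p′ , q′) = +-cong (*-cong p p′) (*-cong q q′)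

  ·ᵣ-cong : ∀ {u u′} M → u ≈ᵥ u′ → u ·ᵣ M ≈ᵥ u′ ·ᵣ M
  ·ᵣ-cong M (p , q) = +-cong (*-congʳ p) (*-congʳ q) , +-cong (*-congʳ p) (*-congʳ q)

  ·-assoc : ∀ u M v → (u ·ᵣ M) ·ᵥ v ≈ u ·ᵥ (M · v)
  ·-assoc (x , y) (matrix p q r s) (z , w) =
    solve 8 (λ x y p q r s z w → (x :* p :+ y :* r) :* z :+ (x :* q :+ y :* s) :* w :=
      x :* (p :* z :+ q :* w) :+ y :* (r :* z :+ s :* w)) refl x y p q r s z w
    where open Solver R

-- Weak programs are general programs

module Sums (F : Field c ℓ) {m : ℕ} where
  open CommutativeRing (polyRing F m)
  open SetoidReasoning setoid

  sumP-cong : ∀ k {f g : Fin k → Poly F m} → (∀ i → f i ≈ g i) → sumP F k f ≈ sumP F k g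
  sumP-cong zero    f≈g = refl
  sumP-cong (suc k) f≈g = +-cong (f≈g Fin.zero) (sumP-cong k (λ i → f≈g (Fin.suc i)))

  sumP-0 : ∀ k {f : Fin k → Poly F m} → (∀ i → f i ≈ 0#) → sumP F k f ≈ 0#
  sumP-0 zero    f≈0 = refl
  sumP-0 (suc k) f≈0 = trans (+-cong (f≈0 Fin.zero) (sumP-0 k (λ i → f≈0 (Fin.suc i)))) (+-identityˡ _)

  sumP-single : ∀ k {f : Fin k → Poly F m} i → (∀ j → ¬ j ≡ i → f j ≈ 0#) → sumP F k f ≈ f i
  sumP-single (suc k) Fin.zero    f≈0 = trans (+-congˡ (sumP-0 k (λ j → f≈0 (Fin.suc j) λ ()))) (+-identityʳ _)
  sumP-single (suc k) (Fin.suc i) f≈0 = trans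
    (+-cong (f≈0 Fin.zero λ ()) (sumP-single k i (λ j j≢i → f≈0 (Fin.suc j) (λ eq → j≢i (FinP.suc-injective eq)))))
    (+-identityˡ _)

module WeakToGeneral (F : Field c ℓ) where
  private
    module F = Field F

    indicator : ∀ {m} → Fin m → F.Carrier → Fin m → F.Carrier
    indicator i x j with j Fin.≟ i
    ... | yes _ = x
    ... | no _  = F.0#

    general : ∀ {m} → WeakLabel F m → GenLabel F m
    general (wconst β)   = (λ _ → F.0#) , β
    general (wlin i α β) = indicator i α , β

    general-value : ∀ {m} (l : WeakLabel F m) → _≋_ F (⟦_⟧g F (general l)) (⟦_⟧w F l)
    general-value {m} (wconst β) = ≋-trans (⊕-cong (Sums.sumP-0 F m (λ i → _≋_.zeroˡ (var i))) ≋-refl) (⊕-idˡ (con β))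
    general-value {m} (wlin i α β) = ⊕-cong
      (≋-trans (Sums.sumP-single F m i off-diagonal) (⊛-cong (con-cong diagonal) ≋-refl)) ≋-refl
      where
      off-diagonal : ∀ j → ¬ j ≡ i → _≋_ F (con (indicator i α j) ⊛ var j) (0p F)
      off-diagonal j j≢i with j Fin.≟ i
      ... | yes j≡i = contradiction j≡i j≢i
      ... | no _    = _≋_.zeroˡ (var j)
      diagonal : indicator i α i F.≈ α
      diagonal with i Fin.≟ i
      ... | yes _  = F.refl
      ... | no i≢i = contradiction ≡.refl i≢i

    module _ {Lab Lab′ : Set c} (g : Lab → Lab′) where
      mapProg : ∀ {k} → Prog F Lab k → Prog F Lab′ k
      mapProg start                = start
      mapProg (step k 1≤k k≤2 P l) = step k 1≤k k≤2 (mapProg P) (λ u v → g (l u v))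

      size-mapProg : ∀ {k} (P : Prog F Lab k) → size F (mapProg P) ≡ size F P
      size-mapProg start            = ≡.refl
      size-mapProg (step k _ _ P _) = ≡.cong (N._+ k) (size-mapProg P)

      valueAt-mapProg : ∀ {m k} (⟦_⟧ₗ : Lab → Poly F m) (⟦_⟧ₗ′ : Lab′ → Poly F m) →
        (∀ l → _≋_ F ⟦ g l ⟧ₗ′ ⟦ l ⟧ₗ) → (P : Prog F Lab k) → ∀ v →
        _≋_ F (valueAt F ⟦_⟧ₗ′ (mapProg P) v) (valueAt F ⟦_⟧ₗ P v)
      valueAt-mapProg _ _ eq start v = ≋-refl
      valueAt-mapProg ⟦_⟧ₗ ⟦_⟧ₗ′ eq (step {j} k _ _ P l) v =
        Sums.sumP-cong F j (λ u → ⊛-cong (valueAt-mapProg ⟦_⟧ₗ ⟦_⟧ₗ′ eq P u) (eq (l u v)))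

  weak⊆general : ∀ f → VP₂weak F f → VP₂gen F f
  weak⊆general f (vars-bounded , s , s-bounded , programs) =
    vars-bounded , s , s-bounded , λ n → convert n (programs n)
    where
    convert : ∀ n → (∃ λ (A : ABP F (WeakLabel F (nvars f n))) →
                 abpSize F A N.≤ s n × _≋_ F (abpValue F (⟦_⟧w F) A) (poly f n)) →
              ∃ λ (A : ABP F (GenLabel F (nvars f n))) →
                 abpSize F A N.≤ s n × _≋_ F (abpValue F (⟦_⟧g F) A) (poly f n)
    convert n (A@(abp body l) , size≤ , value≋) =
      abp (mapProg general body) (λ u v → general (l u v)) ,
      NP.≤-trans (NP.≤-reflexive (size-mapProg general (prog F A))) size≤ ,
      ≋-trans (valueAt-mapProg general (⟦_⟧w F) (⟦_⟧g F) general-value (prog F A) Fin.zero) value≋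

-- Weak programs as products of matrices

module WeakMatrices (F : Field c ℓ) (m : ℕ) where
  open CommutativeRing (polyRing F m) renaming (zeroˡ to *-zeroˡ)
  open MatrixOps (polyRing F m)
  open SetoidReasoning setoid

  private
    Lab = WeakLabel F m
    ⟦_⟧ₗ : Lab → Poly F m
    ⟦_⟧ₗ = ⟦_⟧w F

  -- `e₁` selects the sink, and the first coordinate of the result selects the source.
  column : List (Matrix Lab) → Vector
  column []       = e₁
  column (M ∷ Ms) = mapMatrix ⟦_⟧ₗ M · column Ms

  private
    -- Pads a layer of width one with the default `z`. Layers wider than two, which would be
    -- truncated, are excluded by `width≤2`.
    pick : {A : Set a} → A → ∀ k → (Fin k → A) → A × A
    pick z zero          f = z , z
    pick z (suc zero)    f = f Fin.zero , z
    pick z (suc (suc k)) f = f Fin.zero , f (Fin.suc Fin.zero)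

    no-edge : Lab
    no-edge = wconst (Field.0# F)

    pad : ∀ {j k} → (Fin j → Fin k → Lab) → Matrix Lab
    pad {j} {k} l =
      let ((p , r) , (q , s)) = pick (no-edge , no-edge) k (λ v → pick no-edge j (λ u → l u v))
      in matrix p q r s

    matrices : ∀ {k} → Prog F Lab k → List (Matrix Lab) → List (Matrix Lab)
    matrices start            Ms = Ms
    matrices (step k _ _ P l) Ms = matrices P (pad l ∷ Ms)

    width≤2 : ∀ {k} → Prog F Lab k → k N.≤ 2
    width≤2 start              = N.s≤s N.z≤n
    width≤2 (step _ _ k≤2 _ _) = k≤2

    row : ∀ {k} → Prog F Lab k → Vector
    row {k} P = pick 0# k (valueAt F ⟦_⟧ₗ P)

    sum-pick : ∀ j → j N.≤ 2 → (f : Fin j → Poly F m) (g : Fin j → Lab) →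
      sumP F j (λ u → f u * ⟦ g u ⟧ₗ) ≈
      let (p , r) = pick no-edge j g in pick 0# j f ·ᵥ (⟦ p ⟧ₗ , ⟦ r ⟧ₗ)
    sum-pick zero _ f g = sym (trans (+-cong (*-zeroˡ _) (*-zeroˡ _)) (+-identityʳ 0#))
    sum-pick (suc zero) _ f g = +-congˡ (sym (*-zeroˡ _))
    sum-pick (suc (suc zero)) _ f g = +-congˡ (+-identityʳ _)
    sum-pick (suc (suc (suc _))) (N.s≤s (N.s≤s ())) f g

    no-edges : ∀ v → 0# ≈ v ·ᵥ (⟦ no-edge ⟧ₗ , ⟦ no-edge ⟧ₗ)
    no-edges (x , y) = sym (trans (+-cong (zeroʳ x) (zeroʳ y)) (+-identityʳ 0#))

    row-step : ∀ {j} k 1≤k k≤2 (P : Prog F Lab j) l →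
      row (step k 1≤k k≤2 P l) ≈ᵥ row P ·ᵣ mapMatrix ⟦_⟧ₗ (pad l)
    row-step {j} zero ()
    row-step {j} (suc zero) _ _ P l = sum-pick j (width≤2 P) _ _ , no-edges (row P)
    row-step {j} (suc (suc zero)) _ _ P l = sum-pick j (width≤2 P) _ _ , sum-pick j (width≤2 P) _ _
    row-step {j} (suc (suc (suc _))) _ (N.s≤s (N.s≤s ())) P l

    -- Generalised over the accumulator of `matrices`: `Ms` holds the steps that follow `P`.
    value-matrices : ∀ {k} (P : Prog F Lab k) Ms →
      row P ·ᵥ column Ms ≈ proj₁ (column (matrices P Ms))
    value-matrices start Ms = trans (+-cong (*-identityˡ _) (*-zeroˡ _)) (+-identityʳ _)
    value-matrices (step k 1≤k k≤2 P l) Ms = begin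
      row (step k 1≤k k≤2 P l) ·ᵥ column Ms
        ≈⟨ ·ᵥ-cong (row-step k 1≤k k≤2 P l) (refl , refl) ⟩
      (row P ·ᵣ mapMatrix ⟦_⟧ₗ (pad l)) ·ᵥ column Ms
        ≈⟨ ·-assoc (row P) (mapMatrix ⟦_⟧ₗ (pad l)) (column Ms) ⟩
      row P ·ᵥ column (pad l ∷ Ms)
        ≈⟨ value-matrices P (pad l ∷ Ms) ⟩
      proj₁ (column (matrices P (pad l ∷ Ms))) ∎

  weak-as-matrices : (A : ABP F Lab) →
    ∃ λ Ms → proj₁ (column Ms) ≈ abpValue F ⟦_⟧ₗ A
  weak-as-matrices A = matrices (prog F A) [] , (begin
    proj₁ (column (matrices (prog F A) [])) ≈⟨ value-matrices (prog F A) [] ⟨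
    row (prog F A) ·ᵥ e₁                    ≈⟨ +-cong (*-identityʳ _) (zeroʳ _) ⟩
    abpValue F ⟦_⟧ₗ A + 0#                  ≈⟨ +-identityʳ _ ⟩
    abpValue F ⟦_⟧ₗ A                       ∎)

-- Determinants and matrices of rank one over a field

module FieldMatrices (K : Field c ℓ) where
  open Field K hiding (zeroˡ)
  open FieldProperties K public
  open Solver commutativeRing
  open SetoidReasoning setoid

  det : Matrix Carrier → Carrier
  det (matrix p q r s) = p * s - q * r

  _*ᵐ_ _+ᵐ_ : Matrix Carrier → Matrix Carrier → Matrix Carrier
  matrix p q r s *ᵐ matrix p′ q′ r′ s′ =
    matrix (p * p′ + q * r′) (p * q′ + q * s′) (r * p′ + s * r′) (r * q′ + s * s′)
  matrix p q r s +ᵐ matrix p′ q′ r′ s′ = matrix (p + p′) (q + q′) (r + r′) (s + s′)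

  det-*ᵐ : ∀ M N → det (M *ᵐ N) ≈ det M * det N
  det-*ᵐ (matrix p q r s) (matrix p′ q′ r′ s′) =
    solve 8 (λ p q r s p′ q′ r′ s′ →
      (p :* p′ :+ q :* r′) :* (r :* q′ :+ s :* s′) :- (p :* q′ :+ q :* s′) :* (r :* p′ :+ s :* r′)
      := (p :* s :- q :* r) :* (p′ :* s′ :- q′ :* r′)) refl p q r s p′ q′ r′ s′

  -- det (M + N g) = det M + mixedDet M N g + det N g²
  mixedDet : Matrix Carrier → Matrix Carrier → Carrier
  mixedDet (matrix p q r s) (matrix p′ q′ r′ s′) = p * s′ + p′ * s - (q * r′ + q′ * r)

  mixedDet-polarised : ∀ M N → det (M +ᵐ N) ≈ det M + mixedDet M N + det N
  mixedDet-polarised (matrix p q r s) (matrix p′ q′ r′ s′) =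
    solve 8 (λ p q r s p′ q′ r′ s′ →
      (p :+ p′) :* (s :+ s′) :- (q :+ q′) :* (r :+ r′)
      := (p :* s :- q :* r) :+ (p :* s′ :+ p′ :* s :- (q :* r′ :+ q′ :* r)) :+ (p′ :* s′ :- q′ :* r′))
      refl p q r s p′ q′ r′ s′

  det-distrib : ∀ G M N → det ((G *ᵐ M) +ᵐ (G *ᵐ N)) ≈ det G * det (M +ᵐ N)
  det-distrib G@(matrix p q r s) M@(matrix p′ q′ r′ s′) N@(matrix p″ q″ r″ s″) = trans
    (+-cong (*-cong (distr p q p′ p″ r′ r″) (distr r s q′ q″ s′ s″))
            (-‿cong (*-cong (distr p q q′ q″ s′ s″) (distr r s p′ p″ r′ r″))))
    (det-*ᵐ G (M +ᵐ N))
    where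
    distr : ∀ x y z z′ w w′ → (x * z + y * w) + (x * z′ + y * w′) ≈ x * (z + z′) + y * (w + w′)
    distr = solve 6 (λ x y z z′ w w′ → (x :* z :+ y :* w) :+ (x :* z′ :+ y :* w′) := x :* (z :+ z′) :+ y :* (w :+ w′)) refl

  -- By polarisation from the multiplicativity of `det`: the mixed determinant is det (M + N) - det
  -- M - det N.
  mixedDet-*ᵐ : ∀ G M N → mixedDet (G *ᵐ M) (G *ᵐ N) ≈ det G * mixedDet M N
  mixedDet-*ᵐ G M N = begin
    mixedDet (G *ᵐ M) (G *ᵐ N)
      ≈⟨ solve 3 (λ d₀ d₁ d₂ → d₁ := (d₀ :+ d₁ :+ d₂) :- d₀ :- d₂) refl (det (G *ᵐ M)) _ (det (G *ᵐ N)) ⟩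
    (det (G *ᵐ M) + mixedDet (G *ᵐ M) (G *ᵐ N) + det (G *ᵐ N)) - det (G *ᵐ M) - det (G *ᵐ N)
      ≈⟨ +-cong (+-cong (trans (sym (mixedDet-polarised _ _)) (trans (det-distrib G M N) (*-congˡ (mixedDet-polarised M N))))
                        (-‿cong (det-*ᵐ G M))) (-‿cong (det-*ᵐ G N)) ⟩
    det G * (det M + mixedDet M N + det N) - det G * det M - det G * det N
      ≈⟨ solve 4 (λ g d₀ d₁ d₂ → g :* (d₀ :+ d₁ :+ d₂) :- g :* d₀ :- g :* d₂ := g :* d₁) refl (det G) (det M) _ (det N) ⟩
    det G * mixedDet M N ∎

  *-≉0 : ∀ {x y} → ¬ x ≈ 0# → ¬ y ≈ 0# → ¬ x * y ≈ 0#
  *-≉0 x≉0 y≉0 xy≈0 = field-isDomain xy≈0 x≉0 y≉0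

  det-*ᵐ-≉0 : ∀ M N → ¬ det M ≈ 0# → ¬ det N ≈ 0# → ¬ det (M *ᵐ N) ≈ 0#
  det-*ᵐ-≉0 M N M≉0 N≉0 eq = *-≉0 M≉0 N≉0 (trans (sym (det-*ᵐ M N)) eq)

  OuterProduct : Matrix Carrier → Carrier × Carrier → Carrier × Carrier → Set ℓ
  OuterProduct (matrix p q r s) (x , y) (z , w) = (p ≈ x * z × q ≈ x * w) × (r ≈ y * z × s ≈ y * w)

  -- If p is nonzero, the second row is r / p times the first. If p is zero and q is not, the
  -- determinant forces r = 0 and only the second column remains. If the first row is zero, the
  -- second row is the right factor.
  rank-one : ∀ M → det M ≈ 0# → ¬ ¬ ∃ λ u → ∃ λ v → OuterProduct M u v
  rank-one (matrix p q r s) det≈0 k = ¬¬-excluded-middle λ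
    { (no p≉0) → let (w , pw≈1) = inverse p p≉0 in
        k ((1# , r * w) , (p , q) , (sym (*-identityˡ p) , sym (*-identityˡ q)) ,
          (begin
            r           ≈⟨ *-identityʳ r ⟨
            r * 1#      ≈⟨ *-congˡ pw≈1 ⟨
            r * (p * w) ≈⟨ solve 3 (λ r p w → r :* (p :* w) := r :* w :* p) refl r p w ⟩
            r * w * p   ∎) ,
          (begin
            s                           ≈⟨ *-identityʳ s ⟨
            s * 1#                      ≈⟨ *-congˡ pw≈1 ⟨
            s * (p * w)                 ≈⟨ solve 5 (λ p q r s w → s :* (p :* w) := (p :* s :- q :* r) :* w :+ r :* w :* q) refl p q r s w ⟩
            (p * s - q * r) * w + r * w * q ≈⟨ +-congʳ (trans (*-congʳ det≈0) (trans (*-comm 0# w) (zeroʳ w))) ⟩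
            0# + r * w * q              ≈⟨ +-identityˡ _ ⟩
            r * w * q                   ∎))
    ; (yes p≈0) → ¬¬-excluded-middle λ
      { (yes q≈0) → k ((0# , 1#) , (r , s) ,
          (trans p≈0 (sym (trans (*-comm 0# r) (zeroʳ r))) , trans q≈0 (sym (trans (*-comm 0# s) (zeroʳ s)))) ,
          sym (*-identityˡ r) , sym (*-identityˡ s))
      ; (no q≉0) → k ((q , s) , (0# , 1#) ,
          (trans p≈0 (sym (zeroʳ q)) , sym (*-identityʳ q)) ,
          trans (*-cancel-0 q≉0 (begin
            q * r                           ≈⟨ solve 4 (λ p q r s → q :* r := p :* s :- (p :* s :- q :* r)) refl p q r s ⟩
            p * s - (p * s - q * r)         ≈⟨ +-cong (trans (*-congʳ p≈0) (trans (*-comm 0# s) (zeroʳ s))) (-‿cong det≈0) ⟩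
            0# - 0#                         ≈⟨ -‿inverseʳ 0# ⟩
            0#                              ∎)) (sym (zeroʳ s)) , sym (*-identityʳ s)) } }

-- Nonsingular segments and continuants

-- Products of matrices A + B g, with g affine in X and Z, whose determinant is a
-- nonzero constant.  Along ψ the elements X and Z have different positive degrees.
module ConstantDeterminant (K : Field c ℓ) {R : CommutativeRing d e}
  (κ : RingHom (Field.commutativeRing K) R) (X Z : CommutativeRing.Carrier R)
  (ψ : RingHom R (seriesRing (Field.commutativeRing K)))
  (ψ-κ : ∀ k → PowerSeries._≈ˢ_ (Field.commutativeRing K) (⟦ ψ ⟧ (⟦ κ ⟧ k)) (⟦ constant-hom (Field.commutativeRing K) ⟧ k))
  (ψ-X : HasDegree (Field.commutativeRing K) (⟦ ψ ⟧ X) 1)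
  (ψ-Z : HasDegree (Field.commutativeRing K) (⟦ ψ ⟧ Z) 2) where
  private
    module K = Field K
    module S = PowerSeries K.commutativeRing
  open CommutativeRing R renaming (zeroˡ to *-zeroˡ)
  open Solver R
  open SetoidReasoning setoid
  open MatrixOps R
  open FieldMatrices K
  private
    module κ = RingHom κ
    module ψ = RingHom ψ
    module KS = Solver K.commutativeRing

  record Affine : Set c where
    constructor affine
    field coeffX coeffZ coeff1 : K.Carrier
  open Affine

  ⟪_⟫ : Affine → Carrier
  ⟪ affine α γ δ ⟫ = κ.⟦ α ⟧ * X + κ.⟦ γ ⟧ * Z + κ.⟦ δ ⟧

  IsConstant : Affine → Set ℓ
  IsConstant g = coeffX g K.≈ K.0# × coeffZ g K.≈ K.0#

  _+ᵃ_ : Affine → Affine → Affine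
  affine α γ δ +ᵃ affine α′ γ′ δ′ = affine (α K.+ α′) (γ K.+ γ′) (δ K.+ δ′)

  _*ᵃ_ : K.Carrier → Affine → Affine
  k *ᵃ affine α γ δ = affine (k K.* α) (k K.* γ) (k K.* δ)

  constantᵃ : K.Carrier → Affine
  constantᵃ k = affine K.0# K.0# k

  constant-value : ∀ g → IsConstant g → ⟪ g ⟫ ≈ κ.⟦ coeff1 g ⟧
  constant-value g (α≈0 , γ≈0) = trans
    (+-congʳ (trans (+-cong (vanish α≈0) (vanish γ≈0)) (+-identityˡ 0#))) (+-identityˡ _)
    where
    vanish : ∀ {k y} → k K.≈ K.0# → κ.⟦ k ⟧ * y ≈ 0#
    vanish k≈0 = trans (*-congʳ (trans (κ.⟦⟧-cong k≈0) κ.0-homo)) (*-zeroˡ _)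

  +ᵃ-value : ∀ g h → ⟪ g +ᵃ h ⟫ ≈ ⟪ g ⟫ + ⟪ h ⟫
  +ᵃ-value (affine α γ δ) (affine α′ γ′ δ′) = trans
    (+-cong (+-cong (*-congʳ (κ.+-homo α α′)) (*-congʳ (κ.+-homo γ γ′))) (κ.+-homo δ δ′))
    (solve 8 (λ α γ δ α′ γ′ δ′ X Z → (α :+ α′) :* X :+ (γ :+ γ′) :* Z :+ (δ :+ δ′)
      := (α :* X :+ γ :* Z :+ δ) :+ (α′ :* X :+ γ′ :* Z :+ δ′)) refl _ _ _ _ _ _ _ _)

  *ᵃ-value : ∀ k g → ⟪ k *ᵃ g ⟫ ≈ κ.⟦ k ⟧ * ⟪ g ⟫
  *ᵃ-value k (affine α γ δ) = trans
    (+-cong (+-cong (*-congʳ (κ.*-homo k α)) (*-congʳ (κ.*-homo k γ))) (κ.*-homo k δ))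
    (solve 6 (λ k α γ δ X Z → k :* α :* X :+ k :* γ :* Z :+ k :* δ := k :* (α :* X :+ γ :* Z :+ δ)) refl _ _ _ _ _ _)

  -- `push` multiplies the row (p₀ , q₀) by the matrix with rows (g , 1) and (1 , 0), as in a
  -- continued fraction. Quotients are required to be nonconstant so that every `push` raises the
  -- degree along ψ.
  data Continuants : Carrier → Carrier → Set (c ⊔ ℓ ⊔ d ⊔ e) where
    base : ∀ {p q} → p ≈ 1# → q ≈ 0# → Continuants p q
    push : ∀ {p q p₀ q₀} → Continuants p₀ q₀ → (g : Affine) → ¬ IsConstant g →
           p ≈ ⟪ g ⟫ * p₀ + q₀ → q ≈ p₀ → Continuants p q

  -- The multiple of q is absorbed by the last quotient, which changes by a constant and so stays
  -- nonconstant; before the first `push` q is zero.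
  shift : ∀ k {p q} → Continuants p q → Continuants (p + κ.⟦ k ⟧ * q) q
  shift k (base p≈1 q≈0) = base (trans (+-congˡ (trans (*-congˡ q≈0) (zeroʳ _))) (trans (+-identityʳ _) p≈1)) q≈0
  shift k {p} {q} (push {p₀ = p₀} {q₀} pq₀ g g-nonconst p≈ q≈) = push pq₀ (g +ᵃ constantᵃ k)
    (λ (α≈0 , γ≈0) → g-nonconst (K.trans (K.sym (K.+-identityʳ _)) α≈0 , K.trans (K.sym (K.+-identityʳ _)) γ≈0))
    (begin
      p + κ.⟦ k ⟧ * q                                 ≈⟨ +-cong p≈ (*-congˡ q≈) ⟩
      ⟪ g ⟫ * p₀ + q₀ + κ.⟦ k ⟧ * p₀                  ≈⟨ solve 4 (λ g p q k → g :* p :+ q :+ k :* p := (g :+ k) :* p :+ q) refl ⟪ g ⟫ p₀ q₀ κ.⟦ k ⟧ ⟩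
      (⟪ g ⟫ + κ.⟦ k ⟧) * p₀ + q₀                     ≈⟨ +-congʳ (*-congʳ (+-congˡ (constant-value (constantᵃ k) (K.refl , K.refl)))) ⟨
      (⟪ g ⟫ + ⟪ constantᵃ k ⟫) * p₀ + q₀             ≈⟨ +-congʳ (*-congʳ (+ᵃ-value g (constantᵃ k))) ⟨
      ⟪ g +ᵃ constantᵃ k ⟫ * p₀ + q₀                  ∎)
    q≈

  κᵐ : Matrix K.Carrier → Matrix Carrier
  κᵐ = mapMatrix κ.⟦_⟧

  κᵛ : K.Carrier × K.Carrier → Vector
  κᵛ (x , y) = κ.⟦ x ⟧ , κ.⟦ y ⟧

  -- The invariant of a nonsingular segment: its row is a continuant row followed by an invertible
  -- constant matrix.
  record InSpan (v : Vector) : Set (c ⊔ ℓ ⊔ d ⊔ e) where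
    constructor inSpan
    field
      {p q}       : Carrier
      continuants : Continuants p q
      basis       : Matrix K.Carrier
      det≉0       : ¬ det basis K.≈ K.0#
      expansion   : v ≈ᵥ (p , q) ·ᵣ κᵐ basis

  inSpan-cong : ∀ {u v} → u ≈ᵥ v → InSpan v → InSpan u
  inSpan-cong (u₁≈ , u₂≈) (inSpan pq G G≉0 (v₁≈ , v₂≈)) = inSpan pq G G≉0 (trans u₁≈ v₁≈ , trans u₂≈ v₂≈)

  infixr 5 _⟫≈_
  _⟫≈_ : ∀ {u v w} → u ≈ᵥ v → v ≈ᵥ w → u ≈ᵥ w
  (x , y) ⟫≈ (x′ , y′) = trans x x′ , trans y y′

  ·ᵣ-*ᵐ : ∀ u G A → (u ·ᵣ κᵐ G) ·ᵣ κᵐ A ≈ᵥ u ·ᵣ κᵐ (G *ᵐ A)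
  ·ᵣ-*ᵐ (p , q) (matrix g₁ g₂ g₃ g₄) (matrix a₁ a₂ a₃ a₄) =
    entry a₁ a₃ g₁ g₃ g₂ g₄ , entry a₂ a₄ g₁ g₃ g₂ g₄
    where
    combine : ∀ g x g′ y → κ.⟦ g K.* x K.+ g′ K.* y ⟧ ≈ κ.⟦ g ⟧ * κ.⟦ x ⟧ + κ.⟦ g′ ⟧ * κ.⟦ y ⟧
    combine g x g′ y = trans (κ.+-homo _ _) (+-cong (κ.*-homo _ _) (κ.*-homo _ _))
    entry : ∀ x y g h g′ h′ →
      (p * κ.⟦ g ⟧ + q * κ.⟦ h ⟧) * κ.⟦ x ⟧ + (p * κ.⟦ g′ ⟧ + q * κ.⟦ h′ ⟧) * κ.⟦ y ⟧
      ≈ p * κ.⟦ g K.* x K.+ g′ K.* y ⟧ + q * κ.⟦ h K.* x K.+ h′ K.* y ⟧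
    entry x y g h g′ h′ = trans
      (solve 8 (λ p q g h g′ h′ x y → (p :* g :+ q :* h) :* x :+ (p :* g′ :+ q :* h′) :* y
        := p :* (g :* x :+ g′ :* y) :+ q :* (h :* x :+ h′ :* y)) refl _ _ _ _ _ _ _ _)
      (sym (+-cong (*-congˡ (combine g x g′ y)) (*-congˡ (combine h x h′ y))))

  inSpan-· : ∀ {v} A → ¬ det A K.≈ K.0# → InSpan v → InSpan (v ·ᵣ κᵐ A)
  inSpan-· {v} A A≉0 (inSpan {p} {q} pq G G≉0 v≈) = inSpan pq (G *ᵐ A) (det-*ᵐ-≉0 G A G≉0 A≉0)
    (·ᵣ-cong (κᵐ A) v≈ ⟫≈ ·ᵣ-*ᵐ (p , q) G A)

  continuants⇒inSpan : ∀ {p q} → Continuants p q → InSpan (p , q)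
  continuants⇒inSpan {p} {q} pq = inSpan pq (matrix K.1# K.0# K.0# K.1#)
    (λ eq → K.0≉1 (K.trans (K.sym eq) (KS.solve 0 (KS.:1 KS.:* KS.:1 KS.:- KS.:0 KS.:* KS.:0 KS.:= KS.:1) K.refl)))
    (sym (trans (+-cong (*-congˡ κ.1-homo) (*-congˡ κ.0-homo)) (solve 2 (λ p q → p :* :1 :+ q :* :0 := p) refl p q)) ,
     sym (trans (+-cong (*-congˡ κ.0-homo) (*-congˡ κ.1-homo)) (solve 2 (λ p q → p :* :0 :+ q :* :1 := q) refl p q)))

  inSpan-by : ∀ {p q} → Continuants p q → ∀ x y z w → (∃ λ n → x K.* w K.- y K.* z K.≈ n × ¬ n K.≈ K.0#) → ∀ {v₁ v₂} →
    v₁ ≈ p * κ.⟦ x ⟧ + q * κ.⟦ z ⟧ → v₂ ≈ p * κ.⟦ y ⟧ + q * κ.⟦ w ⟧ → InSpan (v₁ , v₂)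
  inSpan-by pq x y z w (n , det≈n , n≉0) v₁≈ v₂≈ =
    inSpan pq (matrix x y z w) (λ det≈0 → n≉0 (K.trans (K.sym det≈n) det≈0)) (v₁≈ , v₂≈)

  1≉0 : ¬ K.1# K.≈ K.0#
  1≉0 eq = K.0≉1 (K.sym eq)

  -1≉0 : ¬ K.- K.1# K.≈ K.0#
  -1≉0 eq = 1≉0 (K.trans (KS.solve 0 (KS.:1 KS.:= KS.:- (KS.:- KS.:1)) K.refl)
    (K.trans (K.-‿cong eq) (KS.solve 0 (KS.:- KS.:0 KS.:= KS.:0) K.refl)))

  κ-0 : ∀ {k} → k K.≈ K.0# → κ.⟦ k ⟧ ≈ 0#
  κ-0 k≈0 = trans (κ.⟦⟧-cong k≈0) κ.0-homo

  -- The row (p , q) times I + g b eᵀ, with b a column and e a row; when b · e = 0 this is a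
  -- transvection, of determinant 1.
  sheared : Affine → (b₁ b₂ e₁ e₂ : K.Carrier) → Carrier → Carrier → Vector
  sheared g b₁ b₂ e₁ e₂ p q = p + ⟪ g ⟫ * s * κ.⟦ e₁ ⟧ , q + ⟪ g ⟫ * s * κ.⟦ e₂ ⟧
    where s = κ.⟦ b₁ ⟧ * p + κ.⟦ b₂ ⟧ * q

  -- For nonzero b₁ the shear appends a quotient to the shifted continuant. For b₁ = 0 and nonzero
  -- b₂ orthogonality forces e₂ = 0, and the shear only changes the last quotient, if there is one.
  -- Whenever a quotient comes out constant, it is moved into the basis instead.
  inSpan-sheared : ∀ g b₁ b₂ e₁ e₂ → b₁ K.* e₁ K.+ b₂ K.* e₂ K.≈ K.0# → ∀ {p q} → Continuants p q →
    ¬ ¬ InSpan (sheared g b₁ b₂ e₁ e₂ p q)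
  inSpan-sheared g b₁ b₂ e₁ e₂ be≈0 {p} {q} pq k = ¬¬-excluded-middle λ
    { (no b₁≉0) → case₁ b₁≉0
    ; (yes b₁≈0) → ¬¬-excluded-middle λ { (no b₂≉0) → case₂ b₁≈0 b₂≉0 pq ; (yes b₂≈0) → case₃ b₁≈0 b₂≈0 } }
    where
    case₃ : b₁ K.≈ K.0# → b₂ K.≈ K.0# → ⊥
    case₃ b₁≈0 b₂≈0 = k (inSpan-cong (unchanged p e₁ , unchanged q e₂) (continuants⇒inSpan pq))
      where
      unchanged : ∀ x y → x + ⟪ g ⟫ * (κ.⟦ b₁ ⟧ * p + κ.⟦ b₂ ⟧ * q) * κ.⟦ y ⟧ ≈ x
      unchanged x y = trans
        (+-congˡ (*-congʳ (*-congˡ (+-cong (*-congʳ (κ-0 b₁≈0)) (*-congʳ (κ-0 b₂≈0))))))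
        (solve 5 (λ x y g p q → x :+ g :* (:0 :* p :+ :0 :* q) :* y := x) refl x κ.⟦ y ⟧ ⟪ g ⟫ p q)

    case₂ : b₁ K.≈ K.0# → ¬ b₂ K.≈ K.0# → Continuants p q → ⊥
    case₂ b₁≈0 b₂≉0 (base p≈1 q≈0) =
      k (inSpan-cong (unchanged p e₁ , unchanged q e₂) (continuants⇒inSpan pq))
      where
      unchanged : ∀ x y → x + ⟪ g ⟫ * (κ.⟦ b₁ ⟧ * p + κ.⟦ b₂ ⟧ * q) * κ.⟦ y ⟧ ≈ x
      unchanged x y = trans
        (+-congˡ (*-congʳ (*-congˡ (+-cong (*-congʳ (κ-0 b₁≈0)) (*-congˡ q≈0)))))
        (solve 5 (λ x y g p b → x :+ g :* (:0 :* p :+ b :* :0) :* y := x) refl x κ.⟦ y ⟧ ⟪ g ⟫ p κ.⟦ b₂ ⟧)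
    case₂ b₁≈0 b₂≉0 (push {p₀ = p₀} {q₀} pq₀ h h-nonconst p≈ q≈) = ¬¬-excluded-middle λ
      { (no nonconst) → k (continuants⇒inSpan′ nonconst)
      -- The last quotient has degenerated to a constant δ, so the continuant gets shorter: (δ p₀ +
      -- q₀ , p₀) is a constant combination of the previous pair.
      ; (yes const) → k (inSpan-by pq₀ (coeff1 h′) K.1# K.1# K.0#
          (K.- K.1# , KS.solve 1 (λ x → x KS.:* KS.:0 KS.:- KS.:1 KS.:* KS.:1 KS.:= KS.:- KS.:1) K.refl _ , -1≉0)
          (trans first (+-cong (trans (*-congʳ (constant-value h′ const)) (*-comm _ _)) (sym (trans (*-congˡ κ.1-homo) (*-identityʳ _)))))
          (trans second (sym (trans (+-cong (*-congˡ κ.1-homo) (*-congˡ κ.0-homo)) (solve 2 (λ p q → p :* :1 :+ q :* :0 := p) refl p₀ q₀))))) }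
      where
      e₂≈0 : e₂ K.≈ K.0#
      e₂≈0 = *-cancel-0 b₂≉0 (K.trans (KS.solve 3 (λ e b f → b KS.:* f KS.:= KS.:0 KS.:* e KS.:+ b KS.:* f) K.refl e₁ b₂ e₂)
        (K.trans (K.+-congʳ (K.*-congʳ (K.sym b₁≈0))) be≈0))
      h′ : Affine
      h′ = h +ᵃ ((b₂ K.* e₁) *ᵃ g)
      h′-value : ⟪ h′ ⟫ ≈ ⟪ h ⟫ + κ.⟦ b₂ ⟧ * κ.⟦ e₁ ⟧ * ⟪ g ⟫
      h′-value = trans (+ᵃ-value h _) (+-congˡ (trans (*ᵃ-value _ g) (*-congʳ (κ.*-homo b₂ e₁))))
      first : p + ⟪ g ⟫ * (κ.⟦ b₁ ⟧ * p + κ.⟦ b₂ ⟧ * q) * κ.⟦ e₁ ⟧ ≈ ⟪ h′ ⟫ * p₀ + q₀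
      first = begin
        p + ⟪ g ⟫ * (κ.⟦ b₁ ⟧ * p + κ.⟦ b₂ ⟧ * q) * κ.⟦ e₁ ⟧
          ≈⟨ +-cong p≈ (*-congʳ (*-congˡ (+-cong (*-congʳ (κ-0 b₁≈0)) (*-congˡ q≈)))) ⟩
        ⟪ h ⟫ * p₀ + q₀ + ⟪ g ⟫ * (0# * p + κ.⟦ b₂ ⟧ * p₀) * κ.⟦ e₁ ⟧
          ≈⟨ solve 7 (λ h p₀ q₀ g p b e → h :* p₀ :+ q₀ :+ g :* (:0 :* p :+ b :* p₀) :* e := (h :+ b :* e :* g) :* p₀ :+ q₀)
               refl ⟪ h ⟫ p₀ q₀ ⟪ g ⟫ p κ.⟦ b₂ ⟧ κ.⟦ e₁ ⟧ ⟩
        (⟪ h ⟫ + κ.⟦ b₂ ⟧ * κ.⟦ e₁ ⟧ * ⟪ g ⟫) * p₀ + q₀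
          ≈⟨ +-congʳ (*-congʳ h′-value) ⟨
        ⟪ h′ ⟫ * p₀ + q₀ ∎
      second : q + ⟪ g ⟫ * (κ.⟦ b₁ ⟧ * p + κ.⟦ b₂ ⟧ * q) * κ.⟦ e₂ ⟧ ≈ p₀
      second = trans (+-cong q≈ (trans (*-congˡ (κ-0 e₂≈0)) (zeroʳ _))) (+-identityʳ _)
      continuants⇒inSpan′ : ¬ IsConstant h′ → InSpan _
      continuants⇒inSpan′ nonconst = continuants⇒inSpan (push pq₀ h′ nonconst first second)

    case₁ : ¬ b₁ K.≈ K.0# → ⊥
    case₁ b₁≉0 = ¬¬-excluded-middle λ
      -- The second coordinate is the new continuant h p̃ + q, and the first is p̃ minus r times it.
      { (no nonconst) → k (inSpan-by (push (shift r pq) h nonconst refl refl) (K.- r) K.1# K.1# K.0#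
          (K.- K.1# , KS.solve 1 (λ r → KS.:- r KS.:* KS.:0 KS.:- KS.:1 KS.:* KS.:1 KS.:= KS.:- KS.:1) K.refl r , -1≉0)
          (trans first (sym (+-cong (*-congˡ (κ.-‿homo r)) (*-congˡ κ.1-homo))))
          (trans second (sym (trans (+-cong (*-congˡ κ.1-homo) (*-congˡ κ.0-homo))
            (solve 2 (λ x y → x :* :1 :+ y :* :0 := x) refl _ _)))))
      ; (yes const) → let δ = coeff1 h ; h≈δ = constant-value h const in
          k (inSpan-by (shift r pq) (K.1# K.- r K.* δ) δ (K.- r) K.1#
          (K.1# , KS.solve 2 (λ r δ → (KS.:1 KS.:- r KS.:* δ) KS.:* KS.:1 KS.:- δ KS.:* (KS.:- r) KS.:= KS.:1) K.refl r δ , 1≉0)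
          (begin
            p + ⟪ g ⟫ * (κ.⟦ b₁ ⟧ * p + κ.⟦ b₂ ⟧ * q) * κ.⟦ e₁ ⟧
              ≈⟨ first ⟩
            (⟪ h ⟫ * p̃ + q) * - κ.⟦ r ⟧ + p̃ * 1#
              ≈⟨ +-congʳ (*-congʳ (+-congʳ (*-congʳ h≈δ))) ⟩
            (κ.⟦ δ ⟧ * p̃ + q) * - κ.⟦ r ⟧ + p̃ * 1#
              ≈⟨ solve 4 (λ δ p q r → (δ :* p :+ q) :* :- r :+ p :* :1 := p :* (:1 :- r :* δ) :+ q :* :- r) refl κ.⟦ δ ⟧ p̃ q κ.⟦ r ⟧ ⟩
            p̃ * (1# - κ.⟦ r ⟧ * κ.⟦ δ ⟧) + q * - κ.⟦ r ⟧
              ≈⟨ +-cong (*-congˡ (trans (κ.+-homo _ _) (+-cong κ.1-homo (trans (κ.-‿homo _) (-‿cong (κ.*-homo r δ)))))) (*-congˡ (κ.-‿homo r)) ⟨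
            p̃ * κ.⟦ K.1# K.- r K.* δ ⟧ + q * κ.⟦ K.- r ⟧ ∎)
          (trans second (+-cong (trans (*-congʳ h≈δ) (*-comm _ _)) (sym (trans (*-congˡ κ.1-homo) (*-identityʳ q)))))) }
      where
      w = proj₁ (K.inverse b₁ b₁≉0)
      b₁w≈1 = proj₂ (K.inverse b₁ b₁≉0)
      r = b₂ K.* w
      p̃ = p + κ.⟦ r ⟧ * q
      h = (b₁ K.* e₂) *ᵃ g
      h-value : ⟪ h ⟫ ≈ κ.⟦ b₁ ⟧ * κ.⟦ e₂ ⟧ * ⟪ g ⟫
      h-value = trans (*ᵃ-value _ g) (*-congʳ (κ.*-homo b₁ e₂))
      b₂≈ : κ.⟦ b₂ ⟧ ≈ κ.⟦ b₁ ⟧ * κ.⟦ r ⟧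
      b₂≈ = trans (κ.⟦⟧-cong (K.trans (K.trans (K.sym (K.*-identityʳ b₂)) (K.*-congˡ (K.sym b₁w≈1)))
        (KS.solve 3 (λ b₁ b₂ w → b₂ KS.:* (b₁ KS.:* w) KS.:= b₁ KS.:* (b₂ KS.:* w)) K.refl b₁ b₂ w))) (κ.*-homo b₁ r)
      e₁≈ : κ.⟦ e₁ ⟧ ≈ - (κ.⟦ r ⟧ * κ.⟦ e₂ ⟧)
      e₁≈ = trans (κ.⟦⟧-cong (K.trans
        (K.trans (K.sym (K.*-identityˡ e₁)) (K.*-congʳ (K.sym b₁w≈1)))
        (K.trans (KS.solve 5 (λ b₁ b₂ e₁ e₂ w → b₁ KS.:* w KS.:* e₁ KS.:= w KS.:* (b₁ KS.:* e₁ KS.:+ b₂ KS.:* e₂) KS.:- b₂ KS.:* w KS.:* e₂)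
                   K.refl b₁ b₂ e₁ e₂ w)
        (K.trans (K.+-congʳ (K.trans (K.*-congˡ be≈0) (K.zeroʳ w))) (K.+-identityˡ _)))))
        (trans (κ.-‿homo _) (-‿cong (κ.*-homo r e₂)))
      s≈ : κ.⟦ b₁ ⟧ * p + κ.⟦ b₂ ⟧ * q ≈ κ.⟦ b₁ ⟧ * p̃
      s≈ = trans (+-congˡ (*-congʳ b₂≈)) (solve 4 (λ b r p q → b :* p :+ b :* r :* q := b :* (p :+ r :* q)) refl _ _ p q)
      first : p + ⟪ g ⟫ * (κ.⟦ b₁ ⟧ * p + κ.⟦ b₂ ⟧ * q) * κ.⟦ e₁ ⟧ ≈ (⟪ h ⟫ * p̃ + q) * - κ.⟦ r ⟧ + p̃ * 1#
      first = begin
        p + ⟪ g ⟫ * (κ.⟦ b₁ ⟧ * p + κ.⟦ b₂ ⟧ * q) * κ.⟦ e₁ ⟧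
          ≈⟨ +-congˡ (*-cong (*-congˡ s≈) e₁≈) ⟩
        p + ⟪ g ⟫ * (κ.⟦ b₁ ⟧ * p̃) * - (κ.⟦ r ⟧ * κ.⟦ e₂ ⟧)
          ≈⟨ solve 6 (λ p q g b r e → p :+ g :* (b :* (p :+ r :* q)) :* :- (r :* e)
               := (b :* e :* g :* (p :+ r :* q) :+ q) :* :- r :+ (p :+ r :* q) :* :1) refl p q ⟪ g ⟫ κ.⟦ b₁ ⟧ κ.⟦ r ⟧ κ.⟦ e₂ ⟧ ⟩
        (κ.⟦ b₁ ⟧ * κ.⟦ e₂ ⟧ * ⟪ g ⟫ * p̃ + q) * - κ.⟦ r ⟧ + p̃ * 1#
          ≈⟨ +-congʳ (*-congʳ (+-congʳ (*-congʳ h-value))) ⟨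
        (⟪ h ⟫ * p̃ + q) * - κ.⟦ r ⟧ + p̃ * 1# ∎
      second : q + ⟪ g ⟫ * (κ.⟦ b₁ ⟧ * p + κ.⟦ b₂ ⟧ * q) * κ.⟦ e₂ ⟧ ≈ ⟪ h ⟫ * p̃ + q
      second = begin
        q + ⟪ g ⟫ * (κ.⟦ b₁ ⟧ * p + κ.⟦ b₂ ⟧ * q) * κ.⟦ e₂ ⟧
          ≈⟨ +-congˡ (*-congʳ (*-congˡ s≈)) ⟩
        q + ⟪ g ⟫ * (κ.⟦ b₁ ⟧ * p̃) * κ.⟦ e₂ ⟧
          ≈⟨ solve 5 (λ q g b e s → q :+ g :* (b :* s) :* e := b :* e :* g :* s :+ q) refl q ⟪ g ⟫ κ.⟦ b₁ ⟧ κ.⟦ e₂ ⟧ p̃ ⟩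
        κ.⟦ b₁ ⟧ * κ.⟦ e₂ ⟧ * ⟪ g ⟫ * p̃ + q
          ≈⟨ +-congʳ (*-congʳ h-value) ⟨
        ⟪ h ⟫ * p̃ + q ∎

  IsPencil : Matrix Carrier → Matrix K.Carrier → Matrix K.Carrier → Carrier → Set e
  IsPencil (matrix m₁ m₂ m₃ m₄) (matrix a₁ a₂ a₃ a₄) (matrix b₁ b₂ b₃ b₄) g =
    (m₁ ≈ κ.⟦ a₁ ⟧ + κ.⟦ b₁ ⟧ * g × m₂ ≈ κ.⟦ a₂ ⟧ + κ.⟦ b₂ ⟧ * g) ×
    (m₃ ≈ κ.⟦ a₃ ⟧ + κ.⟦ b₃ ⟧ * g × m₄ ≈ κ.⟦ a₄ ⟧ + κ.⟦ b₄ ⟧ * g)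

  pencil-· : ∀ v M A B g → IsPencil M A B g →
    let (x , y) = v ·ᵣ κᵐ A ; (z , w) = v ·ᵣ κᵐ B in v ·ᵣ M ≈ᵥ (x + z * g , y + w * g)
  pencil-· (x , y) (matrix m₁ m₂ m₃ m₄) (matrix a₁ a₂ a₃ a₄) (matrix b₁ b₂ b₃ b₄) g ((m₁≈ , m₂≈) , (m₃≈ , m₄≈)) =
    trans (+-cong (*-congˡ m₁≈) (*-congˡ m₃≈)) (expand _ _ _ _) ,
    trans (+-cong (*-congˡ m₂≈) (*-congˡ m₄≈)) (expand _ _ _ _)
    where
    expand : ∀ a a′ b b′ → x * (a + b * g) + y * (a′ + b′ * g) ≈ (x * a + y * a′) + (x * b + y * b′) * g
    expand a a′ b b′ = solve 7 (λ x y g a a′ b b′ → x :* (a :+ b :* g) :+ y :* (a′ :+ b′ :* g)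
      := (x :* a :+ y :* a′) :+ (x :* b :+ y :* b′) :* g) refl x y g a a′ b b′

  -- Once the nonzero determinant is divided out, a rank one pencil is a shear
  -- followed by a constant matrix.
  inSpan-pencil : ∀ {v M} A B g → IsPencil M A B ⟪ g ⟫ →
    ¬ det A K.≈ K.0# → mixedDet A B K.≈ K.0# → det B K.≈ K.0# →
    InSpan v → ¬ ¬ InSpan (v ·ᵣ M)
  inSpan-pencil {v} {M} A B g M≈ A≉0 AB≈0 B≈0 (inSpan {p} {q} pq G G≉0 v≈) k =
    -- The basis `G` is merged into the pencil, which then acts directly on the continuants; the
    -- determinants and the mixed determinant are merely scaled by `det G`.
    rank-one (G *ᵐ B) (K.trans (det-*ᵐ G B) (K.trans (K.*-congˡ B≈0) (K.zeroʳ _)))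
      λ (b , e , outer) → go (G *ᵐ A) (G *ᵐ B) b e outer
        (det-*ᵐ-≉0 G A G≉0 A≉0)
        (K.trans (mixedDet-*ᵐ G A B) (K.trans (K.*-congˡ AB≈0) (K.zeroʳ _)))
        (pencil-· v M A B ⟪ g ⟫ M≈ ⟫≈
          (let (x≈ , y≈) = ·ᵣ-cong (κᵐ A) v≈ ⟫≈ ·ᵣ-*ᵐ (p , q) G A
               (z≈ , w≈) = ·ᵣ-cong (κᵐ B) v≈ ⟫≈ ·ᵣ-*ᵐ (p , q) G B
           in +-cong x≈ (*-congʳ z≈) , +-cong y≈ (*-congʳ w≈)))
    where
    go : ∀ A B b e → OuterProduct B b e → ¬ det A K.≈ K.0# → mixedDet A B K.≈ K.0# →
      (let (x , y) = (p , q) ·ᵣ κᵐ A ; (z , w) = (p , q) ·ᵣ κᵐ B in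
       v ·ᵣ M ≈ᵥ (x + z * ⟪ g ⟫ , y + w * ⟪ g ⟫)) → ⊥
    go A@(matrix a₁ a₂ a₃ a₄) B@(matrix b₁₁ b₁₂ b₂₁ b₂₂) (b₁ , b₂) (e₁ , e₂) ((b₁₁≈ , b₁₂≈) , (b₂₁≈ , b₂₂≈)) A≉0 AB≈0 vM≈ =
      inSpan-sheared g b₁ b₂ f₁ f₂ bf≈0 pq λ sheared∈ →
      k (inSpan-cong (vM≈ ⟫≈ (entry a₁ a₃ b₁₁≈ b₂₁≈ fA₁ , entry a₂ a₄ b₁₂≈ b₂₂≈ fA₂)) (inSpan-· A A≉0 sheared∈))
      where
      w = proj₁ (K.inverse (det A) A≉0)
      Aw≈1 = proj₂ (K.inverse (det A) A≉0)
      -- f solves f A = e: it is e times the adjugate of A, divided by `det A`.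
      f₁ = (e₁ K.* a₄ K.- e₂ K.* a₃) K.* w
      f₂ = (e₂ K.* a₁ K.- e₁ K.* a₂) K.* w
      -- b · f is the mixed determinant of A and b eᵀ divided by `det A`; this is where the
      -- vanishing of the linear term of the determinant is spent.
      bf≈0 : b₁ K.* f₁ K.+ b₂ K.* f₂ K.≈ K.0#
      bf≈0 = K.trans
        (KS.solve 9 (λ a₁ a₂ a₃ a₄ b₁ b₂ e₁ e₂ w →
          b₁ KS.:* ((e₁ KS.:* a₄ KS.:- e₂ KS.:* a₃) KS.:* w) KS.:+ b₂ KS.:* ((e₂ KS.:* a₁ KS.:- e₁ KS.:* a₂) KS.:* w)
          KS.:= w KS.:* (a₁ KS.:* (b₂ KS.:* e₂) KS.:+ b₁ KS.:* e₁ KS.:* a₄ KS.:- (a₂ KS.:* (b₂ KS.:* e₁) KS.:+ b₁ KS.:* e₂ KS.:* a₃)))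
          K.refl a₁ a₂ a₃ a₄ b₁ b₂ e₁ e₂ w)
        (K.trans (K.*-congˡ (K.trans
          (K.sym (K.+-cong (K.+-cong (K.*-congˡ b₂₂≈) (K.*-congʳ b₁₁≈)) (K.-‿cong (K.+-cong (K.*-congˡ b₂₁≈) (K.*-congʳ b₁₂≈)))))
          AB≈0)) (K.zeroʳ w))
      cancel-det : ∀ x → x K.* (det A K.* w) K.≈ x
      cancel-det x = K.trans (K.*-congˡ Aw≈1) (K.*-identityʳ x)
      fA₁ : f₁ K.* a₁ K.+ f₂ K.* a₃ K.≈ e₁
      fA₁ = K.trans (KS.solve 7 (λ a₁ a₂ a₃ a₄ e₁ e₂ w →
        (e₁ KS.:* a₄ KS.:- e₂ KS.:* a₃) KS.:* w KS.:* a₁ KS.:+ (e₂ KS.:* a₁ KS.:- e₁ KS.:* a₂) KS.:* w KS.:* a₃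
        KS.:= e₁ KS.:* ((a₁ KS.:* a₄ KS.:- a₂ KS.:* a₃) KS.:* w)) K.refl a₁ a₂ a₃ a₄ e₁ e₂ w) (cancel-det e₁)
      fA₂ : f₁ K.* a₂ K.+ f₂ K.* a₄ K.≈ e₂
      fA₂ = K.trans (KS.solve 7 (λ a₁ a₂ a₃ a₄ e₁ e₂ w →
        (e₁ KS.:* a₄ KS.:- e₂ KS.:* a₃) KS.:* w KS.:* a₂ KS.:+ (e₂ KS.:* a₁ KS.:- e₁ KS.:* a₂) KS.:* w KS.:* a₄
        KS.:= e₂ KS.:* ((a₁ KS.:* a₄ KS.:- a₂ KS.:* a₃) KS.:* w)) K.refl a₁ a₂ a₃ a₄ e₁ e₂ w) (cancel-det e₂)
      s = κ.⟦ b₁ ⟧ * p + κ.⟦ b₂ ⟧ * q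
      entry : ∀ a a′ {b b′ e} → b K.≈ b₁ K.* e → b′ K.≈ b₂ K.* e → f₁ K.* a K.+ f₂ K.* a′ K.≈ e →
        (p * κ.⟦ a ⟧ + q * κ.⟦ a′ ⟧) + (p * κ.⟦ b ⟧ + q * κ.⟦ b′ ⟧) * ⟪ g ⟫
        ≈ (p + ⟪ g ⟫ * s * κ.⟦ f₁ ⟧) * κ.⟦ a ⟧ + (q + ⟪ g ⟫ * s * κ.⟦ f₂ ⟧) * κ.⟦ a′ ⟧
      entry a a′ {b} {b′} {e} b≈ b′≈ fa≈ = begin
        (p * κ.⟦ a ⟧ + q * κ.⟦ a′ ⟧) + (p * κ.⟦ b ⟧ + q * κ.⟦ b′ ⟧) * ⟪ g ⟫
          ≈⟨ +-congˡ (*-congʳ (+-cong (*-congˡ (trans (κ.⟦⟧-cong b≈) (κ.*-homo b₁ e))) (*-congˡ (trans (κ.⟦⟧-cong b′≈) (κ.*-homo b₂ e))))) ⟩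
        (p * κ.⟦ a ⟧ + q * κ.⟦ a′ ⟧) + (p * (κ.⟦ b₁ ⟧ * κ.⟦ e ⟧) + q * (κ.⟦ b₂ ⟧ * κ.⟦ e ⟧)) * ⟪ g ⟫
          ≈⟨ solve 7 (λ x p q b₁ b₂ e g → x :+ (p :* (b₁ :* e) :+ q :* (b₂ :* e)) :* g
               := x :+ g :* (b₁ :* p :+ b₂ :* q) :* e) refl _ p q κ.⟦ b₁ ⟧ κ.⟦ b₂ ⟧ κ.⟦ e ⟧ ⟪ g ⟫ ⟩
        (p * κ.⟦ a ⟧ + q * κ.⟦ a′ ⟧) + ⟪ g ⟫ * s * κ.⟦ e ⟧
          ≈⟨ +-congˡ (*-congˡ (trans (κ.⟦⟧-cong (K.sym fa≈)) (trans (κ.+-homo _ _) (+-cong (κ.*-homo f₁ a) (κ.*-homo f₂ a′))))) ⟩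
        (p * κ.⟦ a ⟧ + q * κ.⟦ a′ ⟧) + ⟪ g ⟫ * s * (κ.⟦ f₁ ⟧ * κ.⟦ a ⟧ + κ.⟦ f₂ ⟧ * κ.⟦ a′ ⟧)
          ≈⟨ solve 7 (λ p q a a′ gs f₁ f₂ → (p :* a :+ q :* a′) :+ gs :* (f₁ :* a :+ f₂ :* a′)
               := (p :+ gs :* f₁) :* a :+ (q :+ gs :* f₂) :* a′) refl p q κ.⟦ a ⟧ κ.⟦ a′ ⟧ (⟪ g ⟫ * s) κ.⟦ f₁ ⟧ κ.⟦ f₂ ⟧ ⟩
        (p + ⟪ g ⟫ * s * κ.⟦ f₁ ⟧) * κ.⟦ a ⟧ + (q + ⟪ g ⟫ * s * κ.⟦ f₂ ⟧) * κ.⟦ a′ ⟧ ∎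

  -- The empty continuant row is (1 , 0), so it suffices to complete `v` to an invertible matrix by
  -- a unit vector.
  inSpan-constant : ∀ v → ¬ (proj₁ v K.≈ K.0# × proj₂ v K.≈ K.0#) → ¬ ¬ InSpan (κᵛ v)
  inSpan-constant (x , y) v≉0 k = ¬¬-excluded-middle λ
    { (no x≉0) → k (inSpan-by (base refl refl) x y K.0# K.1#
        (x , KS.solve 2 (λ x y → x KS.:* KS.:1 KS.:- y KS.:* KS.:0 KS.:= x) K.refl x y , x≉0)
        (sym (trans (+-congˡ (*-zeroˡ _)) (trans (+-identityʳ _) (*-identityˡ _))))
        (sym (trans (+-congˡ (*-zeroˡ _)) (trans (+-identityʳ _) (*-identityˡ _)))))
    ; (yes x≈0) → k (inSpan-by (base refl refl) x y K.1# K.0#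
        (K.- y , KS.solve 2 (λ x y → x KS.:* KS.:0 KS.:- y KS.:* KS.:1 KS.:= KS.:- y) K.refl x y ,
          λ -y≈0 → v≉0 (x≈0 , K.trans (KS.solve 1 (λ y → y KS.:= KS.:- (KS.:- y)) K.refl y)
            (K.trans (K.-‿cong -y≈0) (KS.solve 0 (KS.:- KS.:0 KS.:= KS.:0) K.refl))))
        (sym (trans (+-congˡ (*-zeroˡ _)) (trans (+-identityʳ _) (*-identityˡ _))))
        (sym (trans (+-congˡ (*-zeroˡ _)) (trans (+-identityʳ _) (*-identityˡ _))))) }

  private
    scaled-degree : ∀ {k y n} → ¬ k K.≈ K.0# → HasDegree K.commutativeRing (⟦ ψ ⟧ y) n →
      HasDegree K.commutativeRing (⟦ ψ ⟧ (κ.⟦ k ⟧ * y)) n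
    scaled-degree {k} {y} k≉0 deg = S.hasDegree-cong
      (λ n → K.sym (K.trans (ψ.*-homo _ y n) (S.*ˢ-cong (ψ-κ k) (λ _ → K.refl) n)))
      (S.hasDegree-* field-isDomain constant-degree deg)
      where
      constant-degree : HasDegree K.commutativeRing (S.constant k) 0
      constant-degree = record { leading≉0 = k≉0 ; vanishes = λ { (N.s≤s _) → K.refl } }

    scaled-vanishes : ∀ k {y n} → VanishesFrom K.commutativeRing (⟦ ψ ⟧ y) n → VanishesFrom K.commutativeRing (⟦ ψ ⟧ (κ.⟦ k ⟧ * y)) n
    scaled-vanishes k {y} y≈0 {n} n≤ = K.trans (ψ.*-homo κ.⟦ k ⟧ y n) (K.trans (S.*ˢ-cong {g = ⟦ ψ ⟧ y} (ψ-κ k) (λ _ → K.refl) n)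
      (K.trans (S.constant-*ˢ k (⟦ ψ ⟧ y) n) (K.trans (K.*-congˡ (y≈0 n≤)) (K.zeroʳ k))))

    constant-vanishes : ∀ k → VanishesFrom K.commutativeRing (⟦ ψ ⟧ κ.⟦ k ⟧) 1
    constant-vanishes k {suc n} _ = ψ-κ k (suc n)

    degree-+ : ∀ {x y n} → HasDegree K.commutativeRing (⟦ ψ ⟧ x) n → VanishesFrom K.commutativeRing (⟦ ψ ⟧ y) n →
      HasDegree K.commutativeRing (⟦ ψ ⟧ (x + y)) n
    degree-+ {x} {y} deg y≈0 = S.hasDegree-cong (λ n → K.sym (ψ.+-homo x y n)) (S.hasDegree-+ deg y≈0)

    degree-cong : ∀ {x y n} → x ≈ y → HasDegree K.commutativeRing (⟦ ψ ⟧ y) n → HasDegree K.commutativeRing (⟦ ψ ⟧ x) n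
    degree-cong x≈y = S.hasDegree-cong (λ n → K.sym (ψ.⟦⟧-cong x≈y n))

    -- The degrees 1 and 2 of X and Z are distinct and positive, so neither the other variable nor
    -- the constant term can cancel the leading one.
    affine-degree : ∀ g → ¬ IsConstant g → ¬ ¬ ∃ λ n → HasDegree K.commutativeRing (⟦ ψ ⟧ ⟪ g ⟫) (suc n)
    affine-degree g@(affine α γ δ) nonconst k = ¬¬-excluded-middle λ
      { (no γ≉0) → k (1 , degree-+
          (degree-cong (+-comm _ _) (degree-+ (scaled-degree γ≉0 ψ-Z) (scaled-vanishes α (S.vanishes ψ-X))))
          (λ { (N.s≤s _) → constant-vanishes δ (N.s≤s N.z≤n) }))
      ; (yes γ≈0) → k (0 , degree-+
          (degree-cong (trans (+-congˡ (trans (*-congʳ (κ-0 γ≈0)) (*-zeroˡ _))) (+-identityʳ _))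
            (scaled-degree (λ α≈0 → nonconst (α≈0 , γ≈0)) ψ-X))
          (constant-vanishes δ)) }

    -- In g p₀ + q₀ the first term has larger degree than p₀, while q₀ stays below p₀. The last
    -- clause serves combinations without p: q is zero before the first `push` and has a degree
    -- afterwards.
    continuants-degree : ∀ {p q} → Continuants p q →
      ¬ ¬ ∃ λ n → HasDegree K.commutativeRing (⟦ ψ ⟧ p) n × VanishesFrom K.commutativeRing (⟦ ψ ⟧ q) n
                × (q ≈ 0# ⊎ ∃ (HasDegree K.commutativeRing (⟦ ψ ⟧ q)))
    continuants-degree (base {p} {q} p≈1 q≈0) k = k (0 ,
      S.hasDegree-cong (λ n → K.sym (K.trans (ψ.⟦⟧-cong p≈1 n) (ψ.1-homo n)))
        (record { leading≉0 = 1≉0 ; vanishes = λ { (N.s≤s _) → K.refl } }) ,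
      (λ _ → K.trans (ψ.⟦⟧-cong q≈0 _) (ψ.0-homo _)) ,
      inj₁ q≈0)
    continuants-degree (push {p₀ = p₀} pq₀ g nonconst p≈ q≈) k =
      affine-degree g nonconst λ (e , deg-g) →
      continuants-degree pq₀ λ (n , deg-p₀ , q₀-vanishes , _) →
      k (suc e N.+ n ,
         degree-cong p≈ (degree-+
           (S.hasDegree-cong (λ i → K.sym (ψ.*-homo ⟪ g ⟫ p₀ i)) (S.hasDegree-* field-isDomain deg-g deg-p₀))
           (λ le → q₀-vanishes (NP.≤-trans (NP.m≤n+m n (suc e)) le))) ,
         (λ le → K.trans (ψ.⟦⟧-cong q≈ _) (S.vanishes deg-p₀ (NP.≤-trans (N.s≤s (NP.m≤n+m n e)) le))) ,
         inj₂ (n , degree-cong q≈ deg-p₀))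

  -- The dot product is γ p + δ q with constants γ and δ. It has the degree of p unless γ = 0, and
  -- then that of q unless δ q = 0.
  inSpan-ψ-injective : ∀ {v} w → InSpan v → ⟦ ψ ⟧ (v ·ᵥ κᵛ w) S.≈ˢ (λ _ → K.0#) → ¬ ¬ v ·ᵥ κᵛ w ≈ 0#
  inSpan-ψ-injective {v} (w₁ , w₂) (inSpan {p} {q} pq (matrix g₁ g₂ g₃ g₄) _ (v₁≈ , v₂≈)) ψ≈0 k =
    continuants-degree pq λ (n , deg-p , q-vanishes , q-degree) → ¬¬-excluded-middle λ
      { (no γ≉0) → S.hasDegree-≉0 (degree-cong vw≈ (degree-+ (scaled-degree γ≉0 deg-p) (scaled-vanishes δ q-vanishes))) ψ≈0
      ; (yes γ≈0) → ¬¬-excluded-middle λ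
        { (yes δ≈0) → k (trans (without-p γ≈0) (trans (*-congʳ (κ-0 δ≈0)) (*-zeroˡ _)))
        ; (no δ≉0) → only-q γ≈0 δ≉0 q-degree } }
    where
    γ = g₁ K.* w₁ K.+ g₂ K.* w₂
    δ = g₃ K.* w₁ K.+ g₄ K.* w₂
    vw≈ : v ·ᵥ κᵛ (w₁ , w₂) ≈ κ.⟦ γ ⟧ * p + κ.⟦ δ ⟧ * q
    vw≈ = trans (+-cong (*-congʳ v₁≈) (*-congʳ v₂≈)) (trans
      (solve 8 (λ p q g₁ g₂ g₃ g₄ w₁ w₂ → (p :* g₁ :+ q :* g₃) :* w₁ :+ (p :* g₂ :+ q :* g₄) :* w₂
        := (g₁ :* w₁ :+ g₂ :* w₂) :* p :+ (g₃ :* w₁ :+ g₄ :* w₂) :* q) refl p q _ _ _ _ _ _)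
      (sym (+-cong (*-congʳ (trans (κ.+-homo _ _) (+-cong (κ.*-homo _ _) (κ.*-homo _ _))))
                   (*-congʳ (trans (κ.+-homo _ _) (+-cong (κ.*-homo _ _) (κ.*-homo _ _)))))))
    without-p : γ K.≈ K.0# → v ·ᵥ κᵛ (w₁ , w₂) ≈ κ.⟦ δ ⟧ * q
    without-p γ≈0 = trans vw≈ (trans (+-congʳ (trans (*-congʳ (κ-0 γ≈0)) (*-zeroˡ _))) (+-identityˡ _))
    only-q : γ K.≈ K.0# → ¬ δ K.≈ K.0# → q ≈ 0# ⊎ ∃ (HasDegree K.commutativeRing (⟦ ψ ⟧ q)) → ⊥
    only-q γ≈0 δ≉0 (inj₁ q≈0) = k (trans (without-p γ≈0) (trans (*-congˡ q≈0) (zeroʳ _)))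
    only-q γ≈0 δ≉0 (inj₂ (_ , deg-q)) = S.hasDegree-≉0 (degree-cong (without-p γ≈0) (scaled-degree δ≉0 deg-q)) ψ≈0

-- Every weak matrix is singular or regular relative to the fixed variables

module _ (F K : Field c ℓ) {m : ℕ} where
  private
    module F = Field F
    module K = Field K

  valueOf : (F.Carrier → K.Carrier) → (Fin m → K.Carrier) → WeakLabel F m → K.Carrier
  valueOf ι θ (wconst β)   = ι β
  valueOf ι θ (wlin i α β) = ι α K.* θ i K.+ ι β

  matrixAt : (F.Carrier → K.Carrier) → (Fin m → K.Carrier) → Matrix (WeakLabel F m) → Matrix K.Carrier
  matrixAt ι θ = mapMatrix (valueOf ι θ)

  valueOf-eval : (ι : FieldHom F K) (θ : Fin m → K.Carrier) →
    ∀ l → valueOf ⟦ ι ⟧ θ l ≡ ⟦ eval-hom F ι θ ⟧ (⟦_⟧w F l)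
  valueOf-eval ι θ (wconst β)   = ≡.refl
  valueOf-eval ι θ (wlin i α β) = ≡.refl

module FixedVariables (F K : Field c ℓ) (ι : FieldHom F K)
  {m : ℕ} (S : List (Fin m)) (θ : Fin m → Field.Carrier K) where
  private
    module F = Field F
    module K = Field K
    module ι = RingHom ι
    Lab = WeakLabel F m
  open FieldMatrices K

  data Constant : Lab → Set (c ⊔ ℓ) where
    const : ∀ {β} → Constant (wconst β)
    fixed : ∀ {i α β} → i ∈ S → Constant (wlin i α β)
    flat  : ∀ {i α β} → ι.⟦ α ⟧ K.≈ K.0# → Constant (wlin i α β)

  data Live : Fin m → Lab → Set (c ⊔ ℓ) where
    live : ∀ {i α β} → i ∉ S → ¬ ι.⟦ α ⟧ K.≈ K.0# → Live i (wlin i α β)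

  classify : ∀ l → ¬ ¬ (Constant l ⊎ ∃ λ i → Live i l)
  classify (wconst β) k = k (inj₁ const)
  classify (wlin i α β) k = ¬¬-excluded-middle λ
    { (yes i∈S) → k (inj₁ (fixed i∈S))
    ; (no i∉S) → ¬¬-excluded-middle λ
      { (yes α≈0) → k (inj₁ (flat α≈0))
      ; (no α≉0) → k (inj₂ (i , live i∉S α≉0)) } }

  -- Linear i l a b : the label l is a + b xᵢ.
  data Linear (i : Fin m) : Lab → K.Carrier → K.Carrier → Set (c ⊔ ℓ) where
    constant : ∀ {l} → Constant l → Linear i l (valueOf F K ι.⟦_⟧ θ l) K.0#
    variable′ : ∀ {α β} → Linear i (wlin i α β) ι.⟦ β ⟧ ι.⟦ α ⟧

  LinearMatrix : Fin m → Matrix Lab → Matrix K.Carrier → Matrix K.Carrier → Set (c ⊔ ℓ)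
  LinearMatrix i (matrix p q r s) (matrix a₁ a₂ a₃ a₄) (matrix b₁ b₂ b₃ b₄) =
    (Linear i p a₁ b₁ × Linear i q a₂ b₂) × (Linear i r a₃ b₃ × Linear i s a₄ b₄)

  -- In the expansion of det (A + B x) the last two conditions leave only the constant `det A`. For
  -- a matrix of constants `B` is zero and the pivot arbitrary.
  record Regular (M : Matrix Lab) : Set (c ⊔ ℓ) where
    field
      pivot      : Fin m
      A B        : Matrix K.Carrier
      linear     : LinearMatrix pivot M A B
      detA≉0     : ¬ det A K.≈ K.0#
      mixedDet≈0 : mixedDet A B K.≈ K.0#
      detB≈0     : det B K.≈ K.0#

  -- The target is an arbitrary ring, so that one computation serves both for values in fields and
  -- for restrictions to polynomial rings.
  module Evaluation {R : CommutativeRing d e} (κ : RingHom K.commutativeRing R) (τ : RingHom (polyRing F m) R)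
    (τ-con : ∀ x → CommutativeRing._≈_ R (⟦ τ ⟧ (con x)) (⟦ κ ⟧ ι.⟦ x ⟧))
    (τ-var : ∀ {j} → j ∈ S → CommutativeRing._≈_ R (⟦ τ ⟧ (var j)) (⟦ κ ⟧ (θ j))) where
    open CommutativeRing R renaming (zeroˡ to *-zeroˡ)
    private
      module κ = RingHom κ
      module τ = RingHom τ

      unfold : ∀ i α β → τ.⟦ ⟦_⟧w F (wlin i α β) ⟧ ≈ κ.⟦ ι.⟦ α ⟧ ⟧ * τ.⟦ var i ⟧ + κ.⟦ ι.⟦ β ⟧ ⟧
      unfold i α β = trans (τ.+-homo _ _) (+-cong (trans (τ.*-homo _ _) (*-congʳ (τ-con α))) (τ-con β))

    constant-value : ∀ {l} → Constant l → τ.⟦ ⟦_⟧w F l ⟧ ≈ κ.⟦ valueOf F K ι.⟦_⟧ θ l ⟧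
    constant-value (const {β}) = τ-con β
    constant-value (fixed {i} {α} {β} i∈S) = trans (unfold i α β)
      (trans (+-congʳ (*-congˡ (τ-var i∈S))) (sym (trans (κ.+-homo _ _) (+-congʳ (κ.*-homo _ _)))))
    constant-value (flat {i} {α} {β} α≈0) = trans (unfold i α β)
      (trans (+-congʳ (trans (*-congʳ κα≈0) (trans (*-zeroˡ _) (sym (trans (*-congʳ κα≈0) (*-zeroˡ _))))))
             (sym (trans (κ.+-homo _ _) (+-congʳ (κ.*-homo _ (θ i))))))
      where
      κα≈0 : κ.⟦ ι.⟦ α ⟧ ⟧ ≈ 0#
      κα≈0 = trans (κ.⟦⟧-cong α≈0) κ.0-homo

    linear-value : ∀ {i l a b} → Linear i l a b → τ.⟦ ⟦_⟧w F l ⟧ ≈ κ.⟦ a ⟧ + κ.⟦ b ⟧ * τ.⟦ var i ⟧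
    linear-value (constant l-const) = trans (constant-value l-const)
      (sym (trans (+-congˡ (trans (*-congʳ κ.0-homo) (*-zeroˡ _))) (+-identityʳ _)))
    linear-value {i} (variable′ {α} {β}) = trans (unfold i α β) (+-comm _ _)

  -- The assignment is total: the values on `S` and on the variables of `M` define the restrictions,
  -- and the others are drawn upon when only two variables are kept free.
  record Singular (M : Matrix Lab) : Set (lsuc (c ⊔ ℓ)) where
    field
      extension : FieldExtension K
    open FieldExtension extension public
    field
      θ′     : Fin m → Field.Carrier field′
      agrees : ∀ {i} → i ∈ S → Field._≈_ field′ (θ′ i) (⟦ embedding ⟧ (θ i))
      det≈0  : Field._≈_ field′ (FieldMatrices.det field′ (matrixAt F field′ (λ x → ⟦ embedding ⟧ ι.⟦ x ⟧) θ′ M)) (Field.0# field′)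

  _[_↦_] : (Fin m → K.Carrier) → Fin m → K.Carrier → Fin m → K.Carrier
  (θ′ [ i ↦ x ]) j with j Fin.≟ i
  ... | yes _ = x
  ... | no _  = θ′ j

  update-same : ∀ θ′ i x → (θ′ [ i ↦ x ]) i ≡ x
  update-same θ′ i x with i Fin.≟ i
  ... | yes _  = ≡.refl
  ... | no i≢i = contradiction ≡.refl i≢i

  update-other : ∀ θ′ i x {j} → ¬ j ≡ i → (θ′ [ i ↦ x ]) j ≡ θ′ j
  update-other θ′ i x {j} j≢i with j Fin.≟ i
  ... | yes j≡i = contradiction j≡i j≢i
  ... | no _    = ≡.refl

  Agrees : (Fin m → K.Carrier) → Set ℓ
  Agrees θ′ = ∀ {i} → i ∈ S → θ′ i K.≈ θ i

  private
    infix 4 _at_≈_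
    _at_≈_ : Lab → (Fin m → K.Carrier) → K.Carrier → Set ℓ
    l at θ′ ≈ x = valueOf F K ι.⟦_⟧ θ′ l K.≈ x

  constant-at : ∀ {l θ′} → Constant l → Agrees θ′ → l at θ′ ≈ valueOf F K ι.⟦_⟧ θ l
  constant-at {l} {θ′} l-const agrees = K.trans (K.reflexive (valueOf-eval F K ι θ′ l))
    (Evaluation.constant-value (id-hom _) (eval-hom F ι θ′) (λ _ → K.refl) agrees l-const)

  live-at : ∀ {i l} → Live i l → ∀ v → ∃ λ x → ∀ {θ′} → θ′ i ≡ x → l at θ′ ≈ v
  live-at (live {i} {α} {β} _ α≉0) v with K.inverse ι.⟦ α ⟧ α≉0
  ... | w , αw≈1 = w K.* (v K.- ι.⟦ β ⟧) , λ {θ′} θ′i≡x → begin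
    ι.⟦ α ⟧ K.* θ′ i K.+ ι.⟦ β ⟧                    ≈⟨ K.+-congʳ (K.*-congˡ (K.reflexive θ′i≡x)) ⟩
    ι.⟦ α ⟧ K.* (w K.* (v K.- ι.⟦ β ⟧)) K.+ ι.⟦ β ⟧ ≈⟨ K.+-congʳ (K.*-assoc _ _ _) ⟨
    ι.⟦ α ⟧ K.* w K.* (v K.- ι.⟦ β ⟧) K.+ ι.⟦ β ⟧   ≈⟨ K.+-congʳ (K.trans (K.*-congʳ αw≈1) (K.*-identityˡ _)) ⟩
    v K.- ι.⟦ β ⟧ K.+ ι.⟦ β ⟧                       ≈⟨ KS.solve 2 (λ v b → v KS.:- b KS.:+ b KS.:= v) K.refl v ι.⟦ β ⟧ ⟩
    v                                               ∎
    where
    open SetoidReasoning K.setoid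
    module KS = Solver K.commutativeRing

  live-∉ : ∀ {i l} → Live i l → i ∉ S
  live-∉ (live i∉S _) = i∉S

  update-agrees : ∀ {θ′ i x} → i ∉ S → Agrees θ′ → Agrees (θ′ [ i ↦ x ])
  update-agrees {θ′} {i} {x} i∉S agrees {j} j∈S =
    K.trans (K.reflexive (update-other θ′ i x λ { ≡.refl → i∉S j∈S })) (agrees j∈S)

  two-live-at : ∀ {i j l l′} → Live i l → Live j l′ → ¬ i ≡ j → ∀ v v′ →
    ∃ λ θ′ → Agrees θ′ × l at θ′ ≈ v × l′ at θ′ ≈ v′
  two-live-at {i} {j} l-live l′-live i≢j v v′ with live-at l-live v | live-at l′-live v′
  ... | x , l≈v | x′ , l′≈v′ = (θ [ i ↦ x ]) [ j ↦ x′ ] ,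
    update-agrees {x = x′} (live-∉ l′-live) (update-agrees {x = x} (live-∉ l-live) (λ _ → K.refl)) ,
    l≈v (≡.trans (update-other (θ [ i ↦ x ]) j x′ i≢j) (update-same θ i x)) ,
    l′≈v′ (update-same (θ [ i ↦ x ]) j x′)

  singular-at : ∀ {M} θ′ → Agrees θ′ → det (matrixAt F K ι.⟦_⟧ θ′ M) K.≈ K.0# → Singular M
  singular-at θ′ agrees det≈0 = record
    { extension = trivialExtension K ; θ′ = θ′ ; agrees = agrees ; det≈0 = det≈0 }

  private
    det-zero : ∀ x y z w → x K.* y K.≈ K.0# → z K.* w K.≈ K.0# → x K.* y K.- z K.* w K.≈ K.0#
    det-zero _ _ _ _ xy≈0 zw≈0 = K.trans (K.+-cong xy≈0 (K.-‿cong zw≈0)) (K.-‿inverseʳ K.0#)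

    zero-* : ∀ {x} y → x K.≈ K.0# → x K.* y K.≈ K.0#
    zero-* y x≈0 = K.trans (K.*-congʳ x≈0) (K.trans (K.*-comm _ _) (K.zeroʳ y))

    *-zero : ∀ x {y} → y K.≈ K.0# → x K.* y K.≈ K.0#
    *-zero x y≈0 = K.trans (K.*-congˡ y≈0) (K.zeroʳ x)

  -- Two live labels with different variables: adjacent ones can both be made zero,
  -- opposite ones can be given the values 1 and the product of the other two.
  module _ {p q r s : Lab} {i j : Fin m} (i≢j : ¬ i ≡ j) where
    singular-top : Live i p → Live j q → Singular (matrix p q r s)
    singular-top p-live q-live with two-live-at p-live q-live i≢j K.0# K.0#
    ... | θ′ , agrees , p≈0 , q≈0 = singular-at θ′ agrees (det-zero _ _ _ _ (zero-* _ p≈0) (zero-* _ q≈0))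

    singular-bottom : Live i r → Live j s → Singular (matrix p q r s)
    singular-bottom r-live s-live with two-live-at r-live s-live i≢j K.0# K.0#
    ... | θ′ , agrees , r≈0 , s≈0 = singular-at θ′ agrees (det-zero _ _ _ _ (*-zero _ s≈0) (*-zero _ r≈0))

    singular-left : Live i p → Live j r → Singular (matrix p q r s)
    singular-left p-live r-live with two-live-at p-live r-live i≢j K.0# K.0#
    ... | θ′ , agrees , p≈0 , r≈0 = singular-at θ′ agrees (det-zero _ _ _ _ (zero-* _ p≈0) (*-zero _ r≈0))

    singular-right : Live i q → Live j s → Singular (matrix p q r s)
    singular-right q-live s-live with two-live-at q-live s-live i≢j K.0# K.0#
    ... | θ′ , agrees , q≈0 , s≈0 = singular-at θ′ agrees (det-zero _ _ _ _ (*-zero _ s≈0) (zero-* _ q≈0))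

    singular-diagonal : Live i p → Live j s → Constant q → Constant r → Singular (matrix p q r s)
    singular-diagonal p-live s-live q-const r-const
      with two-live-at p-live s-live i≢j K.1# (valueOf F K ι.⟦_⟧ θ q K.* valueOf F K ι.⟦_⟧ θ r)
    ... | θ′ , agrees , p≈1 , s≈ = singular-at θ′ agrees (K.trans
      (K.+-cong (K.trans (K.*-cong p≈1 s≈) (K.*-identityˡ _)) (K.-‿cong (K.*-cong (constant-at q-const agrees) (constant-at r-const agrees))))
      (K.-‿inverseʳ _))

    singular-antidiagonal : Live i q → Live j r → Constant p → Constant s → Singular (matrix p q r s)
    singular-antidiagonal q-live r-live p-const s-const
      with two-live-at q-live r-live i≢j K.1# (valueOf F K ι.⟦_⟧ θ p K.* valueOf F K ι.⟦_⟧ θ s)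
    ... | θ′ , agrees , q≈1 , r≈ = singular-at θ′ agrees (K.trans
      (K.+-cong (K.*-cong (constant-at p-const agrees) (constant-at s-const agrees)) (K.-‿cong (K.trans (K.*-cong q≈1 r≈) (K.*-identityˡ _))))
      (K.-‿inverseʳ _))

  module _ {M : Matrix Lab} (i : Fin m) (A B : Matrix K.Carrier) (linear : LinearMatrix i M A B) where
    det-at : (L : FieldExtension K) →
      let open FieldExtension L
          module L = Field field′
      in (θ′ : Fin m → L.Carrier) → (∀ {j} → j ∈ S → θ′ j L.≈ ⟦ embedding ⟧ (θ j)) →
      FieldMatrices.det field′ (matrixAt F field′ (λ x → ⟦ embedding ⟧ ι.⟦ x ⟧) θ′ M) L.≈
      quadratic field′ (⟦ embedding ⟧ (det A)) (⟦ embedding ⟧ (mixedDet A B)) (⟦ embedding ⟧ (det B)) (θ′ i)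
    det-at L θ′ agrees = go A B linear
      where
      open FieldExtension L
      module L = Field field′
      module κ = RingHom embedding
      module LS = Solver L.commutativeRing
      open Evaluation embedding (eval-hom F (embedding ∘h ι) θ′) (λ _ → L.refl) agrees
      label-value : ∀ {l a b} → Linear i l a b → valueOf F field′ (λ x → κ.⟦ ι.⟦ x ⟧ ⟧) θ′ l L.≈ κ.⟦ a ⟧ L.+ κ.⟦ b ⟧ L.* θ′ i
      label-value {l} lin = L.trans (L.reflexive (valueOf-eval F field′ (embedding ∘h ι) θ′ l)) (linear-value lin)
      κ-det : ∀ p q r s → κ.⟦ p K.* s K.- q K.* r ⟧ L.≈ κ.⟦ p ⟧ L.* κ.⟦ s ⟧ L.- κ.⟦ q ⟧ L.* κ.⟦ r ⟧
      κ-det p q r s = L.trans (κ.+-homo _ _) (L.+-cong (κ.*-homo p s) (L.trans (κ.-‿homo _) (L.-‿cong (κ.*-homo q r))))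
      κ-mixed : ∀ p s p′ s′ q r q′ r′ → κ.⟦ p K.* s′ K.+ p′ K.* s K.- (q K.* r′ K.+ q′ K.* r) ⟧ L.≈
        κ.⟦ p ⟧ L.* κ.⟦ s′ ⟧ L.+ κ.⟦ p′ ⟧ L.* κ.⟦ s ⟧ L.- (κ.⟦ q ⟧ L.* κ.⟦ r′ ⟧ L.+ κ.⟦ q′ ⟧ L.* κ.⟦ r ⟧)
      κ-mixed p s p′ s′ q r q′ r′ = L.trans (κ.+-homo _ _) (L.+-cong (two p s′ p′ s) (L.trans (κ.-‿homo _) (L.-‿cong (two q r′ q′ r))))
        where
        two : ∀ x y z w → κ.⟦ x K.* y K.+ z K.* w ⟧ L.≈ κ.⟦ x ⟧ L.* κ.⟦ y ⟧ L.+ κ.⟦ z ⟧ L.* κ.⟦ w ⟧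
        two x y z w = L.trans (κ.+-homo _ _) (L.+-cong (κ.*-homo x y) (κ.*-homo z w))
      go : ∀ {M} A B → LinearMatrix i M A B → FieldMatrices.det field′ (matrixAt F field′ (λ x → ⟦ embedding ⟧ ι.⟦ x ⟧) θ′ M) L.≈
        κ.⟦ det A ⟧ L.+ κ.⟦ mixedDet A B ⟧ L.* θ′ i L.+ κ.⟦ det B ⟧ L.* (θ′ i L.* θ′ i)
      go {matrix p q r s} (matrix a₁ a₂ a₃ a₄) (matrix b₁ b₂ b₃ b₄) ((p-lin , q-lin) , (r-lin , s-lin)) = L.trans
        (L.+-cong (L.*-cong (label-value p-lin) (label-value s-lin)) (L.-‿cong (L.*-cong (label-value q-lin) (label-value r-lin))))
        (L.trans
          (LS.solve 9 (λ a₁ a₂ a₃ a₄ b₁ b₂ b₃ b₄ x →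
            (a₁ LS.:+ b₁ LS.:* x) LS.:* (a₄ LS.:+ b₄ LS.:* x) LS.:- (a₂ LS.:+ b₂ LS.:* x) LS.:* (a₃ LS.:+ b₃ LS.:* x) LS.:=
            (a₁ LS.:* a₄ LS.:- a₂ LS.:* a₃) LS.:+ (a₁ LS.:* b₄ LS.:+ b₁ LS.:* a₄ LS.:- (a₂ LS.:* b₃ LS.:+ b₂ LS.:* a₃)) LS.:* x
              LS.:+ (b₁ LS.:* b₄ LS.:- b₂ LS.:* b₃) LS.:* (x LS.:* x))
            L.refl κ.⟦ a₁ ⟧ κ.⟦ a₂ ⟧ κ.⟦ a₃ ⟧ κ.⟦ a₄ ⟧ κ.⟦ b₁ ⟧ κ.⟦ b₂ ⟧ κ.⟦ b₃ ⟧ κ.⟦ b₄ ⟧ (θ′ i))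
          (L.sym (L.+-cong (L.+-cong (κ-det a₁ a₂ a₃ a₄) (L.*-congʳ (κ-mixed a₁ a₄ b₁ b₄ a₂ a₃ b₂ b₃)))
            (L.*-congʳ (κ-det b₁ b₂ b₃ b₄)))))

    -- The determinant is a quadratic in the variable i. If nonconstant it has a root in an
    -- extension, which may be assigned because i is free; a vanishing constant is singular at θ
    -- itself. Freeness is asked only in the nonconstant case, since for a matrix of constants i is
    -- a dummy.
    linear-dichotomy : (¬ (mixedDet A B K.≈ K.0# × det B K.≈ K.0#) → i ∉ S) → ¬ ¬ (Singular M ⊎ Regular M)
    linear-dichotomy i-free k = ¬¬-excluded-middle λ
      { (no nonconstant) → root-exists K (det A) (mixedDet A B) (det B) nonconstant λ (L , x , root) →
          k (inj₁ (singular-root (i-free nonconstant) L x root))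
      ; (yes (AB≈0 , B≈0)) → ¬¬-excluded-middle λ
        { (no A≉0) → k (inj₂ record { pivot = i ; A = A ; B = B ; linear = linear ; detA≉0 = A≉0 ; mixedDet≈0 = AB≈0 ; detB≈0 = B≈0 })
        ; (yes A≈0) → k (inj₁ (singular-at θ (λ _ → K.refl) (K.trans (det-at (trivialExtension K) θ (λ _ → K.refl))
            (K.trans (K.+-cong (K.+-cong A≈0 (zero-* _ AB≈0)) (zero-* _ B≈0)) (K.trans (K.+-identityʳ _) (K.+-identityʳ _)))))) } }
      where
      singular-root : i ∉ S → (L : FieldExtension K) →
        let open FieldExtension L
            module L = Field field′
        in ∀ x → quadratic field′ (⟦ embedding ⟧ (det A)) (⟦ embedding ⟧ (mixedDet A B)) (⟦ embedding ⟧ (det B)) x L.≈ L.0# →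
        Singular M
      singular-root i∉S L x root = record
        { extension = L ; θ′ = θ″ ; agrees = agrees
        ; det≈0 = L.trans (det-at L θ″ agrees) (≡.subst (λ y →
            quadratic field′ (⟦ embedding ⟧ (det A)) (⟦ embedding ⟧ (mixedDet A B)) (⟦ embedding ⟧ (det B)) y L.≈ L.0#)
            (≡.sym at-i) root) }
        where
        open FieldExtension L
        module L = Field field′
        θ″ : Fin m → L.Carrier
        θ″ j with j Fin.≟ i
        ... | yes _ = x
        ... | no _  = ⟦ embedding ⟧ (θ j)
        at-i : θ″ i ≡ x
        at-i with i Fin.≟ i
        ... | yes _  = ≡.refl
        ... | no i≢i = contradiction ≡.refl i≢i
        agrees : ∀ {j} → j ∈ S → θ″ j L.≈ ⟦ embedding ⟧ (θ j)
        agrees {j} j∈S with j Fin.≟ i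
        ... | yes ≡.refl = contradiction j∈S i∉S
        ... | no _       = L.refl

  private
    Class : Lab → Set (c ⊔ ℓ)
    Class l = Constant l ⊎ ∃ λ i → Live i l

    LinearIn : Fin m → Lab → Set (c ⊔ ℓ)
    LinearIn i l = ∃ λ a → ∃ λ b → Linear i l a b

    live-linear : ∀ {i l} → Live i l → LinearIn i l
    live-linear (live _ _) = _ , _ , variable′

    constant-linear : ∀ {i l} → Constant l → LinearIn i l
    constant-linear l-const = _ , _ , constant l-const

    compare : ∀ i {l} → Class l → LinearIn i l ⊎ (∃ λ j → ¬ i ≡ j × Live j l)
    compare i (inj₁ l-const) = inj₁ (constant-linear l-const)
    compare i (inj₂ (j , l-live)) with i Fin.≟ j
    ... | yes ≡.refl = inj₁ (live-linear l-live)
    ... | no i≢j     = inj₂ (j , i≢j , l-live)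

    all-linear : ∀ {p q r s} i → i ∉ S → LinearIn i p → LinearIn i q → LinearIn i r → LinearIn i s →
      ¬ ¬ (Singular (matrix p q r s) ⊎ Regular (matrix p q r s))
    all-linear i i∉S (a₁ , b₁ , p) (a₂ , b₂ , q) (a₃ , b₃ , r) (a₄ , b₄ , s) =
      linear-dichotomy i (matrix a₁ a₂ a₃ a₄) (matrix b₁ b₂ b₃ b₄) ((p , q) , (r , s)) (λ _ → i∉S)

    all-constant : ∀ {p q r s} → Fin m → Constant p → Constant q → Constant r → Constant s →
      ¬ ¬ (Singular (matrix p q r s) ⊎ Regular (matrix p q r s))
    all-constant i p q r s =
      linear-dichotomy i _ (matrix K.0# K.0# K.0# K.0#) ((constant p , constant q) , (constant r , constant s))
        (λ nonconstant → ⊥-elim (nonconstant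
          (K.trans (K.+-cong (K.trans (K.+-cong (*-zero _ K.refl) (zero-* _ K.refl)) (K.+-identityʳ K.0#))
                             (K.-‿cong (K.trans (K.+-cong (*-zero _ K.refl) (zero-* _ K.refl)) (K.+-identityʳ K.0#))))
                   (K.-‿inverseʳ K.0#) ,
           det-zero _ _ _ _ (K.zeroʳ _) (K.zeroʳ _))))

    ≢-sym : ∀ {i j : Fin m} → ¬ i ≡ j → ¬ j ≡ i
    ≢-sym i≢j j≡i = i≢j (≡.sym j≡i)

    -- The first live label, in the order p, q, r, s, chooses the variable.
    cases : ∀ {p q r s} → Fin m → Class p → Class q → Class r → Class s →
      ¬ ¬ (Singular (matrix p q r s) ⊎ Regular (matrix p q r s))
    cases _ (inj₂ (i , p)) cq cr cs k with compare i cq | compare i cr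
    ... | inj₂ (j , i≢j , q) | _ = k (inj₁ (singular-top i≢j p q))
    ... | inj₁ _ | inj₂ (j , i≢j , r) = k (inj₁ (singular-left i≢j p r))
    ... | inj₁ lq | inj₁ lr with compare i cs | cq | cr
    ... | inj₁ ls | _ | _ = all-linear i (live-∉ p) (live-linear p) lq lr ls k
    ... | inj₂ (j , i≢j , s) | inj₁ q | inj₁ r = k (inj₁ (singular-diagonal i≢j p s q r))
    -- That `lq` forces i′ = i is not extracted; either answer exhibits two adjacent live labels
    -- with different variables.
    ... | inj₂ (j , i≢j , s) | inj₂ (i′ , q) | _ with i′ Fin.≟ i
    ...   | yes ≡.refl = k (inj₁ (singular-right i≢j q s))
    ...   | no i′≢i    = k (inj₁ (singular-top (≢-sym i′≢i) p q))
    cases _ (inj₂ (i , p)) cq cr cs k | inj₁ lq | inj₁ lr | inj₂ (j , i≢j , s) | inj₁ q | inj₂ (i′ , r) with i′ Fin.≟ i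
    ...   | yes ≡.refl = k (inj₁ (singular-bottom i≢j r s))
    ...   | no i′≢i    = k (inj₁ (singular-left (≢-sym i′≢i) p r))
    cases _ (inj₁ p) (inj₂ (i , q)) cr cs k with compare i cs | cr
    ... | inj₂ (j , i≢j , s) | _ = k (inj₁ (singular-right i≢j q s))
    ... | inj₁ ls | inj₁ r = all-linear i (live-∉ q) (constant-linear p) (live-linear q) (constant-linear r) ls k
    ... | inj₁ ls | inj₂ (j , r) with i Fin.≟ j | cs
    ...   | yes ≡.refl | _ = all-linear i (live-∉ q) (constant-linear p) (live-linear q) (live-linear r) ls k
    ...   | no i≢j | inj₁ s = k (inj₁ (singular-antidiagonal i≢j q r p s))
    ...   | no i≢j | inj₂ (i′ , s) with i′ Fin.≟ i
    ...     | yes ≡.refl = k (inj₁ (singular-bottom (≢-sym i≢j) r s))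
    ...     | no i′≢i    = k (inj₁ (singular-right (≢-sym i′≢i) q s))
    cases _ (inj₁ p) (inj₁ q) (inj₂ (i , r)) cs k with compare i cs
    ... | inj₂ (j , i≢j , s) = k (inj₁ (singular-bottom i≢j r s))
    ... | inj₁ ls = all-linear i (live-∉ r) (constant-linear p) (constant-linear q) (live-linear r) ls k
    cases _ (inj₁ p) (inj₁ q) (inj₁ r) (inj₂ (i , s)) k =
      all-linear i (live-∉ s) (constant-linear p) (constant-linear q) (constant-linear r) (live-linear s) k
    cases i₀ (inj₁ p) (inj₁ q) (inj₁ r) (inj₁ s) k = all-constant i₀ p q r s k

  -- `i₀` is the dummy pivot of a matrix without live labels.
  singular-or-regular : Fin m → ∀ M → ¬ ¬ (Singular M ⊎ Regular M)
  singular-or-regular i₀ (matrix p q r s) k =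
    classify p λ cp → classify q λ cq → classify r λ cr → classify s λ cs → cases i₀ cp cq cr cs k

-- The separating polynomial and its general program

avoids : ∀ {n m} (g : Fin n → Fin m) → (∀ {i j} → g i ≡ g j → i ≡ j) →
  (S : List (Fin m)) → length S N.< n → ∃ λ i → g i ∉ S
avoids {n} g g-injective S |S|<n = FinP.¬∀⟶∃¬ n (λ i → g i ∈ S) (λ i → g i ∈? S) not-all
  where
  open DecMembership Fin._≟_ using (_∈?_)
  not-all : ¬ (∀ i → g i ∈ S)
  -- If all values of `g` were in `S`, their positions there would collide, and equal positions hold
  -- equal values.
  not-all all with FinP.pigeonhole |S|<n (λ i → index (all i))
  ... | i , j , i<j , eq = FinP.<⇒≢ i<j (g-injective (≡.trans (AnyP.lookup-index (all i))
    (≡.trans (≡.cong (lookup S) eq) (≡.sym (AnyP.lookup-index (all j))))))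

module HomSums (F : Field c ℓ) {m : ℕ} {R : CommutativeRing d e} (τ τ′ : RingHom (polyRing F m) R) where
  open CommutativeRing R
  open Solver R
  private
    module τ = RingHom τ
    module τ′ = RingHom τ′

  sumP-agree : ∀ k {f : Fin k → Poly F m} → (∀ i → τ.⟦ f i ⟧ ≈ τ′.⟦ f i ⟧) → τ.⟦ sumP F k f ⟧ ≈ τ′.⟦ sumP F k f ⟧
  sumP-agree zero    agree = trans τ.0-homo (sym τ′.0-homo)
  sumP-agree (suc k) agree = trans (τ.+-homo _ _)
    (trans (+-cong (agree Fin.zero) (sumP-agree k (λ i → agree (Fin.suc i)))) (sym (τ′.+-homo _ _)))

  -- Homomorphisms that agree off the index z differ on the sum by their difference at z; the
  -- additive form keeps the induction free of subtraction.
  sumP-shift : ∀ k {f : Fin k → Poly F m} z → (∀ i → ¬ i ≡ z → τ.⟦ f i ⟧ ≈ τ′.⟦ f i ⟧) →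
    τ′.⟦ sumP F k f ⟧ + τ.⟦ f z ⟧ ≈ τ.⟦ sumP F k f ⟧ + τ′.⟦ f z ⟧
  sumP-shift (suc k) {f} Fin.zero agree = trans (+-congʳ (τ′.+-homo _ _))
    (trans (+-congʳ (+-congˡ (sym (sumP-agree k (λ i → agree (Fin.suc i) λ ())))))
    (trans (solve 3 (λ x′ s x → x′ :+ s :+ x := x :+ s :+ x′) refl τ′.⟦ f Fin.zero ⟧ τ.⟦ sumP F k (λ i → f (Fin.suc i)) ⟧ τ.⟦ f Fin.zero ⟧)
    (+-congʳ (sym (τ.+-homo _ _)))))
  sumP-shift (suc k) {f} (Fin.suc z) agree = trans (+-congʳ (τ′.+-homo _ _))
    (trans (+-assoc _ _ _)
    (trans (+-cong (sym (agree Fin.zero λ ())) (sumP-shift k z (λ i i≢z → agree (Fin.suc i) (λ eq → i≢z (FinP.suc-injective eq)))))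
    (trans (sym (+-assoc _ _ _)) (+-congʳ (sym (τ.+-homo _ _))))))

-- Nine variables for each of the two linear forms of the separating polynomial: one
-- of them stays free when the at most eight variables of two matrices are fixed.
numVars : ℕ
numVars = 9 N.+ 9

isFirst : Fin numVars → Bool
isFirst i = [ (λ _ → true) , (λ _ → false) ] (splitAt 9 i)

isFirst-↑ˡ : ∀ i → isFirst (i ↑ˡ 9) ≡ true
isFirst-↑ˡ i = ≡.cong [ (λ _ → true) , (λ _ → false) ] (FinP.splitAt-↑ˡ 9 i 9)

isFirst-↑ʳ : ∀ i → isFirst (9 ↑ʳ i) ≡ false
isFirst-↑ʳ i = ≡.cong [ (λ _ → true) , (λ _ → false) ] (FinP.splitAt-↑ʳ 9 9 i)

module Witness (F : Field c ℓ) where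
  private module F = Field F

  m : ℕ
  m = numVars

  coefficient : Bool → Fin m → F.Carrier
  coefficient true  i = if isFirst i then F.1# else F.0#
  coefficient false i = if isFirst i then F.0# else F.1#

  form : Bool → Poly F m
  form s = ⟦_⟧g F (coefficient s , F.0#)

  -- Abstract, so that the sums of eighteen terms are never unfolded.
  abstract
    witness : Poly F m
    witness = form true ⊛ form true ⊕ form false

    witness-def : _≋_ F witness (form true ⊛ form true ⊕ form false)
    witness-def = ≋-refl

  -- The row (L₁ , 1) followed by the column (L₁ , L₂), on 1 + 2 + 1 vertices.
  witnessABP : ABP F (GenLabel F m)
  witnessABP = abp (step 2 (N.s≤s N.z≤n) (N.s≤s (N.s≤s N.z≤n)) start
                      (λ { _ Fin.zero → coefficient true , F.0# ; _ (Fin.suc _) → (λ _ → F.0#) , F.1# }))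
                   (λ { Fin.zero _ → coefficient true , F.0# ; (Fin.suc _) _ → coefficient false , F.0# })

  private
    module P = CommutativeRing (polyRing F m)

  witnessABP-value : abpValue F (⟦_⟧g F) witnessABP P.≈ witness
  witnessABP-value = P.trans (P.+-cong
    (P.*-congʳ (P.trans (P.+-identityʳ _) (P.*-identityˡ _)))
    (P.trans (P.+-identityʳ _) (P.trans (P.*-congʳ
      (P.trans (P.+-identityʳ _) (P.trans (P.*-identityˡ _)
        (P.trans (P.+-congʳ (Sums.sumP-0 F m (λ i → _≋_.zeroˡ (var i)))) (P.+-identityˡ _)))))
      (P.*-identityˡ _)))) (P.sym witness-def)

  witnessFamily : Family F
  witnessFamily = record { nvars = λ _ → m ; poly = λ _ → witness }

  constant-polyBounded : ∀ k → PolyBounded F (λ _ → k)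
  constant-polyBounded k = k , λ n → NP.m≤n+m k _

  witness-general : VP₂gen F witnessFamily
  witness-general = constant-polyBounded m , (λ _ → 4) , constant-polyBounded 4 ,
    λ n → witnessABP , NP.≤-refl , witnessABP-value

  coefficient-own : ∀ s i → isFirst i ≡ s → coefficient s i ≡ F.1#
  coefficient-own true  i eq rewrite eq = ≡.refl
  coefficient-own false i eq rewrite eq = ≡.refl

  coefficient-other : ∀ s i → isFirst i ≡ not s → coefficient s i ≡ F.0#
  coefficient-other true  i eq rewrite eq = ≡.refl
  coefficient-other false i eq rewrite eq = ≡.refl

  -- All that is ever needed of the sums of eighteen terms is their response to a change of a single
  -- variable z.
  module Shift {R : CommutativeRing d e} (τ τ′ : RingHom (polyRing F m) R)
    (con-agree : ∀ x → CommutativeRing._≈_ R (⟦ τ ⟧ (con x)) (⟦ τ′ ⟧ (con x)))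
    (z : Fin m) (var-agree : ∀ i → ¬ i ≡ z → CommutativeRing._≈_ R (⟦ τ ⟧ (var i)) (⟦ τ′ ⟧ (var i))) where
    open CommutativeRing R
    private
      module τ = RingHom τ
      module τ′ = RingHom τ′
    open Solver R
    open SetoidReasoning setoid

    private
      terms : Bool → Fin m → Poly F m
      terms s i = con (coefficient s i) ⊛ var i

      terms-agree : ∀ s i → ¬ i ≡ z → τ.⟦ terms s i ⟧ ≈ τ′.⟦ terms s i ⟧
      terms-agree s i i≢z = trans (τ.*-homo _ _) (trans (*-cong (con-agree _) (var-agree i i≢z)) (sym (τ′.*-homo _ _)))

      own-term : (υ : RingHom (polyRing F m) R) → ∀ s → isFirst z ≡ s → ⟦ υ ⟧ (terms s z) ≈ ⟦ υ ⟧ (var z)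
      own-term υ s eq = RingHom.⟦⟧-cong υ (P.trans (P.*-congʳ (con-cong (F.reflexive (coefficient-own s z eq)))) (P.*-identityˡ _))

      other-term : (υ : RingHom (polyRing F m) R) → ∀ s → isFirst z ≡ not s → ⟦ υ ⟧ (terms s z) ≈ 0#
      other-term υ s eq = trans (RingHom.⟦⟧-cong υ
        (P.trans (P.*-congʳ (con-cong (F.reflexive (coefficient-other s z eq)))) (_≋_.zeroˡ (var z)))) (RingHom.0-homo υ)

      form-value : (υ : RingHom (polyRing F m) R) → ∀ s → ⟦ υ ⟧ (form s) ≈ ⟦ υ ⟧ (sumP F m (terms s))
      form-value υ s = RingHom.⟦⟧-cong υ (P.+-identityʳ _)

    form-shift : ∀ s → isFirst z ≡ s → τ′.⟦ form s ⟧ + τ.⟦ var z ⟧ ≈ τ.⟦ form s ⟧ + τ′.⟦ var z ⟧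
    form-shift s eq = begin
      τ′.⟦ form s ⟧ + τ.⟦ var z ⟧              ≈⟨ +-cong (form-value τ′ s) (sym (own-term τ s eq)) ⟩
      τ′.⟦ sumP F m (terms s) ⟧ + τ.⟦ terms s z ⟧ ≈⟨ HomSums.sumP-shift F τ τ′ m z (terms-agree s) ⟩
      τ.⟦ sumP F m (terms s) ⟧ + τ′.⟦ terms s z ⟧ ≈⟨ +-cong (sym (form-value τ s)) (own-term τ′ s eq) ⟩
      τ.⟦ form s ⟧ + τ′.⟦ var z ⟧              ∎

    form-fixed : ∀ s → isFirst z ≡ not s → τ′.⟦ form s ⟧ ≈ τ.⟦ form s ⟧
    form-fixed s eq = begin
      τ′.⟦ form s ⟧                              ≈⟨ trans (form-value τ′ s) (sym (+-identityʳ _)) ⟩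
      τ′.⟦ sumP F m (terms s) ⟧ + 0#             ≈⟨ +-congˡ (other-term τ s eq) ⟨
      τ′.⟦ sumP F m (terms s) ⟧ + τ.⟦ terms s z ⟧ ≈⟨ HomSums.sumP-shift F τ τ′ m z (terms-agree s) ⟩
      τ.⟦ sumP F m (terms s) ⟧ + τ′.⟦ terms s z ⟧ ≈⟨ +-congˡ (other-term τ′ s eq) ⟩
      τ.⟦ sumP F m (terms s) ⟧ + 0#              ≈⟨ trans (+-identityʳ _) (sym (form-value τ s)) ⟩
      τ.⟦ form s ⟧                               ∎

    witness-value : (υ : RingHom (polyRing F m) R) →
      ⟦ υ ⟧ witness ≈ ⟦ υ ⟧ (form true) * ⟦ υ ⟧ (form true) + ⟦ υ ⟧ (form false)
    witness-value υ = trans (RingHom.⟦⟧-cong υ witness-def) (trans (RingHom.+-homo υ _ _) (+-congʳ (RingHom.*-homo υ _ _)))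

    -- A variable of the second form occurs in L₂ only, with coefficient 1, so the polynomial
    -- changes by exactly as much as z does.
    witness-shift : isFirst z ≡ false → τ′.⟦ witness ⟧ + τ.⟦ var z ⟧ ≈ τ.⟦ witness ⟧ + τ′.⟦ var z ⟧
    witness-shift eq = begin
      τ′.⟦ witness ⟧ + τ.⟦ var z ⟧
        ≈⟨ +-congʳ (trans (witness-value τ′) (+-congʳ (*-cong (form-fixed true eq) (form-fixed true eq)))) ⟩
      τ.⟦ form true ⟧ * τ.⟦ form true ⟧ + τ′.⟦ form false ⟧ + τ.⟦ var z ⟧
        ≈⟨ trans (+-assoc _ _ _) (trans (+-congˡ (form-shift false eq)) (sym (+-assoc _ _ _))) ⟩
      τ.⟦ form true ⟧ * τ.⟦ form true ⟧ + τ.⟦ form false ⟧ + τ′.⟦ var z ⟧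
        ≈⟨ +-congʳ (witness-value τ) ⟨
      τ.⟦ witness ⟧ + τ′.⟦ var z ⟧ ∎

-- Restrictions and their irreducibility

assign : (K : Field c ℓ) {m : ℕ} → (Fin m → Bool) → (Fin m → Field.Carrier K) → Fin m → Poly K m
assign K free θ i = if free i then var i else con (θ i)

-- The target keeps all m variables, assigned ones included, so that restrictions compose without
-- renumbering.
substitution : (F K : Field c ℓ) → FieldHom F K →
  {m : ℕ} → (Fin m → Bool) → (Fin m → Field.Carrier K) → RingHom (polyRing F m) (polyRing K m)
substitution F K ι {m} free θ = eval-hom F (con-hom K m ∘h ι) (assign K free θ)

assign-fixed : (K : Field c ℓ) {m : ℕ} (free : Fin m → Bool) (θ : Fin m → Field.Carrier K) →
  ∀ {i} → free i ≡ false → assign K free θ i ≡ con (θ i)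
assign-fixed K free θ {i} eq rewrite eq = ≡.refl

assign-free : (K : Field c ℓ) {m : ℕ} (free : Fin m → Bool) (θ : Fin m → Field.Carrier K) →
  ∀ {i} → free i ≡ true → assign K free θ i ≡ var i
assign-free K free θ {i} eq rewrite eq = ≡.refl

-- Fixing further variables, possibly over a larger field, factors through the first restriction;
-- identities and units carry over along the second factor.
module Refinement (F K K′ : Field c ℓ)
  (ι : FieldHom F K)
  (ι′ : FieldHom F K′)
  (κ : FieldHom K K′) {m : ℕ}
  (ι′≈κι : ∀ x → Field._≈_ K′ (⟦ ι′ ⟧ x) (⟦ κ ⟧ (⟦ ι ⟧ x)))
  (free free′ : Fin m → Bool) (θ : Fin m → Field.Carrier K) (θ′ : Fin m → Field.Carrier K′)
  (refines : ∀ i → free i ≡ false → free′ i ≡ false × Field._≈_ K′ (θ′ i) (⟦ κ ⟧ (θ i))) where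
  private
    module P′ = CommutativeRing (polyRing K′ m)

  refine : RingHom (polyRing K m) (polyRing K′ m)
  refine = substitution K K′ κ free′ θ′

  refine-substitution : ∀ p → ⟦ substitution F K′ ι′ free′ θ′ ⟧ p P′.≈ ⟦ refine ⟧ (⟦ substitution F K ι free θ ⟧ p)
  refine-substitution = poly-hom-unique F (substitution F K′ ι′ free′ θ′) (refine ∘h substitution F K ι free θ)
    on-var (λ x → con-cong (ι′≈κι x))
    where
    on-var : ∀ i → assign K′ free′ θ′ i P′.≈ ⟦ refine ⟧ (assign K free θ i)
    on-var i with free i in eq
    ... | true  = P′.refl
    ... | false = P′.trans (P′.reflexive (assign-fixed K′ free′ θ′ (proj₁ (refines i eq)))) (con-cong (proj₂ (refines i eq)))

unit-cancel : (R : CommutativeRing a b) (let open CommutativeRing R) → ∀ {x y} → Unit R x → x * y ≈ 0# → y ≈ 0#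
unit-cancel R {x} {y} (w , xw≈1) xy≈0 = begin
  y           ≈⟨ *-identityˡ y ⟨
  1# * y      ≈⟨ *-congʳ (trans (sym xw≈1) (*-comm x w)) ⟩
  w * x * y   ≈⟨ *-assoc w x y ⟩
  w * (x * y) ≈⟨ *-congˡ xy≈0 ⟩
  w * 0#      ≈⟨ zeroʳ w ⟩
  0#          ∎
  where
  open CommutativeRing R
  open SetoidReasoning setoid

unit-* : (R : CommutativeRing a b) (let open CommutativeRing R) → ∀ {x y} → Unit R x → Unit R y → Unit R (x * y)
unit-* R {x} {y} (v , xv≈1) (w , yw≈1) = v * w ,
  trans (solve 4 (λ x y v w → x :* y :* (v :* w) := x :* v :* (y :* w)) refl x y v w) (trans (*-cong xv≈1 yw≈1) (*-identityˡ 1#))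
  where
  open CommutativeRing R
  open Solver R

poly-0≉1 : (K : Field c ℓ) {m : ℕ} → let open CommutativeRing (polyRing K m) in ¬ 1# ≈ 0#
poly-0≉1 K {m} 1≈0 = Field.0≉1 K (Field.sym K (RingHom.⟦⟧-cong (eval-hom K {m} (id-hom _) (λ _ → Field.0# K)) 1≈0))

-- A polynomial g that some substitutions for the variable z turn into 0 and 1.
-- Then p − p[z ↦ z − g] is a multiple of g for every p, so g is prime.
module Coordinate (K : Field c ℓ) {m : ℕ} (g : Poly K m) (z : Fin m) where
  open CommutativeRing (polyRing K m) renaming (zeroˡ to *-zeroˡ)
  private module PS = Solver (polyRing K m)

  -- When g is z plus terms free of z, sending z to z + (h - g) sends g to h.
  translate : Carrier → Fin m → Carrier
  translate h i with i Fin.≟ z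
  ... | yes _ = var i + (h - g)
  ... | no _  = var i

  translation : Carrier → RingHom (polyRing K m) (polyRing K m)
  translation h = eval-hom K (con-hom K m) (translate h)

  translate-other : ∀ h {i} → ¬ i ≡ z → translate h i ≡ var i
  translate-other h {i} i≢z with i Fin.≟ z
  ... | yes i≡z = contradiction i≡z i≢z
  ... | no _    = ≡.refl

  translate-same : ∀ h → translate h z ≡ var z + (h - g)
  translate-same h with z Fin.≟ z
  ... | yes _  = ≡.refl
  ... | no z≢z = contradiction ≡.refl z≢z

  remainder : ∀ p → ∃ λ q → p ≈ ⟦ translation 0# ⟧ p + g * q
  remainder (var i) with i Fin.≟ z
  ... | no _  = 0# , sym (trans (+-congˡ (zeroʳ g)) (+-identityʳ _))
  ... | yes _ = 1# , sym (trans (+-congˡ (*-identityʳ g)) (trans (+-assoc _ _ _)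
    (trans (+-congˡ (trans (+-assoc _ _ _) (trans (+-identityˡ _) (-‿inverseˡ g)))) (+-identityʳ _))))
  remainder (con x) = 0# , sym (trans (+-congˡ (zeroʳ g)) (+-identityʳ _))
  remainder (p ⊕ q) with remainder p | remainder q
  ... | r , p≈ | s , q≈ = r + s , trans (+-cong p≈ q≈)
    (PS.solve 5 (λ p g r q s → (p PS.:+ g PS.:* r) PS.:+ (q PS.:+ g PS.:* s) PS.:= (p PS.:+ q) PS.:+ g PS.:* (r PS.:+ s)) refl _ g r _ s)
  remainder (p ⊛ q) with remainder p | remainder q
  ... | r , p≈ | s , q≈ = ⟦ translation 0# ⟧ p * s + r * ⟦ translation 0# ⟧ q + g * (r * s) , trans (*-cong p≈ q≈)
    (PS.solve 5 (λ p g r q s → (p PS.:+ g PS.:* r) PS.:* (q PS.:+ g PS.:* s)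
      PS.:= p PS.:* q PS.:+ g PS.:* (p PS.:* s PS.:+ r PS.:* q PS.:+ g PS.:* (r PS.:* s))) refl _ g r _ s)

  module _ (to-0 : ⟦ translation 0# ⟧ g ≈ 0#) (to-1 : ⟦ translation 1# ⟧ g ≈ 1#) where
    g≉0 : ¬ g ≈ 0#
    g≉0 g≈0 = poly-0≉1 K (trans (sym to-1) (trans (RingHom.⟦⟧-cong (translation 1#) g≈0) (RingHom.0-homo (translation 1#))))

    private
      -- By `remainder`, p = g r; then g (q r - 1) = 0 in a domain, and r is an inverse of q.
      cofactor-unit : ∀ p q → p * q ≈ g → ⟦ translation 0# ⟧ p ≈ 0# → ¬ ¬ Unit (polyRing K m) q
      cofactor-unit p q pq≈g p↦0 k with remainder p
      ... | r , p≈ = poly-isDomain K m g*≈0 g≉0 (λ ≈0 → k (r , x-1≈0⇒x≈1 ≈0))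
        where
        open SetoidReasoning setoid
        g*≈0 : g * (q * r - 1#) ≈ 0#
        g*≈0 = begin
          g * (q * r - 1#)             ≈⟨ trans (distribˡ′ g (q * r) (- 1#)) (+-congˡ (g*-1)) ⟩
          g * (q * r) - g              ≈⟨ +-congʳ (PS.solve 3 (λ g q r → g PS.:* (q PS.:* r) PS.:= g PS.:* r PS.:* q) refl g q r) ⟩
          g * r * q - g                ≈⟨ +-congʳ (*-congʳ (trans p≈ (trans (+-congʳ p↦0) (+-identityˡ _)))) ⟨
          p * q - g                    ≈⟨ +-congʳ pq≈g ⟩
          g - g                        ≈⟨ -‿inverseʳ g ⟩
          0#                           ∎
          where
          distribˡ′ = CommutativeRing.distribˡ (polyRing K m)
          g*-1 : g * - 1# ≈ - g
          g*-1 = trans (PS.solve 2 (λ g y → g PS.:* (PS.:- y) PS.:= PS.:- (g PS.:* y)) refl g 1#) (-‿cong (*-identityʳ g))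
        x-1≈0⇒x≈1 : ∀ {x} → x - 1# ≈ 0# → x ≈ 1#
        x-1≈0⇒x≈1 {x} eq = trans (PS.solve 2 (λ x y → x PS.:= x PS.:- y PS.:+ y) refl x 1#) (trans (+-congʳ eq) (+-identityˡ 1#))

    -- The translation towards 0 kills g = p q, hence one of the two factors, and the other one is
    -- then a unit.
    irreducible : ∀ p q → p * q ≈ g → ¬ ¬ (Unit (polyRing K m) p ⊎ Unit (polyRing K m) q)
    irreducible p q pq≈g k = ¬¬-excluded-middle λ
      { (yes p↦0) → cofactor-unit p q pq≈g p↦0 (λ u → k (inj₂ u))
      ; (no p↦≉0) → ¬¬-excluded-middle λ
        { (yes q↦0) → cofactor-unit q p (trans (*-comm q p) pq≈g) q↦0 (λ u → k (inj₁ u))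
        ; (no q↦≉0) → poly-isDomain K m
            (trans (sym (RingHom.*-homo (translation 0#) p q)) (trans (RingHom.⟦⟧-cong (translation 0#) pq≈g) to-0)) p↦≉0 q↦≉0 } }

module RestrictedWitness (F K : Field c ℓ) (ι : FieldHom F K)
  (free : Fin numVars → Bool) (θ : Fin numVars → Field.Carrier K)
  (z : Fin numVars) (z-second : isFirst z ≡ false) (z-free : free z ≡ true) where
  open Witness F
  open CommutativeRing (polyRing K m)
  private
    module PS = Solver (polyRing K m)
    σ = substitution F K ι free θ
    g = ⟦ σ ⟧ witness
    module C = Coordinate K g z

    to : ∀ h → ⟦ C.translation h ⟧ g ≈ h
    to h = trans (PS.solve 2 (λ x y → x PS.:= x PS.:+ y PS.:- y) refl (⟦ C.translation h ⟧ g) (var z))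
      (trans (+-congʳ shifted)
             (PS.solve 3 (λ g z h → g PS.:+ (z PS.:+ (h PS.:- g)) PS.:- z PS.:= h) refl g (var z) h))
      where
      σz≡z : ⟦ σ ⟧ (var z) ≡ var z
      σz≡z = assign-free K free θ z-free
      var-agree : ∀ i → ¬ i ≡ z → ⟦ σ ⟧ (var i) ≈ ⟦ C.translation h ⟧ (⟦ σ ⟧ (var i))
      var-agree i i≢z with free i
      ... | true  = reflexive (≡.sym (C.translate-other h i≢z))
      ... | false = refl
      shifted : ⟦ C.translation h ⟧ g + var z ≈ g + (var z + (h - g))
      shifted = trans (+-congˡ (reflexive (≡.sym σz≡z)))
        (trans (Shift.witness-shift σ (C.translation h ∘h σ) (λ x → refl) z var-agree z-second)
               (+-congˡ (reflexive (≡.trans (≡.cong ⟦ C.translation h ⟧ σz≡z) (C.translate-same h)))))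

  witness-≉0 : ¬ g ≈ 0#
  witness-≉0 = C.g≉0 (to 0#) (to 1#)

  witness-irreducible : ∀ p q → p * q ≈ g → ¬ ¬ (Unit (polyRing K m) p ⊎ Unit (polyRing K m) q)
  witness-irreducible = C.irreducible (to 0#) (to 1#)

-- Rows under homomorphisms and the curve in the zero set

hom-≉0 : (K L : Field c ℓ) (κ : FieldHom K L) →
  ∀ {x} → ¬ Field._≈_ K x (Field.0# K) → ¬ Field._≈_ L (⟦ κ ⟧ x) (Field.0# L)
hom-≉0 K L κ {x} x≉0 = FieldProperties.unit⇒≉0 L (unit-hom κ (Field.inverse K x x≉0))

module _ (F : Field c ℓ) {m : ℕ} where
  -- The list is in reverse order: its head acts last, so that a segment is extended on the right by
  -- a cons.
  rowAlong : {R : CommutativeRing d e} → RingHom (polyRing F m) R → MatrixOps.Vector R →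
    List (Matrix (WeakLabel F m)) → MatrixOps.Vector R
  rowAlong τ v []               = v
  rowAlong {R = R} τ v (M ∷ Ms) = rowAlong τ v Ms ·ᵣ mapMatrix (λ l → ⟦ τ ⟧ (⟦_⟧w F l)) M
    where open MatrixOps R

mapVector : {A : Set a} {B : Set b} → (A → B) → A × A → B × B
mapVector f (x , y) = f x , f y

module _ {R : CommutativeRing a b} {R′ : CommutativeRing c d} (h : RingHom R R′) where
  private
    module h = RingHom h
    module R = CommutativeRing R
    module M = MatrixOps R
    module M′ = MatrixOps R′
  open CommutativeRing R′

  dot-hom : ∀ u v → h.⟦ u M.·ᵥ v ⟧ ≈ mapVector h.⟦_⟧ u M′.·ᵥ mapVector h.⟦_⟧ v
  dot-hom u v = trans (h.+-homo _ _) (+-cong (h.*-homo _ _) (h.*-homo _ _))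

  ·-hom : ∀ M v → mapVector h.⟦_⟧ (M M.· v) M′.≈ᵥ mapMatrix h.⟦_⟧ M M′.· mapVector h.⟦_⟧ v
  ·-hom M v = trans (h.+-homo _ _) (+-cong (h.*-homo _ _) (h.*-homo _ _)) ,
              trans (h.+-homo _ _) (+-cong (h.*-homo _ _) (h.*-homo _ _))

  module _ (F : Field e ℓ) {m : ℕ} (τ : RingHom (polyRing F m) R) (τ′ : RingHom (polyRing F m) R′)
           (τ′≈hτ : ∀ p → ⟦ τ′ ⟧ p ≈ h.⟦ ⟦ τ ⟧ p ⟧) where
    rowAlong-hom : ∀ {v v′} → v′ M′.≈ᵥ mapVector h.⟦_⟧ v → ∀ Ms →
      rowAlong F τ′ v′ Ms M′.≈ᵥ mapVector h.⟦_⟧ (rowAlong F τ v Ms)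
    rowAlong-hom v≈ [] = v≈
    rowAlong-hom v≈ (M ∷ Ms) with rowAlong-hom v≈ Ms
    ... | x≈ , y≈ =
      trans (+-cong (*-cong x≈ (τ′≈hτ _)) (*-cong y≈ (τ′≈hτ _))) (sym (trans (h.+-homo _ _) (+-cong (h.*-homo _ _) (h.*-homo _ _)))) ,
      trans (+-cong (*-cong x≈ (τ′≈hτ _)) (*-cong y≈ (τ′≈hτ _))) (sym (trans (h.+-homo _ _) (+-cong (h.*-homo _ _) (h.*-homo _ _))))

module _ {m : ℕ} where
  open DecMembership (Fin._≟_ {m}) using (_∈?_)

  outside : List (Fin m) → Fin m → Bool
  outside S i = not ⌊ i ∈? S ⌋

  outside-∈ : ∀ {S i} → i ∈ S → outside S i ≡ false
  outside-∈ {S} {i} i∈S with i ∈? S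
  ... | yes _  = ≡.refl
  ... | no i∉S = contradiction i∈S i∉S

  outside-∉ : ∀ {S i} → i ∉ S → outside S i ≡ true
  outside-∉ {S} {i} i∉S with i ∈? S
  ... | yes i∈S = contradiction i∈S i∉S
  ... | no _    = ≡.refl

  outside-false : ∀ {S i} → outside S i ≡ false → i ∈ S
  outside-false {S} {i} eq with i ∈? S
  ... | yes i∈S = i∈S
  outside-false () | no _

-- A curve t ↦ (x , z) = (t , y(t)) inside the zero set of the witness; all other
-- variables are fixed.  Since y has degree 2, every nonconstant affine element in
-- x and z has positive degree along the curve.
module Curve (F K : Field c ℓ) (ι : FieldHom F K)
  (θ : Fin numVars → Field.Carrier K)
  (x z : Fin numVars) (x-first : isFirst x ≡ true) (z-second : isFirst z ≡ false) where
  private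
    module K = Field K
    module S = PowerSeries K.commutativeRing
    module SR = CommutativeRing S.seriesRing
  open Witness F

  onlyXZ : Fin m → Bool
  onlyXZ i = ⌊ i Fin.≟ x ⌋ ∨ ⌊ i Fin.≟ z ⌋

  τ : RingHom (polyRing F m) (polyRing K m)
  τ = substitution F K ι onlyXZ θ

  x≢z : ¬ x ≡ z
  x≢z ≡.refl with ≡.trans (≡.sym x-first) z-second
  ... | ()

  private
    -- The value zero at the remaining indices is a filler, because `τ` has already replaced those
    -- variables by constants.
    coordinates : S.Series → Fin m → S.Series
    coordinates y i with i Fin.≟ x | i Fin.≟ z
    ... | yes _ | _     = S.t
    ... | no _  | yes _ = y
    ... | no _  | no _  = λ _ → K.0#

    coordinates-x : ∀ y → coordinates y x ≡ S.t
    coordinates-x y with x Fin.≟ x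
    ... | yes _  = ≡.refl
    ... | no x≢x = contradiction ≡.refl x≢x

    coordinates-z : ∀ y → coordinates y z ≡ y
    coordinates-z y with z Fin.≟ x | z Fin.≟ z
    ... | yes z≡x | _       = contradiction (≡.sym z≡x) x≢z
    ... | no _    | yes _   = ≡.refl
    ... | no _    | no z≢z  = contradiction ≡.refl z≢z

    coordinates-agree : ∀ y y′ i → ¬ i ≡ z → coordinates y i ≡ coordinates y′ i
    coordinates-agree y y′ i i≢z with i Fin.≟ x | i Fin.≟ z
    ... | yes _ | _       = ≡.refl
    ... | no _  | yes i≡z = contradiction i≡z i≢z
    ... | no _  | no _    = ≡.refl

    coordinates-0 : ∀ i → ¬ i ≡ x → coordinates (λ _ → K.0#) i ≡ (λ _ → K.0#)
    coordinates-0 i i≢x with i Fin.≟ x | i Fin.≟ z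
    ... | yes i≡x | _     = contradiction i≡x i≢x
    ... | no _    | yes _ = ≡.refl
    ... | no _    | no _  = ≡.refl

    along : (Fin m → S.Series) → RingHom (polyRing K m) S.seriesRing
    along s = eval-hom K S.constant-hom s

    along-τ-agree : ∀ s s′ i → s i ≡ s′ i → ⟦ along s ⟧ (⟦ τ ⟧ (var i)) S.≈ˢ ⟦ along s′ ⟧ (⟦ τ ⟧ (var i))
    along-τ-agree s s′ i eq with onlyXZ i
    ... | true  = SR.reflexive eq
    ... | false = SR.refl

    onlyXZ-x : onlyXZ x ≡ true
    onlyXZ-x with x Fin.≟ x
    ... | yes _  = ≡.refl
    ... | no x≢x = contradiction ≡.refl x≢x

  onlyXZ-z : onlyXZ z ≡ true
  onlyXZ-z with z Fin.≟ x | z Fin.≟ z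
  ... | yes _ | _      = ≡.refl
  ... | no _  | yes _  = ≡.refl
  ... | no _  | no z≢z = contradiction ≡.refl z≢z

  onlyXZ-other : ∀ {i} → ¬ i ≡ x → ¬ i ≡ z → onlyXZ i ≡ false
  onlyXZ-other {i} i≢x i≢z with i Fin.≟ x | i Fin.≟ z
  ... | yes i≡x | _       = contradiction i≡x i≢x
  ... | no _    | yes i≡z = contradiction i≡z i≢z
  ... | no _    | no _    = ≡.refl

  private
    τx≡x : ⟦ τ ⟧ (var x) ≡ var x
    τx≡x = assign-free K onlyXZ θ onlyXZ-x

    τz≡z : ⟦ τ ⟧ (var z) ≡ var z
    τz≡z = assign-free K onlyXZ θ onlyXZ-z

    -- Two stages on the way to `ψ`, one coordinate being changed at a time as `Shift` requires: the
    -- origin, then x = t with z = 0; finally z is set to `y`.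
    ψ₀₀ ψ₀ : RingHom (polyRing K m) S.seriesRing
    ψ₀₀ = along (λ _ _ → K.0#)
    ψ₀  = along (coordinates (λ _ → K.0#))

    at-0 : RingHom (polyRing K m) K.commutativeRing
    at-0 = eval-hom K (id-hom _) (λ _ → K.0#)

    ψ₀₀-constant : ∀ p → ⟦ ψ₀₀ ⟧ p S.≈ˢ S.constant (⟦ at-0 ⟧ p)
    ψ₀₀-constant = poly-hom-unique K ψ₀₀ (S.constant-hom ∘h at-0)
      (λ { i zero → K.refl ; i (suc n) → K.refl }) (λ _ → SR.refl)

    constant-vanishes : ∀ k → VanishesFrom K.commutativeRing (S.constant k) 1
    constant-vanishes k (N.s≤s _) = K.refl

    module ShiftX = Shift (ψ₀₀ ∘h τ) (ψ₀ ∘h τ) (λ _ → SR.refl) x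
      (λ i i≢x → along-τ-agree _ _ i (≡.sym (coordinates-0 i i≢x)))

    first-degree : HasDegree K.commutativeRing (⟦ ψ₀ ⟧ (⟦ τ ⟧ (form true))) 1
    first-degree = S.hasDegree-cong (SR.sym first≈) (S.hasDegree-+ t-degree (constant-vanishes _))
      where
      t-degree : HasDegree K.commutativeRing S.t 1
      t-degree = record { leading≉0 = λ eq → K.0≉1 (K.sym eq) ; vanishes = λ { (N.s≤s (N.s≤s _)) → K.refl } }
      first≈ : ⟦ ψ₀ ⟧ (⟦ τ ⟧ (form true)) S.≈ˢ S.t S.+ˢ S.constant (⟦ at-0 ⟧ (⟦ τ ⟧ (form true)))
      first≈ = SR.trans (SR.sym (SR.+-identityʳ _))
        (SR.trans (SR.+-congˡ (SR.reflexive (≡.sym (≡.cong ⟦ ψ₀₀ ⟧ τx≡x))))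
        (SR.trans (ShiftX.form-shift true x-first)
        (SR.trans (SR.+-cong (ψ₀₀-constant (⟦ τ ⟧ (form true))) (SR.reflexive (≡.trans (≡.cong ⟦ ψ₀ ⟧ τx≡x) (coordinates-x _))))
        (SR.+-comm _ _))))

    second-constant : ⟦ ψ₀ ⟧ (⟦ τ ⟧ (form false)) S.≈ˢ S.constant (⟦ at-0 ⟧ (⟦ τ ⟧ (form false)))
    second-constant = SR.trans (ShiftX.form-fixed false x-first) (ψ₀₀-constant (⟦ τ ⟧ (form false)))

    -- At x = t and z = 0 the restricted polynomial is (t + k)² + k′ for constants k and k′; since z
    -- enters with coefficient 1, setting z to the negative of this value makes it vanish.
    y : S.Series
    y = SR.- ⟦ ψ₀ ⟧ (⟦ τ ⟧ witness)

    y-degree : HasDegree K.commutativeRing y 2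
    y-degree = record
      { leading≉0 = λ eq → S.leading≉0 witness-degree
          (K.trans (K.sym (-‿involutive _)) (K.trans (K.-‿cong eq) -0#≈0#))
      ; vanishes = λ 2<n → K.trans (K.-‿cong (S.vanishes witness-degree 2<n)) -0#≈0# }
      where
      open Algebra.Properties.Ring K.ring
      witness-degree : HasDegree K.commutativeRing (⟦ ψ₀ ⟧ (⟦ τ ⟧ witness)) 2
      witness-degree = S.hasDegree-cong
        (SR.sym (SR.trans (ShiftX.witness-value (ψ₀ ∘h τ)) (SR.+-congˡ second-constant)))
        (S.hasDegree-+ (S.hasDegree-* (FieldProperties.field-isDomain K) first-degree first-degree)
          (λ { (N.s≤s _) → K.refl }))

  ψ : RingHom (polyRing K m) S.seriesRing
  ψ = along (coordinates y)

  ψ-x : HasDegree K.commutativeRing (⟦ ψ ⟧ (var x)) 1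
  ψ-x = S.hasDegree-cong (SR.reflexive (≡.sym (coordinates-x y)))
    (record { leading≉0 = λ eq → K.0≉1 (K.sym eq) ; vanishes = λ { (N.s≤s (N.s≤s _)) → K.refl } })

  ψ-z : HasDegree K.commutativeRing (⟦ ψ ⟧ (var z)) 2
  ψ-z = S.hasDegree-cong (SR.reflexive (≡.sym (coordinates-z y))) y-degree

  ψ-witness : ⟦ ψ ⟧ (⟦ τ ⟧ witness) S.≈ˢ (λ _ → K.0#)
  ψ-witness = SR.trans (SR.sym (SR.+-identityʳ _))
    (SR.trans (SR.+-congˡ (SR.reflexive (≡.sym (≡.trans (≡.cong ⟦ ψ₀ ⟧ τz≡z) (coordinates-z _)))))
    (SR.trans (Shift.witness-shift (ψ₀ ∘h τ) (ψ ∘h τ) (λ _ → SR.refl) z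
                 (λ i i≢z → along-τ-agree _ _ i (coordinates-agree _ y i i≢z)) z-second)
    (SR.trans (SR.+-congˡ (SR.reflexive (≡.trans (≡.cong ⟦ ψ ⟧ τz≡z) (coordinates-z y))))
    (SR.-‿inverseʳ _))))

-- Regular segments do not compute restrictions

module Descent (F : Field c ℓ) where
  open Witness F
  private
    module F = Field F
    Lab = WeakLabel F m

  -- Two assignments occur because the matrices are known to be regular relative to `S` over `K`,
  -- while the identity to be refuted holds only after the larger set `S′` is fixed over `K′`.
  module Segment (K K′ : Field c ℓ)
    (ι : FieldHom F K) (ι′ : FieldHom F K′) (κ : FieldHom K K′)
    (ι′≈κι : ∀ k → Field._≈_ K′ (⟦ ι′ ⟧ k) (⟦ κ ⟧ (⟦ ι ⟧ k)))
    (S S′ : List (Fin m)) (θ : Fin m → Field.Carrier K) (θ′ : Fin m → Field.Carrier K′)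
    (S⊆S′ : ∀ {i} → i ∈ S → i ∈ S′) (agrees : ∀ {i} → i ∈ S → Field._≈_ K′ (θ′ i) (⟦ κ ⟧ (θ i)))
    (x z : Fin m) (x-first : isFirst x ≡ true) (z-second : isFirst z ≡ false) (x∉S′ : x ∉ S′) (z∉S′ : z ∉ S′) where
    private
      module K = Field K
      module K′ = Field K′
      module P′ = CommutativeRing (polyRing K′ m)
      module M′ = MatrixOps (polyRing K′ m)
      σ′ = substitution F K′ ι′ (outside S′) θ′
      module FV = FixedVariables F K ι S θ
      module KS = PowerSeries K′.commutativeRing

      open Curve F K′ ι′ θ′ x z x-first z-second
      module CD = ConstantDeterminant K′ (con-hom K′ m) (var x) (var z) ψ (λ _ → CommutativeRing.refl KS.seriesRing) ψ-x ψ-z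

      fixed-by-S′ : ∀ {i} → i ∈ S′ → onlyXZ i ≡ false
      fixed-by-S′ {i} i∈S′ = onlyXZ-other {i} (λ { ≡.refl → x∉S′ i∈S′ }) (λ { ≡.refl → z∉S′ i∈S′ })

      open Refinement F K′ K′ ι′ ι′ (id-hom _) (λ _ → K′.refl) (outside S′) onlyXZ θ′ θ′
        (λ i eq → fixed-by-S′ {i} (outside-false {S = S′} eq) , K′.refl)

      -- A pivot other than x and z becomes a constant, which `inSpan-pencil` permits: nothing there
      -- requires its affine form to be nonconstant.
      affine : Fin m → CD.Affine
      affine i with i Fin.≟ x | i Fin.≟ z
      ... | yes _ | _     = CD.affine K′.1# K′.0# K′.0#
      ... | no _  | yes _ = CD.affine K′.0# K′.1# K′.0#
      ... | no _  | no _  = CD.affine K′.0# K′.0# (θ′ i)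

      affine-value : ∀ i → ⟦ τ ⟧ (var i) P′.≈ CD.⟪ affine i ⟫
      affine-value i with i Fin.≟ x | i Fin.≟ z
      ... | yes ≡.refl | _ = P′.sym (P′.trans (P′.+-identityʳ _)
        (P′.trans (P′.+-cong (P′.*-identityˡ _) (_≋_.zeroˡ _)) (P′.+-identityʳ _)))
      ... | no _ | yes ≡.refl = P′.sym (P′.trans (P′.+-identityʳ _)
        (P′.trans (P′.+-cong (_≋_.zeroˡ _) (P′.*-identityˡ _)) (P′.+-identityˡ _)))
      ... | no _ | no _ = P′.sym (P′.trans
        (P′.+-congʳ (P′.trans (P′.+-cong (_≋_.zeroˡ _) (_≋_.zeroˡ _)) (P′.+-identityʳ _))) (P′.+-identityˡ _))

      τ-fixed : ∀ {j} → j ∈ S → ⟦ τ ⟧ (var j) P′.≈ con (⟦ κ ⟧ (θ j))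
      τ-fixed j∈S = P′.trans (P′.reflexive (assign-fixed K′ onlyXZ θ′ (fixed-by-S′ (S⊆S′ j∈S)))) (con-cong (agrees j∈S))

      module Ev = FV.Evaluation (con-hom K′ m ∘h κ) τ (λ k → con-cong (ι′≈κι k)) τ-fixed

      κ-det : ∀ M → ⟦ κ ⟧ (FieldMatrices.det K M) K′.≈ FieldMatrices.det K′ (mapMatrix ⟦ κ ⟧ M)
      κ-det (matrix p q r s) = K′.trans (κ.+-homo _ _) (K′.+-cong (κ.*-homo p s) (K′.trans (κ.-‿homo _) (K′.-‿cong (κ.*-homo q r))))
        where module κ = RingHom κ

      κ-mixedDet : ∀ M N → ⟦ κ ⟧ (FieldMatrices.mixedDet K M N) K′.≈ FieldMatrices.mixedDet K′ (mapMatrix ⟦ κ ⟧ M) (mapMatrix ⟦ κ ⟧ N)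
      κ-mixedDet (matrix p q r s) (matrix p′ q′ r′ s′) =
        K′.trans (κ.+-homo _ _) (K′.+-cong (two p s′ p′ s) (K′.trans (κ.-‿homo _) (K′.-‿cong (two q r′ q′ r))))
        where
        module κ = RingHom κ
        two : ∀ x y z w → κ.⟦ x K.* y K.+ z K.* w ⟧ K′.≈ κ.⟦ x ⟧ K′.* κ.⟦ y ⟧ K′.+ κ.⟦ z ⟧ K′.* κ.⟦ w ⟧
        two x y z w = K′.trans (κ.+-homo _ _) (K′.+-cong (κ.*-homo x y) (κ.*-homo z w))

      pencil : ∀ {M} (reg : FV.Regular M) → let open FV.Regular reg in
        CD.IsPencil (mapMatrix (λ l → ⟦ τ ⟧ (⟦_⟧w F l)) M) (mapMatrix ⟦ κ ⟧ A) (mapMatrix ⟦ κ ⟧ B) CD.⟪ affine pivot ⟫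
      pencil reg = (entry (proj₁ (proj₁ linear)) , entry (proj₂ (proj₁ linear))) ,
                   (entry (proj₁ (proj₂ linear)) , entry (proj₂ (proj₂ linear)))
        where
        open FV.Regular reg
        entry : ∀ {l a b} → FV.Linear pivot l a b →
          ⟦ τ ⟧ (⟦_⟧w F l) P′.≈ con (⟦ κ ⟧ a) P′.+ con (⟦ κ ⟧ b) P′.* CD.⟪ affine pivot ⟫
        entry lin = P′.trans (Ev.linear-value lin) (P′.+-congˡ (P′.*-congˡ (affine-value pivot)))

    module _ (v : K.Carrier × K.Carrier) (v≉0 : ¬ (proj₁ v K.≈ K.0# × proj₂ v K.≈ K.0#)) where
      private
        v′ : M′.Vector
        v′ = mapVector (λ k → con (⟦ κ ⟧ k)) v

        κv≉0 : ¬ (⟦ κ ⟧ (proj₁ v) K′.≈ K′.0# × ⟦ κ ⟧ (proj₂ v) K′.≈ K′.0#)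
        κv≉0 (v₁≈0 , v₂≈0) = ¬¬-excluded-middle λ
          { (no v₁≉0) → hom-≉0 K K′ κ v₁≉0 v₁≈0
          ; (yes v₁≈0) → hom-≉0 K K′ κ (λ v₂≈0 → v≉0 (v₁≈0 , v₂≈0)) v₂≈0 }

        row-inSpan : ∀ {Ms} → All FV.Regular Ms → ¬ ¬ CD.InSpan (rowAlong F τ v′ Ms)
        row-inSpan [] k = CD.inSpan-constant (mapVector ⟦ κ ⟧ v) κv≉0 k
        row-inSpan (reg ∷ regs) k = row-inSpan regs λ row∈ →
          CD.inSpan-pencil (mapMatrix ⟦ κ ⟧ A) (mapMatrix ⟦ κ ⟧ B) (affine pivot) (pencil reg)
            (λ eq → hom-≉0 K K′ κ detA≉0 (K′.trans (κ-det A) eq))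
            (K′.trans (K′.sym (κ-mixedDet A B)) (K′.trans (RingHom.⟦⟧-cong κ mixedDet≈0) (RingHom.0-homo κ)))
            (K′.trans (K′.sym (κ-det B)) (K′.trans (RingHom.⟦⟧-cong κ detB≈0) (RingHom.0-homo κ)))
            row∈ k
          where open FV.Regular reg

      -- All variables but x and z are fixed as well. Along the curve the restricted polynomial
      -- vanishes and the image of u stays invertible, so the dot product vanishes there; by
      -- `inSpan-ψ-injective` it is zero already as a polynomial, and then so is the restriction,
      -- which still contains z with coefficient 1.
      witness-not-regular : ∀ {Ms} → All FV.Regular Ms → ∀ w {u} → Unit (polyRing K′ m) u →
        ¬ ⟦ σ′ ⟧ witness P′.≈ u P′.* (rowAlong F σ′ v′ Ms M′.·ᵥ mapVector con w)
      witness-not-regular {Ms} regs w {u} u-unit eq = row-inSpan regs λ row∈ →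
        CD.inSpan-ψ-injective w row∈ (unit-cancel KS.seriesRing (unit-hom (ψ ∘h refine) u-unit)
            (S′.trans (S′.sym (RingHom.*-homo ψ (⟦ refine ⟧ u) dot)) (S′.trans (S′.sym (RingHom.⟦⟧-cong ψ τ-witness≈)) ψ-witness)))
          λ dot≈0 → RestrictedWitness.witness-≉0 F K′ ι′ onlyXZ θ′ z z-second onlyXZ-z
            (P′.trans τ-witness≈ (P′.trans (P′.*-congˡ dot≈0) (P′.zeroʳ _)))
        where
        module S′ = CommutativeRing KS.seriesRing
        dot = rowAlong F τ v′ Ms M′.·ᵥ mapVector con w
        τ-witness≈ : ⟦ τ ⟧ witness P′.≈ ⟦ refine ⟧ u P′.* dot
        τ-witness≈ = P′.trans (refine-substitution witness)
          (P′.trans (RingHom.⟦⟧-cong refine eq)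
          (P′.*-congˡ (P′.trans (dot-hom refine (rowAlong F σ′ v′ Ms) (mapVector con w))
            (M′.·ᵥ-cong (P′.sym (proj₁ rows) , P′.sym (proj₂ rows)) (P′.refl , P′.refl)))))
          where
          rows : rowAlong F τ v′ Ms M′.≈ᵥ mapVector ⟦ refine ⟧ (rowAlong F σ′ v′ Ms)
          rows = rowAlong-hom refine F σ′ τ refine-substitution (P′.refl , P′.refl) Ms

-- Descent through the singular matrices

module WitnessNotWeak (F : Field c ℓ) where
  open Witness F
  open Descent F
  private
    module F = Field F
    module PF = CommutativeRing (polyRing F m)
    module MF = MatrixOps (polyRing F m)
    Lab = WeakLabel F m
  open WeakMatrices F m using (column; weak-as-matrices)

  free-first : ∀ S → length S N.< 9 → ∃ λ x → isFirst x ≡ true × x ∉ S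
  free-first S |S|<9 with avoids (_↑ˡ 9) (λ {i} {j} → FinP.↑ˡ-injective 9 i j) S |S|<9
  ... | i , i∉S = i ↑ˡ 9 , isFirst-↑ˡ i , i∉S

  free-second : ∀ S → length S N.< 9 → ∃ λ z → isFirst z ≡ false × z ∉ S
  free-second S |S|<9 with avoids (9 ↑ʳ_) (λ {i} {j} → FinP.↑ʳ-injective 9 i j) S |S|<9
  ... | i , i∉S = 9 ↑ʳ i , isFirst-↑ʳ i , i∉S

  variablesOf : Lab → List (Fin m)
  variablesOf (wconst β)   = []
  variablesOf (wlin i α β) = i ∷ []

  matrixVariables : Matrix Lab → List (Fin m)
  matrixVariables (matrix p q r s) = (variablesOf p ++ variablesOf q) ++ (variablesOf r ++ variablesOf s)

  matrixVariables≤4 : ∀ M → length (matrixVariables M) N.≤ 4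
  matrixVariables≤4 (matrix p q r s) = append≤ (variablesOf p ++ variablesOf q)
    (append≤ (variablesOf p) (label≤ p) (label≤ q)) (append≤ (variablesOf r) (label≤ r) (label≤ s))
    where
    label≤ : ∀ l → length (variablesOf l) N.≤ 1
    label≤ (wconst β)   = N.z≤n
    label≤ (wlin i α β) = N.s≤s N.z≤n
    append≤ : ∀ (xs : List (Fin m)) {ys k n} → length xs N.≤ k → length ys N.≤ n → length (xs ++ ys) N.≤ k N.+ n
    append≤ xs xs≤ ys≤ = NP.≤-trans (NP.≤-reflexive (length-++ xs)) (NP.+-mono-≤ xs≤ ys≤)

  module _ (K : Field c ℓ) (ι : FieldHom F K) (θ : Fin m → Field.Carrier K) where
    private
      module K = Field K
      module P = CommutativeRing (polyRing K m)

    fixed-label : ∀ S l → (∀ {i} → i ∈ variablesOf l → i ∈ S) →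
      ⟦ substitution F K ι (outside S) θ ⟧ (⟦_⟧w F l) P.≈ con (valueOf F K ⟦ ι ⟧ θ l)
    fixed-label S (wconst β)   l⊆S = P.refl
    fixed-label S (wlin i α β) l⊆S = P.trans
      (P.+-congʳ (P.trans (P.*-congˡ (P.reflexive (assign-fixed K (outside S) θ (outside-∈ (l⊆S (here ≡.refl))))))
                          (P.sym (con-* _ _))))
      (P.sym (con-+ _ _))

    module OuterSplit (S : List (Fin m)) (M : Matrix Lab) (M⊆S : ∀ {i} → i ∈ matrixVariables M → i ∈ S)
      (a b : K.Carrier × K.Carrier) (outer : FieldMatrices.OuterProduct K (matrixAt F K ⟦ ι ⟧ θ M) a b) where
      private
        σ = substitution F K ι (outside S) θ
        module MK = MatrixOps (polyRing K m)
        open Solver (polyRing K m)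

      -- Once its variables are fixed the matrix is the constant a bᵀ, so u M v = (u · a) (b · v).
      factor : ∀ (u v : MK.Vector) →
        u MK.·ᵥ (mapMatrix (λ l → ⟦ σ ⟧ (⟦_⟧w F l)) M MK.· v) P.≈
        (u MK.·ᵥ mapVector con a) P.* (mapVector con b MK.·ᵥ v)
      factor = go M M⊆S outer
        where
        go : ∀ M → (∀ {i} → i ∈ matrixVariables M → i ∈ S) → FieldMatrices.OuterProduct K (matrixAt F K ⟦ ι ⟧ θ M) a b →
          ∀ (u v : MK.Vector) →
          u MK.·ᵥ (mapMatrix (λ l → ⟦ σ ⟧ (⟦_⟧w F l)) M MK.· v) P.≈
          (u MK.·ᵥ mapVector con a) P.* (mapVector con b MK.·ᵥ v)
        go (matrix p q r s) M⊆S ((p≈ , q≈) , (r≈ , s≈)) (u₁ , u₂) (v₁ , v₂) = P.trans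
          (P.+-cong (P.*-congˡ (P.+-cong (P.*-congʳ (entry p p≈ (λ i∈ → M⊆S (∈-++⁺ˡ (∈-++⁺ˡ i∈)))))
                                         (P.*-congʳ (entry q q≈ (λ i∈ → M⊆S (∈-++⁺ˡ (∈-++⁺ʳ (variablesOf p) i∈)))))))
                    (P.*-congˡ (P.+-cong (P.*-congʳ (entry r r≈ (λ i∈ → M⊆S (∈-++⁺ʳ (variablesOf p ++ variablesOf q) (∈-++⁺ˡ i∈)))))
                                         (P.*-congʳ (entry s s≈ (λ i∈ → M⊆S (∈-++⁺ʳ (variablesOf p ++ variablesOf q) (∈-++⁺ʳ (variablesOf r) i∈))))))))
          (solve 8 (λ u₁ u₂ v₁ v₂ a₁ a₂ b₁ b₂ →
            u₁ :* (a₁ :* b₁ :* v₁ :+ a₁ :* b₂ :* v₂) :+ u₂ :* (a₂ :* b₁ :* v₁ :+ a₂ :* b₂ :* v₂)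
            := (u₁ :* a₁ :+ u₂ :* a₂) :* (b₁ :* v₁ :+ b₂ :* v₂)) P.refl u₁ u₂ v₁ v₂ _ _ _ _)
          where
          entry : ∀ l {x y} → valueOf F K ⟦ ι ⟧ θ l K.≈ x K.* y → (∀ {i} → i ∈ variablesOf l → i ∈ S) →
            ⟦ σ ⟧ (⟦_⟧w F l) P.≈ con x P.* con y
          entry l l≈ l⊆S = P.trans (fixed-label S l l⊆S) (P.trans (con-cong l≈) (con-* _ _))

  module SingularStep (K L : Field c ℓ) (ι : FieldHom F K) (κ : FieldHom K L)
    (S : List (Fin m)) (|S|≤4 : length S N.≤ 4) (θ : Fin m → Field.Carrier K) (θ′ : Fin m → Field.Carrier L)
    (agrees : ∀ {i} → i ∈ S → Field._≈_ L (θ′ i) (⟦ κ ⟧ (θ i))) where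
    private
      module K = Field K
      module L = Field L
      module P = CommutativeRing (polyRing K m)
      module MK = MatrixOps (polyRing K m)
      module PL = CommutativeRing (polyRing L m)
      module ML = MatrixOps (polyRing L m)
      σ = substitution F K ι (outside S) θ

    module Split (M : Matrix Lab) (Ms : List (Matrix Lab))
      (row : MF.Vector) (row≈ : row MF.·ᵥ column (M ∷ Ms) PF.≈ witness)
      (v : K.Carrier × K.Carrier) (v≉0 : ¬ (proj₁ v K.≈ K.0# × proj₂ v K.≈ K.0#))
      {segment : List (Matrix Lab)} (regs : All (FixedVariables.Regular F K ι S θ) segment)
      {u : P.Carrier} (u-unit : Unit (polyRing K m) u)
      (eq : ⟦ σ ⟧ witness P.≈ u P.* (rowAlong F σ (mapVector con v) segment MK.·ᵥ mapVector ⟦ σ ⟧ (column (M ∷ Ms))))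
      (a b : L.Carrier × L.Carrier)
      (outer : FieldMatrices.OuterProduct L (matrixAt F L (λ k → ⟦ κ ⟧ (⟦ ι ⟧ k)) θ′ M) a b) where
      private
        ι′ = κ ∘h ι
        S′ = matrixVariables M
        S″ = S ++ S′
        σ′ = substitution F L ι′ (outside S′) θ′
        σ″ = substitution F L ι′ (outside S″) θ′

        |S′|≤4 : length S′ N.≤ 4
        |S′|≤4 = matrixVariables≤4 M

        |S″|<9 : length S″ N.< 9
        |S″|<9 = N.s≤s (NP.≤-trans (NP.≤-reflexive (length-++ S)) (NP.+-mono-≤ |S|≤4 |S′|≤4))

        module R = Refinement F K L ι ι′ κ (λ _ → L.refl) (outside S) (outside S″) θ θ′
          (λ i i-fixed → outside-∈ (∈-++⁺ˡ (outside-false {S = S} i-fixed)) , agrees (outside-false {S = S} i-fixed))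
        module R′ = Refinement F L L ι′ ι′ (id-hom _) (λ _ → L.refl) (outside S′) (outside S″) θ′ θ′
          (λ i i-fixed → outside-∈ (∈-++⁺ʳ S (outside-false {S = S′} i-fixed)) , L.refl)

        after″ : PL.Carrier
        after″ = mapVector con b ML.·ᵥ mapVector ⟦ σ″ ⟧ (column Ms)

        module Split′ = OuterSplit L ι′ θ′ S′ M (λ i∈ → i∈) a b outer
        module Split″ = OuterSplit L ι′ θ′ S″ M (λ i∈ → ∈-++⁺ʳ S i∈) a b outer

      before after : PL.Carrier
      before = mapVector ⟦ σ′ ⟧ row ML.·ᵥ mapVector con a
      after  = mapVector con b ML.·ᵥ mapVector ⟦ σ′ ⟧ (column Ms)

      before*after : before PL.* after PL.≈ ⟦ σ′ ⟧ witness
      before*after = PL.sym (PL.trans (RingHom.⟦⟧-cong σ′ (PF.sym row≈))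
        (PL.trans (dot-hom σ′ row (column (M ∷ Ms)))
        (PL.trans (ML.·ᵥ-cong (PL.refl , PL.refl) (·-hom σ′ (mapMatrix (⟦_⟧w F) M) (column Ms)))
        (Split′.factor (mapVector ⟦ σ′ ⟧ row) (mapVector ⟦ σ′ ⟧ (column Ms))))))

      private
        v″ : ML.Vector
        v″ = mapVector (λ k → con (⟦ κ ⟧ k)) v

        prior : PL.Carrier
        prior = rowAlong F σ″ v″ segment ML.·ᵥ mapVector con a

        rows : rowAlong F σ″ v″ segment ML.≈ᵥ mapVector ⟦ R.refine ⟧ (rowAlong F σ (mapVector con v) segment)
        rows = rowAlong-hom R.refine F σ σ″ R.refine-substitution (PL.refl , PL.refl) segment

        columns : mapVector ⟦ R.refine ⟧ (mapVector ⟦ σ ⟧ (column (M ∷ Ms))) ML.≈ᵥ mapVector ⟦ σ″ ⟧ (column (M ∷ Ms))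
        columns = PL.sym (R.refine-substitution (proj₁ (column (M ∷ Ms)))) , PL.sym (R.refine-substitution (proj₂ (column (M ∷ Ms))))

        dot≈ : ⟦ R.refine ⟧ (rowAlong F σ (mapVector con v) segment MK.·ᵥ mapVector ⟦ σ ⟧ (column (M ∷ Ms))) PL.≈ prior PL.* after″
        dot≈ = PL.trans (dot-hom R.refine (rowAlong F σ (mapVector con v) segment) (mapVector ⟦ σ ⟧ (column (M ∷ Ms))))
          (PL.trans (ML.·ᵥ-cong (PL.sym (proj₁ rows) , PL.sym (proj₂ rows))
            (PL.trans (proj₁ columns) (proj₁ (·-hom σ″ (mapMatrix (⟦_⟧w F) M) (column Ms))) ,
             PL.trans (proj₂ columns) (proj₂ (·-hom σ″ (mapMatrix (⟦_⟧w F) M) (column Ms)))))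
          (Split″.factor (rowAlong F σ″ v″ segment) (mapVector ⟦ σ″ ⟧ (column Ms))))

        segment″ : ⟦ σ″ ⟧ witness PL.≈ (⟦ R.refine ⟧ u PL.* after″) PL.* prior
        segment″ = PL.trans (R.refine-substitution witness) (PL.trans (RingHom.⟦⟧-cong R.refine eq)
          (PL.trans (PL.*-congˡ dot≈)
          (PL.trans (PL.*-congˡ (PL.*-comm prior after″)) (PL.sym (PL.*-assoc (⟦ R.refine ⟧ u) after″ prior)))))

        after″≈ : after″ PL.≈ ⟦ R′.refine ⟧ after
        after″≈ = PL.trans (ML.·ᵥ-cong (PL.refl , PL.refl) (R′.refine-substitution (proj₁ (column Ms)) , R′.refine-substitution (proj₂ (column Ms))))
          (PL.sym (dot-hom R′.refine (mapVector con b) (mapVector ⟦ σ′ ⟧ (column Ms))))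

        after″-unit : Unit (polyRing L m) after → Unit (polyRing L m) after″
        after″-unit after-unit with unit-hom R′.refine after-unit
        ... | w , after-w≈1 = w , PL.trans (PL.*-congʳ after″≈) after-w≈1

      -- With the variables of `S` and of `M` all fixed, a unit `after` would leave a unit times the
      -- regular segment between the constant vectors `v` and `a`.
      after-not-unit : ¬ Unit (polyRing L m) after
      after-not-unit after-unit =
        let x , x-first , x∉S″ = free-first S″ |S″|<9
            z , z-second , z∉S″ = free-second S″ |S″|<9
        in Segment.witness-not-regular K L ι ι′ κ (λ _ → L.refl) S S″ θ θ′ ∈-++⁺ˡ agrees
             x z x-first z-second x∉S″ z∉S″ v v≉0 regs a
             (unit-* (polyRing L m) (unit-hom R.refine u-unit) (after″-unit after-unit)) segment″

      -- With only the variables of `M` fixed, `before` and `after` are the factors of an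
      -- irreducible polynomial.
      before-unit : ¬ ¬ Unit (polyRing L m) before
      before-unit k =
        let z , z-second , z∉S′ = free-second S′ (N.s≤s (NP.≤-trans |S′|≤4 (NP.m≤m+n 4 4)))
        in RestrictedWitness.witness-irreducible F L ι′ (outside S′) θ′ z z-second (outside-∉ z∉S′) before after before*after λ
          { (inj₂ after-unit) → after-not-unit after-unit ; (inj₁ unit) → k unit }

      -- Otherwise `after`, and with it the restricted polynomial, would be zero. The next segment
      -- starts from `b`, which must therefore be nonzero.
      b≉0 : ¬ (proj₁ b L.≈ L.0# × proj₂ b L.≈ L.0#)
      b≉0 (b₁≈0 , b₂≈0) =
        let z , z-second , z∉S′ = free-second S′ (N.s≤s (NP.≤-trans |S′|≤4 (NP.m≤m+n 4 4)))
        in RestrictedWitness.witness-≉0 F L ι′ (outside S′) θ′ z z-second (outside-∉ z∉S′) (PL.trans (PL.sym before*after)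
             (PL.trans (PL.*-congˡ (PL.trans (PL.+-cong (vanish b₁≈0) (vanish b₂≈0)) (PL.+-identityʳ _))) (PL.zeroʳ _)))
        where
        vanish : ∀ {k y} → k L.≈ L.0# → con k PL.* y PL.≈ PL.0#
        vanish {y = y} k≈0 = PL.trans (PL.*-congʳ (con-cong k≈0)) (_≋_.zeroˡ y)

  -- Restricted to S, the witness is a unit times a product that starts from the
  -- constant vector v and passes through regular matrices, then through Ms.  At the
  -- next matrix M that can be made singular, fixing also its variables shows that the
  -- product after M is not a unit; so when only the variables of M are fixed, it is
  -- the product before M that is a unit, and the old restriction can be dropped.
  Obstruction : List (Matrix Lab) → Set (lsuc (c ⊔ ℓ))
  Obstruction Ms = ∀ (K : Field c ℓ)
    (let module K = Field K
         module P = CommutativeRing (polyRing K m)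
         module MK = MatrixOps (polyRing K m))
    (ι : FieldHom F K) (S : List (Fin m)) (θ : Fin m → K.Carrier)
    (let σ = substitution F K ι (outside S) θ) → length S N.≤ 4 →
    ∀ row → row MF.·ᵥ column Ms PF.≈ witness →
    ∀ v → ¬ (proj₁ v K.≈ K.0# × proj₂ v K.≈ K.0#) →
    ∀ {segment} → All (FixedVariables.Regular F K ι S θ) segment → ∀ {u} → Unit (polyRing K m) u →
    ¬ ⟦ σ ⟧ witness P.≈ u P.* (rowAlong F σ (mapVector con v) segment MK.·ᵥ mapVector ⟦ σ ⟧ (column Ms))

  obstruction-[] : Obstruction []
  obstruction-[] K ι S θ |S|≤4 row _ v v≉0 regs u-unit eq =
    let x , x-first , x∉S = free-first S |S|<9
        z , z-second , z∉S = free-second S |S|<9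
    in Segment.witness-not-regular K K ι ι (id-hom _) (λ _ → K.refl) S S θ θ (λ i∈S → i∈S) (λ _ → K.refl)
         x z x-first z-second x∉S z∉S v v≉0 regs (K.1# , K.0#) u-unit
         (P.trans eq (P.*-congˡ (MK.·ᵥ-cong (P.refl , P.refl) (con-cong (RingHom.1-homo ι) , con-cong (RingHom.0-homo ι)))))
    where
    module K = Field K
    module P = CommutativeRing (polyRing K m)
    module MK = MatrixOps (polyRing K m)
    |S|<9 : length S N.< 9
    |S|<9 = N.s≤s (NP.≤-trans |S|≤4 (NP.m≤m+n 4 4))
  obstruction-∷ : ∀ M Ms → Obstruction Ms → Obstruction (M ∷ Ms)
  obstruction-∷ M Ms obstruction K ι S θ |S|≤4 row row≈ v v≉0 {segment} regs {u} u-unit eq =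
    FixedVariables.singular-or-regular F K ι S θ Fin.zero M λ
      { (inj₂ reg) → obstruction K ι S θ |S|≤4 row′ row′≈ v v≉0 (reg ∷ regs) u-unit
          (P.trans eq (P.*-congˡ (P.trans (MK.·ᵥ-cong (P.refl , P.refl) (·-hom σ (mapMatrix (⟦_⟧w F) M) (column Ms)))
            (P.sym (MK.·-assoc (rowAlong F σ (mapVector con v) segment) (mapMatrix (λ l → ⟦ σ ⟧ (⟦_⟧w F l)) M) (mapVector ⟦ σ ⟧ (column Ms)))))))
      ; (inj₁ record { extension = L ; θ′ = θ′ ; agrees = agrees ; det≈0 = det≈0 }) →
          let open FieldExtension L in
          FieldMatrices.rank-one field′ (matrixAt F field′ (λ k → ⟦ embedding ⟧ (⟦ ι ⟧ k)) θ′ M) det≈0 λ (a , b , outer) →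
          let module Step = SingularStep.Split K field′ ι embedding S |S|≤4 θ θ′ agrees M Ms row row≈ v v≉0 regs u-unit eq a b outer in
          Step.before-unit λ before-unit →
          -- The new segment is empty and starts from `b`, with the unit `before` in front. `S` is
          -- replaced and not enlarged, so the bound 4 persists; only the field grows.
          obstruction field′ (embedding ∘h ι) (matrixVariables M) θ′ (matrixVariables≤4 M) row′ row′≈ b Step.b≉0 [] before-unit
            (CommutativeRing.sym (polyRing field′ m) Step.before*after) }
    where
    module P = CommutativeRing (polyRing K m)
    module MK = MatrixOps (polyRing K m)
    σ = substitution F K ι (outside S) θ
    row′ = row MF.·ᵣ mapMatrix (⟦_⟧w F) M
    row′≈ : row′ MF.·ᵥ column Ms PF.≈ witness
    row′≈ = PF.trans (MF.·-assoc row (mapMatrix (⟦_⟧w F) M) (column Ms)) row≈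

  obstruction : ∀ Ms → Obstruction Ms
  obstruction []       = obstruction-[]
  obstruction (M ∷ Ms) = obstruction-∷ M Ms (obstruction Ms)

  no-matrix-product : ∀ Ms → ¬ proj₁ (column Ms) PF.≈ witness
  no-matrix-product Ms Ms≈ = obstruction Ms F (id-hom F.commutativeRing) [] (λ _ → F.0#) N.z≤n MF.e₁ row≈
      (F.1# , F.0#) (λ (1≈0 , _) → F.0≉1 (F.sym 1≈0)) [] {PF.1#} (PF.1# , PF.*-identityˡ PF.1#) σ-witness≈
    where
    σ : RingHom (polyRing F m) (polyRing F m)
    σ = substitution F F (id-hom F.commutativeRing) (outside []) (λ _ → F.0#)
    row≈ : MF.e₁ MF.·ᵥ column Ms PF.≈ witness
    row≈ = PF.trans (PF.+-cong (PF.*-identityˡ _) (_≋_.zeroˡ _)) (PF.trans (PF.+-identityʳ _) Ms≈)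
    σ-witness≈ : ⟦ σ ⟧ witness PF.≈ PF.1# PF.* (MF.e₁ MF.·ᵥ mapVector ⟦ σ ⟧ (column Ms))
    σ-witness≈ = PF.trans (RingHom.⟦⟧-cong σ (PF.sym row≈)) (PF.trans (dot-hom σ MF.e₁ (column Ms)) (PF.sym (PF.*-identityˡ _)))

  witness-not-weak : ¬ VP₂weak F witnessFamily
  witness-not-weak (_ , _ , _ , programs) =
    let A , _ , A≋witness = programs 0
        Ms , Ms≈A = weak-as-matrices A
    in no-matrix-product Ms (PF.trans Ms≈A A≋witness)

theorem5p3 : ∀ {c ℓ : Level} (F : Field c ℓ) →
    (∀ (f : Family F) → VP₂weak F f → VP₂gen F f) ×
    ∃ (λ (f : Family F) → VP₂gen F f × ¬ VP₂weak F f)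
theorem5p3 F = WeakToGeneral.weak⊆general F ,
  Witness.witnessFamily F , Witness.witness-general F , WitnessNotWeak.witness-not-weak F
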